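{- Let $p\ge5$ be a prime. For $c\in\{8,16,-16,32\}$, consider the Vieta graph of the quartic $(x+y+z+t+1)^2=cxyzt$ over $\mathbb{F}_p$. (a) If $c=8$: there are $p^3-1+\sigma(2)\varphi_2(1)p$ vertices in total; there are $4\big(p-3-\sigma(-1)\big)^2$ vertices of degree $3$, $6\big(1+\sigma(-1)\big)(p-3)$ of degree $2$, $4\big(p^2-3p+4+\sigma(-1)\big)$ of degree $1$, and $6p-8$ of degree $0$. (b) If $c=16$: there are $p^3-1-\sigma(-1)p$ vertices in total; there are $4(p-3)^2$ vertices of degree $3$, $6(p-2)$ of degree $2$, $4(p^2-3p+3)$ of degree $1$, and $6p-7$ of degree $0$. (c) If $c=-16$: there are $p^3-1+\sigma(2)\varphi_2(1)p$ vertices in total; there are $4\big(p-3-\sigma(2)\big)^2$ vertices of degree $3$, $6\big(1+\sigma(2)\big)(p-3)$ of degree $2$, $4\big(p^2-3p+4+\sigma(2)\big)$ of degree $1$, and $6p-8$ of degree $0$. (d) If $c=32$: there are $p^3-1+\varphi_2(1)p$ vertices in total; there are $4\big(p-3-\sigma(2)\big)^2$ vertices of degree $3$, $6\big(1+\sigma(2)\big)(p-3)$ of degree $2$, $4\big(p^2-3p+4+\sigma(2)\big)$ of degree $1$, and $6p-8$ of degree $0$.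
   Context: $\sigma:\mathbb{F}_p\to\{ -1,0,1\}\subset\mathbb{Z}$ denotes the quadratic character: $\sigma(a)=1$ if $a$ is a nonzero square, $\sigma(a)=-1$ if $a$ is a non-square, $\sigma(0)=0$. The Jacobsthal sum is $\varphi_2(1)=\sum_{x\in\mathbb{F}_p}\sigma(x^3+x)$. Let $f(x_1,x_2,x_3,x_4)=(x_1+x_2+x_3+x_4+1)^2-c\,x_1x_2x_3x_4$, which is monic quadratic in each variable. The $i$-th Vieta flip of a solution $x=(x_1,\dots,x_4)\in\mathbb{F}_p^4$ of $f=0$ is the solution obtained by replacing $x_i$ by the other root $x_i'=x_i-(\partial_i f)(x)$ of $f=0$ viewed as a quadratic equation in $x_i$. The Vieta graph is the finite simple graph whose vertices are the solutions of $f=0$ in $\mathbb{F}_p^4$, where two distinct vertices are joined by an edge whenever one is a Vieta flip of the other. -}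

module Defs where

open import Data.Bool.Base using (if_then_else_)
open import Data.Fin.Base using (Fin; toℕ; fromℕ<)
open import Data.Fin.Patterns using (0F; 1F; 2F; 3F)
open import Data.Fin.Properties using (_≟_; any?)
open import Data.Integer.Base using (ℤ; +_; 0ℤ; 1ℤ; -1ℤ; _%ℕ_; _+_; _*_; _-_)
open import Data.Integer.DivMod using (n%ℕd<d)
open import Data.Integer.Properties using (+-0-commutativeMonoid)
open import Data.List.Base using (List; []; _∷_; allFin; cartesianProductWith; filter; length)
open import Data.List.Membership.Propositional using (_∈_)
open import Data.List.Membership.Propositional.Properties using (∈-allFin; ∈-cartesianProductWith⁺)
open import Data.List.Relation.Unary.All using ([])
open import Data.List.Relation.Unary.AllPairs using ([]; _∷_)
open import Data.List.Relation.Unary.Any using (here)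
open import Data.List.Relation.Unary.Unique.Propositional using (Unique)
open import Data.List.Relation.Unary.Unique.Propositional.Properties
  using (allFin⁺; cartesianProductWith⁺)
open import Data.Nat.Base using (ℕ; zero; suc; NonZero)
import Data.Nat.Properties as ℕ
open import Data.Product.Base using (_×_; ∃-syntax)
open import Data.Sum.Base using (_⊎_)
open import Data.Vec.Base using (Vec; []; _∷_; lookup; _[_]≔_)
open import Data.Vec.Properties using (≡-dec; ∷-injective)
open import Relation.Binary.PropositionalEquality.Core using (_≡_; _≢_; refl)
open import Relation.Nullary.Decidable using (Dec; does; ¬?; _×-dec_; _⊎-dec_)
open import Algebra.Properties.CommutativeMonoid.Sum +-0-commutativeMonoid using (sum)

infixl 6 _+ₚ_ _-ₚ_ _⊕_ _⊖_
infixl 7 _*ₚ_ _⊗_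

-- The ring ℤ/p on the least non-negative residues; a field when p is prime.
𝔽 : ℕ → Set
𝔽 = Fin

reduce : (p : ℕ) .{{_ : NonZero p}} → ℤ → 𝔽 p
reduce p a = fromℕ< (n%ℕd<d a p)

toℤ : ∀ {p} → 𝔽 p → ℤ
toℤ a = + toℕ a

_+ₚ_ _*ₚ_ _-ₚ_ : ∀ {p} .{{_ : NonZero p}} → 𝔽 p → 𝔽 p → 𝔽 p
_+ₚ_ {p} a b = reduce p (toℤ a + toℤ b)
_*ₚ_ {p} a b = reduce p (toℤ a * toℤ b)
_-ₚ_ {p} a b = reduce p (toℤ a - toℤ b)

0ₚ : ∀ {p} .{{_ : NonZero p}} → 𝔽 p
0ₚ {p} = reduce p 0ℤ

Square : ∀ {p} .{{_ : NonZero p}} → 𝔽 p → Set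
Square {p} a = ∃[ b ] b *ₚ b ≡ a

square? : ∀ {p} .{{_ : NonZero p}} (a : 𝔽 p) → Dec (Square a)
square? a = any? λ b → b *ₚ b ≟ a

σ : ∀ {p} .{{_ : NonZero p}} → 𝔽 p → ℤ
σ a = if does (a ≟ 0ₚ) then 0ℤ else if does (square? a) then 1ℤ else -1ℤ

φ₂⟨1⟩ : (p : ℕ) .{{_ : NonZero p}} → ℤ
φ₂⟨1⟩ p = sum {p} λ x → σ (x *ₚ x *ₚ x +ₚ x)

data Poly (n : ℕ) : Set where
  con         : ℤ → Poly n
  var         : Fin n → Poly n
  _⊕_ _⊗_ _⊖_ : Poly n → Poly n → Poly n

eval : ∀ {n p} .{{_ : NonZero p}} → Poly n → Vec (𝔽 p) n → 𝔽 p
eval {p = p} (con a) x = reduce p a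
eval (var i) x = lookup x i
eval (f ⊕ g) x = eval f x +ₚ eval g x
eval (f ⊗ g) x = eval f x *ₚ eval g x
eval (f ⊖ g) x = eval f x -ₚ eval g x

∂ : ∀ {n} → Fin n → Poly n → Poly n
∂ i (con a) = con 0ℤ
∂ i (var j) = con (if does (i ≟ j) then 1ℤ else 0ℤ)
∂ i (f ⊕ g) = ∂ i f ⊕ ∂ i g
∂ i (f ⊗ g) = (∂ i f ⊗ g) ⊕ (f ⊗ ∂ i g)
∂ i (f ⊖ g) = ∂ i f ⊖ ∂ i g

quartic : ℤ → Poly 4
quartic c = s ⊗ s ⊖ con c ⊗ var 0F ⊗ var 1F ⊗ var 2F ⊗ var 3F
  where s = var 0F ⊕ var 1F ⊕ var 2F ⊕ var 3F ⊕ con 1ℤ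

points : (p n : ℕ) → List (Vec (𝔽 p) n)
points p zero    = [] ∷ []
points p (suc n) = cartesianProductWith _∷_ (allFin p) (points p n)

-- Every point occurs exactly once in `points`, so the lengths of the filtered
-- lists below are cardinalities.
points-complete : ∀ {p n} (x : Vec (𝔽 p) n) → x ∈ points p n
points-complete []      = here refl
points-complete (a ∷ x) = ∈-cartesianProductWith⁺ _∷_ (∈-allFin a) (points-complete x)

points-unique : ∀ p n → Unique (points p n)
points-unique p zero    = [] ∷ []
points-unique p (suc n) =
  cartesianProductWith⁺ _∷_ ∷-injective (allFin⁺ p) (points-unique p n)

module VietaGraph (p : ℕ) .{{_ : NonZero p}} (c : ℤ) where

  vertices : List (Vec (𝔽 p) 4)
  vertices = filter (λ x → eval (quartic c) x ≟ 0ₚ) (points p 4)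

  vietaFlip : Fin 4 → Vec (𝔽 p) 4 → Vec (𝔽 p) 4
  vietaFlip i x = x [ i ]≔ (lookup x i -ₚ eval (∂ i (quartic c)) x)

  Adjacent : Vec (𝔽 p) 4 → Vec (𝔽 p) 4 → Set
  Adjacent x y = x ≢ y × ((∃[ i ] y ≡ vietaFlip i x) ⊎ (∃[ i ] x ≡ vietaFlip i y))

  adjacent? : ∀ x y → Dec (Adjacent x y)
  adjacent? x y =
    ¬? (x ≟ᵥ y) ×-dec (any? (λ i → y ≟ᵥ vietaFlip i x) ⊎-dec any? (λ i → x ≟ᵥ vietaFlip i y))
    where _≟ᵥ_ = ≡-dec _≟_

  degree : Vec (𝔽 p) 4 → ℕ
  degree x = length (filter (adjacent? x) vertices)

  #vertices : ℕ
  #vertices = length vertices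

  #degree : ℕ → ℕ
  #degree d = length (filter (λ x → degree x ℕ.≟ d) vertices)

open VietaGraph public using (#vertices; #degree)

{-# OPTIONS --safe #-}
module Submission where

-- Degrees. Put s = x₁ + x₂ + x₃ + x₄ + 1. At a solution xᵢ ∂ᵢf = s (2xᵢ - s). Hence if s = 0 the i-th flip
-- moves x exactly when the other three coordinates are nonzero, while if s ≠ 0 all coordinates are nonzero
-- and the i-th flip moves x exactly when 2xᵢ ≠ s. Counting solutions for which j prescribed coordinates
-- satisfy 2xᵢ = s leads to M = 1 + σ(e), the number of a with c a (-a - 1) = 4, where c e = c - 16, so that
-- e = -1, 0, 2, 1/2 for c = 8, 16, -16, 32; inclusion-exclusion then gives the degrees. All counts are sums
-- over 𝔽ₚ of products of indicators δ of zero.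
--
-- Vertices. Solving f = 0 for the last coordinate gives p³ plus a threefold character sum. Two of its
-- summations run over quadratic polynomials and are elementary; what remains is ∑ σ(v (v - 1) (v - e)).
-- For e = 0 this is -σ(-1). Otherwise an affine substitution turns it into ∑ σ(x³ - x), up to a factor
-- σ(2) if e = 1/2, and the 2-isogeny x ↦ x - 1/x shows that ∑ σ(x³ - x) = σ(2) φ₂(1).

open import Defs
open import Algebra.Bundles using (CommutativeRing)
open import Algebra.Core using (Op₁; Op₂)
import Algebra.Properties.Semiring.Sum as SemiringSum
import Algebra.Solver.Ring as RingSolver
open import Algebra.Solver.Ring.AlmostCommutativeRing
  using (AlmostCommutativeRing; fromCommutativeRing; _-Raw-AlmostCommutative⟶_)
open import Algebra.Structures using (IsCommutativeRing)
open import Data.Bool.Base using (Bool; true; false; if_then_else_; _∨_)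
open import Data.Fin.Base using (Fin; zero; suc; toℕ)
open import Data.Fin.Patterns using (0F; 1F; 2F; 3F)
open import Data.Fin.Permutation using (permutation)
open import Data.Fin.Properties using (_≟_; all?; any?; toℕ-injective; toℕ-fromℕ<; toℕ<n)
open import Data.Integer.Base
  using (ℤ; +_; -_; _+_; _-_; _*_; _^_; _%ℕ_; _/ℕ_; ∣_∣; 0ℤ; 1ℤ; -1ℤ; +≤+; -≤+)
import Data.Integer.Base as ℤ using (_≤_)
open import Data.Integer.DivMod using (n%ℕd<d; a≡a%ℕn+[a/ℕn]*n)
open import Data.Integer.Properties using (+-*-commutativeRing)
import Data.Integer.Properties as ℤ
open import Data.Integer.Solver using (module +-*-Solver)
open import Data.List.Base
  using (List; []; _∷_; _++_; allFin; cartesianProductWith; filter; length; map; tabulate)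
open import Data.List.Membership.Propositional using (_∈_)
open import Data.List.Membership.Propositional.Properties
  using (∈-allFin; ∈-filter⁺; ∈-filter⁻; ∈-map⁺; ∈-map⁻)
open import Data.List.Membership.Propositional.Properties.WithK using (unique∧set⇒bag)
open import Data.List.Properties using (length-map)
open import Data.List.Relation.Binary.BagAndSetEquality using (∼bag⇒↭)
open import Data.List.Relation.Binary.Permutation.Propositional.Properties using (↭-length)
open import Data.List.Relation.Unary.All as All using (All; []; _∷_)
import Data.List.Relation.Unary.All.Properties as All
open import Data.List.Relation.Unary.AllPairs using ([]; _∷_)
open import Data.List.Relation.Unary.Unique.Propositional using (Unique)
import Data.List.Relation.Unary.Unique.Propositional.Properties as Unique
open import Data.Maybe.Base as Maybe using (Maybe)
open import Data.Nat.Base as ℕ using (ℕ; NonZero; zero; suc; _≤_)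
open import Data.Nat.Coprimality using (prime⇒coprime; coprime-Bézout)
import Data.Nat.DivMod as ℕ using (m<n⇒m%n≡m)
open import Data.Nat.GCD using (module Bézout)
open import Data.Nat.Primality using (Prime)
import Data.Nat.Properties as ℕ
open import Data.Product.Base using (_×_; _,_; proj₁; proj₂; ∃-syntax)
open import Data.Vec.Base using (Vec; []; _∷_; lookup; _[_]≔_)
open import Data.Vec.Properties using (lookup∘update; lookup∘update′; []≔-lookup)
open import Data.Sum.Base using (inj₁; inj₂)
open import Function.Base using (_∘_)
open import Function.Bundles using (_⇔_; mk⇔)
open import Relation.Binary.PropositionalEquality
open import Relation.Nullary using (¬_; Dec; yes; no; does; contradiction)
open import Relation.Nullary.Decidable using (¬?; _×-dec_; dec-true; dec⇒maybe; map′)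

open SemiringSum (CommutativeRing.semiring +-*-commutativeRing)
  using (sum; sum-cong-≗; ∑-distrib-+; ∑-comm; sum-permute; *-distribˡ-sum; *-distribʳ-sum)
open ≡-Reasoning

-- One parameter governs both counts: e = 1 - 16/c is the discriminant of a² + a + 4/c, whose roots
-- `M` counts, and it is also the third root of the cubic in the vertex count. It enters through c e
-- = c - 16, a relation that can be checked and used without dividing; in the code `k` is the image
-- of c in the field. Since c (1 - e) = 16 is invertible, e = 1 never occurs, and the cubic v (v -
-- 1) (v - e) is singular only for c = 16. The values -1, 2, 1/2 are exactly those for which 0, 1, e
-- form an arithmetic progression in some order, that is, an affine image of the roots -1, 0, 1 of
-- x³ - x; this singles out the other three c. A condition 2xᵢ = s is easy to sum over when it is
-- imposed, as it eliminates a variable, but not when it is forbidden; hence inclusion-exclusion for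
-- s ≠ 0. On the hyperplane s = 0 vanishing and nonvanishing coordinates are equally easy, and exact
-- patterns are summed directly.

module Z = +-*-Solver

-- Indicators and finite sums of integers

iverson : ∀ {a} {A : Set a} → Dec A → ℤ
iverson d = if does d then 1ℤ else 0ℤ

iverson-true : ∀ {a} {A : Set a} (d : Dec A) → A → iverson d ≡ 1ℤ
iverson-true (yes _) _ = refl
iverson-true (no ¬x) x = contradiction x ¬x

iverson-false : ∀ {a} {A : Set a} (d : Dec A) → ¬ A → iverson d ≡ 0ℤ
iverson-false (yes x) ¬x = contradiction x ¬x
iverson-false (no _)  _  = refl

iverson-cong : ∀ {a b} {A : Set a} {B : Set b} (d : Dec A) (e : Dec B) →
               (A → B) → (B → A) → iverson d ≡ iverson e
iverson-cong (yes x) e f _ = sym (iverson-true e (f x))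
iverson-cong (no ¬x) e _ g = sym (iverson-false e (¬x ∘ g))

sum-zero : ∀ {n} {f : Fin n → ℤ} → (∀ x → f x ≡ 0ℤ) → sum f ≡ 0ℤ
sum-zero {zero}  f≡0 = refl
sum-zero {suc n} f≡0 = cong₂ _+_ (f≡0 zero) (sum-zero (f≡0 ∘ suc))

sum-iverson-≟ : ∀ {n} (a : Fin n) → sum (λ x → iverson (x ≟ a)) ≡ 1ℤ
sum-iverson-≟ {suc n} zero    = cong (_+_ 1ℤ) (sum-zero {n} λ _ → refl)
sum-iverson-≟ {suc n} (suc a) = trans (ℤ.+-identityˡ _) (sum-iverson-≟ a)

sum-1 : ∀ n → sum {n} (λ _ → 1ℤ) ≡ + n
sum-1 zero    = refl
sum-1 (suc n) = cong (_+_ 1ℤ) (sum-1 n)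

sum-nonPositive : ∀ {n} {f : Fin n → ℤ} → (∀ x → f x ℤ.≤ 0ℤ) → sum f ℤ.≤ 0ℤ
sum-nonPositive {zero}  f≤0 = ℤ.≤-refl
sum-nonPositive {suc n} f≤0 = ℤ.+-mono-≤ (f≤0 zero) (sum-nonPositive (f≤0 ∘ suc))

+-nonPositive-≡0ˡ : ∀ {i j} → i ℤ.≤ 0ℤ → j ℤ.≤ 0ℤ → i + j ≡ 0ℤ → i ≡ 0ℤ
+-nonPositive-≡0ˡ {i} {j} i≤0 j≤0 i+j≡0 = ℤ.≤-antisym i≤0
  (subst₂ ℤ._≤_ i+j≡0 (ℤ.+-identityʳ i) (ℤ.+-monoʳ-≤ i j≤0))

-- Turns the vanishing of a character sum into information on each of its terms; the
-- multiplicativity of `χ` rests on it.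
sum-nonPositive-≡0 : ∀ {n} {f : Fin n → ℤ} → (∀ x → f x ℤ.≤ 0ℤ) → sum f ≡ 0ℤ → ∀ x → f x ≡ 0ℤ
sum-nonPositive-≡0 f≤0 eq zero = +-nonPositive-≡0ˡ (f≤0 zero) (sum-nonPositive (f≤0 ∘ suc)) eq
sum-nonPositive-≡0 {f = f} f≤0 eq (suc x) = sum-nonPositive-≡0 (f≤0 ∘ suc)
  (+-nonPositive-≡0ˡ (sum-nonPositive (f≤0 ∘ suc)) (f≤0 zero) (trans (ℤ.+-comm (sum (f ∘ suc)) (f zero)) eq)) x

-- ι is kept as a field so that the ring solver can compute with integer coefficients, and 0⁻¹ = 0 makes
-- inversion a permutation.
record OddField (p : ℕ) : Set where
  infixl 6 _⊞_ _⊟_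
  infixl 7 _⊠_
  infix 8 ⊟_ _⁻¹
  field
    _⊞_ _⊠_           : Op₂ (Fin p)
    ⊟_ _⁻¹            : Op₁ (Fin p)
    0# 1#             : Fin p
    isCommutativeRing : IsCommutativeRing _≡_ _⊞_ _⊠_ ⊟_ 0# 1#
    *-inverseʳ        : ∀ {x} → x ≢ 0# → x ⊠ x ⁻¹ ≡ 1#
    0⁻¹≡0             : 0# ⁻¹ ≡ 0#
    ι                 : ℤ → Fin p
    ι-+               : ∀ a b → ι (a + b) ≡ ι a ⊞ ι b
    ι-*               : ∀ a b → ι (a * b) ≡ ι a ⊠ ι b
    ι-neg             : ∀ a → ι (- a) ≡ ⊟ ι a
    ι-0               : ι 0ℤ ≡ 0#
    ι-1               : ι 1ℤ ≡ 1#
    2≢0               : ι (+ 2) ≢ 0#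

  _⊟_ : Op₂ (Fin p)
  x ⊟ y = x ⊞ ⊟ y

  commutativeRing : CommutativeRing _ _
  commutativeRing = record { isCommutativeRing = isCommutativeRing }

-- Arithmetic, indicators and summation over a finite field of odd order

module FieldTheory {p : ℕ} (F : OddField p) where

  open OddField F
  private module K = CommutativeRing commutativeRing

  almostCommutativeRing : AlmostCommutativeRing _ _
  almostCommutativeRing = fromCommutativeRing commutativeRing

  ι-morphism : CommutativeRing.rawRing +-*-commutativeRing -Raw-AlmostCommutative⟶ almostCommutativeRing
  ι-morphism = record
    { ⟦_⟧ = ι ; +-homo = ι-+ ; *-homo = ι-* ; -‿homo = ι-neg ; 0-homo = ι-0 ; 1-homo = ι-1 }

  -- Sound but incomplete, since `ι` is not injective. The identities given to the solver hold with
  -- integer coefficients, so comparing integers is enough.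
  _coeff≟_ : ∀ a b → Maybe (ι a ≡ ι b)
  a coeff≟ b = Maybe.map (cong ι) (dec⇒maybe (a ℤ.≟ b))

  module S = RingSolver (CommutativeRing.rawRing +-*-commutativeRing) almostCommutativeRing
    ι-morphism _coeff≟_
  open S using (_:+_; _:*_; _:-_; :-_; _:=_; con)

  # : ℕ → Fin p
  # n = ι (+ n)

  1≢0 : 1# ≢ 0#
  1≢0 1≡0 = 2≢0 (begin
    # 2          ≡⟨ S.solve 0 (con (+ 2) := con 1ℤ :+ con 1ℤ) refl ⟩
    ι 1ℤ ⊞ ι 1ℤ ≡⟨ cong₂ _⊞_ (trans ι-1 1≡0) (trans ι-1 1≡0) ⟩
    0# ⊞ 0#     ≡⟨ K.+-identityˡ 0# ⟩
    0#           ∎)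

  x⊟y≡0⇒x≡y : ∀ {x y} → x ⊟ y ≡ 0# → x ≡ y
  x⊟y≡0⇒x≡y {x} {y} eq = begin
    x           ≡⟨ S.solve 2 (λ x y → x := (x :- y) :+ y) refl x y ⟩
    x ⊟ y ⊞ y ≡⟨ cong (_⊞ y) eq ⟩
    0# ⊞ y     ≡⟨ K.+-identityˡ y ⟩
    y           ∎

  x≡y⇒x⊟y≡0 : ∀ {x y} → x ≡ y → x ⊟ y ≡ 0#
  x≡y⇒x⊟y≡0 refl = K.-‿inverseʳ _

  *-cancelˡ-0 : ∀ {x y} → x ≢ 0# → x ⊠ y ≡ 0# → y ≡ 0#
  *-cancelˡ-0 {x} {y} x≢0 xy≡0 = begin
    y               ≡⟨ K.*-identityˡ y ⟨
    1# ⊠ y         ≡⟨ cong (_⊠ y) (*-inverseʳ x≢0) ⟨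
    x ⊠ x ⁻¹ ⊠ y ≡⟨ S.solve 3 (λ x i y → x :* i :* y := i :* (x :* y)) refl x (x ⁻¹) y ⟩
    x ⁻¹ ⊠ (x ⊠ y) ≡⟨ cong (x ⁻¹ ⊠_) xy≡0 ⟩
    x ⁻¹ ⊠ 0#     ≡⟨ K.zeroʳ _ ⟩
    0#              ∎

  *-≢0 : ∀ {x y} → x ≢ 0# → y ≢ 0# → x ⊠ y ≢ 0#
  *-≢0 x≢0 y≢0 xy≡0 = y≢0 (*-cancelˡ-0 x≢0 xy≡0)

  *-≢0ˡ : ∀ {x y} → x ⊠ y ≢ 0# → x ≢ 0#
  *-≢0ˡ xy≢0 refl = xy≢0 (K.zeroˡ _)

  *-≢0ʳ : ∀ {x y} → x ⊠ y ≢ 0# → y ≢ 0#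
  *-≢0ʳ xy≢0 refl = xy≢0 (K.zeroʳ _)

  factor-0 : ∀ {x y} c → y ≡ c ⊠ x → x ≡ 0# → y ≡ 0#
  factor-0 c y≡cx refl = trans y≡cx (K.zeroʳ c)

  factor-0-⇔ : ∀ {x y} c → c ≢ 0# → y ≡ c ⊠ x → (x ≡ 0# → y ≡ 0#) × (y ≡ 0# → x ≡ 0#)
  factor-0-⇔ c c≢0 y≡cx = factor-0 c y≡cx , λ y≡0 → *-cancelˡ-0 c≢0 (trans (sym y≡cx) y≡0)

  ⁻¹-≢0 : ∀ {x} → x ≢ 0# → x ⁻¹ ≢ 0#
  ⁻¹-≢0 x≢0 = *-≢0ʳ (λ eq → 1≢0 (trans (sym (*-inverseʳ x≢0)) eq))

  ⊟-≢0 : ∀ {x} → x ≢ 0# → ⊟ x ≢ 0#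
  ⊟-≢0 {x} x≢0 eq = x≢0 (factor-0 (ι -1ℤ) (S.solve 1 (λ x → x := con -1ℤ :* (:- x)) refl x) eq)

  -1≢0 : ι -1ℤ ≢ 0#
  -1≢0 eq = 1≢0 (factor-0 (ι -1ℤ) (trans (sym ι-1) (ι-* -1ℤ -1ℤ)) eq)

  -- Only powers of 2 have to be units: they come from completing squares, from the values of c, and
  -- from c - 16.
  2*≢0 : ∀ m {n} → ι (+ m) ≢ 0# → + 2 * + m ≡ n → ι n ≢ 0#
  2*≢0 m m≢0 refl eq = *-≢0 2≢0 m≢0 (trans (sym (ι-* _ _)) eq)

  4≢0 : # 4 ≢ 0#
  4≢0 = 2*≢0 2 2≢0 refl

  8≢0 : # 8 ≢ 0#
  8≢0 = 2*≢0 4 4≢0 refl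

  16≢0 : # 16 ≢ 0#
  16≢0 = 2*≢0 8 8≢0 refl

  32≢0 : # 32 ≢ 0#
  32≢0 = 2*≢0 16 16≢0 refl

  δ w : Fin p → ℤ
  δ x = iverson (x ≟ 0#)
  w x = 1ℤ - δ x

  δ-≡0 : ∀ {x} → x ≡ 0# → δ x ≡ 1ℤ
  δ-≡0 = iverson-true (_ ≟ 0#)

  δ-≢0 : ∀ {x} → x ≢ 0# → δ x ≡ 0ℤ
  δ-≢0 = iverson-false (_ ≟ 0#)

  w-≡0 : ∀ {x} → x ≡ 0# → w x ≡ 0ℤ
  w-≡0 x≡0 = cong (_-_ 1ℤ) (δ-≡0 x≡0)

  w-≢0 : ∀ {x} → x ≢ 0# → w x ≡ 1ℤ
  w-≢0 x≢0 = cong (_-_ 1ℤ) (δ-≢0 x≢0)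

  δ-cong : ∀ {x y} → (x ≡ 0# → y ≡ 0#) × (y ≡ 0# → x ≡ 0#) → δ x ≡ δ y
  δ-cong (to , from) = iverson-cong (_ ≟ 0#) (_ ≟ 0#) to from

  δ-scale : ∀ {x y} c → c ≢ 0# → y ≡ c ⊠ x → δ y ≡ δ x
  δ-scale c c≢0 eq = sym (δ-cong (factor-0-⇔ c c≢0 eq))

  -- Lets an equation that holds only where `x` vanishes be used inside a sum: elsewhere both sides
  -- are 0. `w-guard` is the complementary rule.
  δ-guard : ∀ x {g h} → (x ≡ 0# → g ≡ h) → δ x * g ≡ δ x * h
  δ-guard x eq with x ≟ 0#
  ... | yes x≡0 = cong (1ℤ *_) (eq x≡0)
  ... | no  _   = refl

  w-guard : ∀ x {g h} → (x ≢ 0# → g ≡ h) → w x * g ≡ w x * h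
  w-guard x eq with x ≟ 0#
  ... | yes _   = refl
  ... | no  x≢0 = cong (1ℤ *_) (eq x≢0)

  w-* : ∀ x y → w (x ⊠ y) ≡ w x * w y
  w-* x y = by-cases (x ≟ 0#) (y ≟ 0#)
    where
    by-cases : Dec (x ≡ 0#) → Dec (y ≡ 0#) → w (x ⊠ y) ≡ w x * w y
    by-cases (yes refl) _ = trans (w-≡0 (K.zeroˡ y)) (sym (cong (_* w y) (w-≡0 refl)))
    by-cases (no x≢0) (yes refl) =
      trans (w-≡0 (K.zeroʳ x)) (sym (trans (cong (w x *_) (w-≡0 refl)) (ℤ.*-zeroʳ (w x))))
    by-cases (no x≢0) (no y≢0) = trans (w-≢0 (*-≢0 x≢0 y≢0)) (sym (cong₂ _*_ (w-≢0 x≢0) (w-≢0 y≢0)))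

  δ-1-w : ∀ x → δ x ≡ 1ℤ - w x
  δ-1-w x = Z.solve 1 (λ d → d Z.:= Z.con 1ℤ Z.:- (Z.con 1ℤ Z.:- d)) refl (δ x)

  δ-* : ∀ x y → δ (x ⊠ y) ≡ δ x + δ y - δ x * δ y
  δ-* x y = begin
    δ (x ⊠ y)        ≡⟨ δ-1-w (x ⊠ y) ⟩
    1ℤ - w (x ⊠ y)  ≡⟨ cong (_-_ 1ℤ) (w-* x y) ⟩
    1ℤ - w x * w y   ≡⟨ Z.solve 2 (λ a b → let 1' = Z.con 1ℤ in
                           1' Z.:- (1' Z.:- a) Z.:* (1' Z.:- b) Z.:= a Z.:+ b Z.:- a Z.:* b) refl (δ x) (δ y) ⟩
    δ x + δ y - δ x * δ y ∎

  P : ℤ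
  P = + p

  ∑ : (Fin p → ℤ) → ℤ
  ∑ = sum

  ∑-cong : ∀ {f g : Fin p → ℤ} → (∀ x → f x ≡ g x) → ∑ f ≡ ∑ g
  ∑-cong = sum-cong-≗

  ∑-+ : ∀ (f g : Fin p → ℤ) → ∑ (λ x → f x + g x) ≡ ∑ f + ∑ g
  ∑-+ = ∑-distrib-+

  ∑-*ˡ : ∀ c (f : Fin p → ℤ) → ∑ (λ x → c * f x) ≡ c * ∑ f
  ∑-*ˡ c f = sym (*-distribˡ-sum c f)

  ∑-*ʳ : ∀ (f : Fin p → ℤ) c → ∑ (λ x → f x * c) ≡ ∑ f * c
  ∑-*ʳ f c = sym (*-distribʳ-sum c f)

  ∑-neg : ∀ (f : Fin p → ℤ) → ∑ (λ x → - f x) ≡ - ∑ f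
  ∑-neg f = begin
    ∑ (λ x → - f x)    ≡⟨ ∑-cong (λ x → sym (ℤ.-1*i≡-i (f x))) ⟩
    ∑ (λ x → -1ℤ * f x) ≡⟨ ∑-*ˡ -1ℤ f ⟩
    -1ℤ * ∑ f           ≡⟨ ℤ.-1*i≡-i (∑ f) ⟩
    - ∑ f ∎

  ∑-- : ∀ (f g : Fin p → ℤ) → ∑ (λ x → f x - g x) ≡ ∑ f - ∑ g
  ∑-- f g = trans (∑-+ f (λ x → - g x)) (cong (_+_ (∑ f)) (∑-neg g))

  ∑-const : ∀ c → ∑ (λ _ → c) ≡ P * c
  ∑-const c = begin
    ∑ (λ _ → c)      ≡⟨ ∑-cong {g = λ _ → 1ℤ * c} (λ _ → sym (ℤ.*-identityˡ c)) ⟩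
    ∑ (λ _ → 1ℤ * c) ≡⟨ ∑-*ʳ (λ _ → 1ℤ) c ⟩
    ∑ (λ _ → 1ℤ) * c ≡⟨ cong (_* c) (sum-1 p) ⟩
    P * c ∎

  ∑-swap : ∀ (f : Fin p → Fin p → ℤ) → ∑ (λ x → ∑ (f x)) ≡ ∑ (λ y → ∑ (λ x → f x y))
  ∑-swap = ∑-comm

  ∑-bij : ∀ (f f⁻ : Fin p → Fin p) → (∀ x → f (f⁻ x) ≡ x) → (∀ x → f⁻ (f x) ≡ x) →
          ∀ g → ∑ (g ∘ f) ≡ ∑ g
  ∑-bij f f⁻ ff⁻ f⁻f g = sym (sum-permute g (permutation f f⁻ ff⁻ f⁻f))

  -- Asking only that `a` be the one zero of `f` lets the same lemma eliminate a variable through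
  -- any equation that determines it.
  ∑-select : ∀ a (f : Fin p → Fin p) → (∀ x → (f x ≡ 0# → x ≡ a)) → f a ≡ 0# →
             ∀ g → ∑ (λ x → δ (f x) * g x) ≡ g a
  ∑-select a f unique root g = begin
    ∑ (λ x → δ (f x) * g x)            ≡⟨ ∑-cong (λ x → δ-guard (f x) (λ eq → cong g (unique x eq))) ⟩
    ∑ (λ x → δ (f x) * g a)            ≡⟨ ∑-*ʳ (δ ∘ f) (g a) ⟩
    ∑ (δ ∘ f) * g a                    ≡⟨ cong (_* g a) (∑-cong λ x →
                                          iverson-cong (f x ≟ 0#) (x ≟ a) (unique x) (λ { refl → root })) ⟩
    ∑ (λ x → iverson (x ≟ a)) * g a    ≡⟨ cong (_* g a) (sum-iverson-≟ a) ⟩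
    1ℤ * g a                           ≡⟨ ℤ.*-identityˡ _ ⟩
    g a ∎

  ∑-δ⊟ : ∀ a g → ∑ (λ x → δ (x ⊟ a) * g x) ≡ g a
  ∑-δ⊟ a = ∑-select a (_⊟ a) (λ _ → x⊟y≡0⇒x≡y) (K.-‿inverseʳ a)

  ∑-δ : ∀ g → ∑ (λ x → δ x * g x) ≡ g 0#
  ∑-δ = ∑-select 0# (λ x → x) (λ _ eq → eq) refl

  ∑-δ1 : ∑ δ ≡ 1ℤ
  ∑-δ1 = trans (∑-cong λ x → sym (ℤ.*-identityʳ (δ x))) (∑-δ (λ _ → 1ℤ))

  ∑-w : ∑ w ≡ P - 1ℤ
  ∑-w = trans (∑-- (λ _ → 1ℤ) δ) (cong₂ _-_ (trans (∑-const 1ℤ) (ℤ.*-identityʳ P)) ∑-δ1)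

  ∑-scale : ∀ a → a ≢ 0# → ∀ g → ∑ (λ x → g (a ⊠ x)) ≡ ∑ g
  ∑-scale a a≢0 = ∑-bij (a ⊠_) (a ⁻¹ ⊠_)
    (λ x → trans (sym (K.*-assoc a _ x)) (trans (cong (_⊠ x) (*-inverseʳ a≢0)) (K.*-identityˡ x)))
    (λ x → trans (S.solve 3 (λ a i x → i :* (a :* x) := a :* i :* x) refl a (a ⁻¹) x)
                 (trans (cong (_⊠ x) (*-inverseʳ a≢0)) (K.*-identityˡ x)))

  ∑-shift : ∀ a g → ∑ (λ x → g (x ⊞ a)) ≡ ∑ g
  ∑-shift a = ∑-bij (_⊞ a) (_⊟ a)
    (λ x → S.solve 2 (λ x a → x :- a :+ a := x) refl x a)
    (λ x → S.solve 2 (λ x a → x :+ a :- a := x) refl x a)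

  ∑-affine : ∀ a b → a ≢ 0# → ∀ g → ∑ (λ x → g (a ⊠ x ⊞ b)) ≡ ∑ g
  ∑-affine a b a≢0 g = trans (∑-scale a a≢0 (λ x → g (x ⊞ b))) (∑-shift b g)

  -- One formula for the three cases of a x = b: one solution if a ≠ 0, otherwise p or none
  -- according to b.
  ∑-δ-linear : ∀ a b → ∑ (λ x → δ (a ⊠ x ⊟ b)) ≡ w a + P * (δ a * δ b)
  ∑-δ-linear a b with a ≟ 0#
  ... | yes refl = begin
    ∑ (λ x → δ (0# ⊠ x ⊟ b)) ≡⟨ ∑-cong (λ x → δ-scale (ι -1ℤ) -1≢0
                                  (trans (cong (_⊟ b) (K.zeroˡ x)) (trans (K.+-identityˡ _)
                                    (S.solve 1 (λ b → :- b := con -1ℤ :* b) refl b)))) ⟩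
    ∑ (λ _ → δ b)            ≡⟨ ∑-const (δ b) ⟩
    P * δ b
      ≡⟨ Z.solve 2 (λ P d → P Z.:* d Z.:= Z.con 0ℤ Z.:+ P Z.:* (Z.con 1ℤ Z.:* d)) refl P (δ b) ⟩
    0ℤ + P * (1ℤ * δ b) ∎
  ... | no a≢0 = begin
    ∑ (λ x → δ (a ⊠ x ⊟ b)) ≡⟨ ∑-affine a (⊟ b) a≢0 δ ⟩
    ∑ δ                       ≡⟨ ∑-δ1 ⟩
    1ℤ
      ≡⟨ Z.solve 2 (λ P d → Z.con 1ℤ Z.:= Z.con 1ℤ Z.:+ P Z.:* (Z.con 0ℤ Z.:* d)) refl P (δ b) ⟩
    1ℤ + P * (0ℤ * δ b) ∎

  -- Groups the points by the value of `f`; the coefficient of `g v` is the size of the fibre over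
  -- `v`.
  ∑-fibre : ∀ (f : Fin p → Fin p) g → ∑ (g ∘ f) ≡ ∑ (λ v → ∑ (λ x → δ (f x ⊟ v)) * g v)
  ∑-fibre f g = begin
    ∑ (g ∘ f)                              ≡⟨ ∑-cong (λ x → ∑-select (f x) (λ v → f x ⊟ v)
                                                (λ _ eq → sym (x⊟y≡0⇒x≡y eq)) (K.-‿inverseʳ _) g) ⟨
    ∑ (λ x → ∑ (λ v → δ (f x ⊟ v) * g v)) ≡⟨ ∑-swap (λ x v → δ (f x ⊟ v) * g v) ⟩
    ∑ (λ v → ∑ (λ x → δ (f x ⊟ v) * g v)) ≡⟨ ∑-cong (λ v → ∑-*ʳ (λ x → δ (f x ⊟ v)) (g v)) ⟩
    ∑ (λ v → ∑ (λ x → δ (f x ⊟ v)) * g v) ∎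

-- The quadratic character and its sums over quadratic polynomials

module QuadraticCharacter {p : ℕ} (F : OddField p) where

  open OddField F
  open FieldTheory F
  open S using (_:+_; _:*_; _:-_; :-_; _:=_; con)
  private module K = CommutativeRing commutativeRing

  IsSquare : Fin p → Set
  IsSquare a = ∃[ b ] b ⊠ b ≡ a

  isSquare? : ∀ a → Dec (IsSquare a)
  isSquare? a = any? λ b → b ⊠ b ≟ a

  -- Follows the case tree of `σ`, so that over `𝔽 p` the two agree by computation.
  χ : Fin p → ℤ
  χ a = if does (a ≟ 0#) then 0ℤ else if does (isSquare? a) then 1ℤ else -1ℤ

  -- The index `b ⊠ b` makes matching replace the argument by an explicit square.
  data Residue : Fin p → Set where
    isZero      : Residue 0#
    isSquare    : ∀ b → b ≢ 0# → Residue (b ⊠ b)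
    isNonsquare : ∀ {a} → a ≢ 0# → ¬ IsSquare a → Residue a

  residue : ∀ a → Residue a
  residue a with a ≟ 0# | isSquare? a
  ... | yes refl | _            = isZero
  ... | no a≢0   | yes (b , refl) = isSquare b (*-≢0ˡ a≢0)
  ... | no a≢0   | no ¬sq       = isNonsquare a≢0 ¬sq

  χ-0 : ∀ {a} → a ≡ 0# → χ a ≡ 0ℤ
  χ-0 {a} a≡0 with a ≟ 0#
  ... | yes _   = refl
  ... | no  a≢0 = contradiction a≡0 a≢0

  χ-square : ∀ {b} → b ≢ 0# → χ (b ⊠ b) ≡ 1ℤ
  χ-square {b} b≢0 with b ⊠ b ≟ 0# | isSquare? (b ⊠ b)
  ... | yes b²≡0 | _       = contradiction b²≡0 (*-≢0 b≢0 b≢0)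
  ... | no  _    | yes _   = refl
  ... | no  _    | no  ¬sq = contradiction (b , refl) ¬sq

  χ-nonsquare : ∀ {a} → a ≢ 0# → ¬ IsSquare a → χ a ≡ -1ℤ
  χ-nonsquare {a} a≢0 ¬sq with a ≟ 0# | isSquare? a
  ... | yes a≡0 | _      = contradiction a≡0 a≢0
  ... | no  _   | yes sq = contradiction sq ¬sq
  ... | no  _   | no  _  = refl

  χ-square-w : ∀ x → χ (x ⊠ x) ≡ w x
  χ-square-w x = by-cases (x ≟ 0#)
    where
    by-cases : Dec (x ≡ 0#) → χ (x ⊠ x) ≡ w x
    by-cases (yes refl) = trans (χ-0 (K.zeroˡ 0#)) (sym (w-≡0 refl))
    by-cases (no x≢0)   = trans (χ-square x≢0) (sym (w-≢0 x≢0))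

  χ≤1 : ∀ a → χ a ℤ.≤ 1ℤ
  χ≤1 a with does (a ≟ 0#) | does (isSquare? a)
  ... | true  | _     = +≤+ ℕ.z≤n
  ... | false | true  = ℤ.≤-refl
  ... | false | false = -≤+

  χ-*-square : ∀ a {b} → b ≢ 0# → χ (a ⊠ (b ⊠ b)) ≡ χ a
  χ-*-square a {b} b≢0 = by-residue (residue a)
    where
    by-residue : ∀ {a} → Residue a → χ (a ⊠ (b ⊠ b)) ≡ χ a
    by-residue isZero = trans (χ-0 (K.zeroˡ _)) (sym (χ-0 refl))
    by-residue (isSquare c c≢0) = begin
      χ (c ⊠ c ⊠ (b ⊠ b))
        ≡⟨ cong χ (S.solve 2 (λ b c → c :* c :* (b :* b) := (c :* b) :* (c :* b)) refl b c) ⟩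
      χ ((c ⊠ b) ⊠ (c ⊠ b)) ≡⟨ χ-square (*-≢0 c≢0 b≢0) ⟩
      1ℤ                      ≡⟨ χ-square c≢0 ⟨
      χ (c ⊠ c) ∎
    by-residue {a} (isNonsquare a≢0 ¬sq) = trans
      -- A root d of a b² would give the root d / b of a.
      (χ-nonsquare (*-≢0 a≢0 (*-≢0 b≢0 b≢0)) λ (d , d²≡ab²) → ¬sq (d ⊠ b ⁻¹ , (begin
        (d ⊠ b ⁻¹) ⊠ (d ⊠ b ⁻¹)
          ≡⟨ S.solve 2 (λ d i → (d :* i) :* (d :* i) := d :* d :* (i :* i)) refl d (b ⁻¹) ⟩
        d ⊠ d ⊠ (b ⁻¹ ⊠ b ⁻¹)       ≡⟨ cong (_⊠ (b ⁻¹ ⊠ b ⁻¹)) d²≡ab² ⟩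
        a ⊠ (b ⊠ b) ⊠ (b ⁻¹ ⊠ b ⁻¹)
          ≡⟨ S.solve 3 (λ a b i → a :* (b :* b) :* (i :* i) := a :* ((b :* i) :* (b :* i)))
                                          refl a b (b ⁻¹) ⟩
        a ⊠ ((b ⊠ b ⁻¹) ⊠ (b ⊠ b ⁻¹)) ≡⟨ cong (λ u → a ⊠ (u ⊠ u)) (*-inverseʳ b≢0) ⟩
        a ⊠ (1# ⊠ 1#)               ≡⟨ cong (a ⊠_) (K.*-identityˡ 1#) ⟩
        a ⊠ 1#                      ≡⟨ K.*-identityʳ a ⟩
        a ∎)))
      (sym (χ-nonsquare a≢0 ¬sq))

  roots : Fin p → ℤ
  roots a = ∑ λ x → δ (x ⊠ x ⊟ a)

  -- A nonzero square b² has two roots because b ≠ -b, by invertibility of 2; this is `disjoint`,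
  -- which kills the correction term in `δ-*`.
  roots≡1+χ : ∀ a → roots a ≡ 1ℤ + χ a
  roots≡1+χ a = by-residue (residue a)
    where
    by-residue : ∀ {a} → Residue a → roots a ≡ 1ℤ + χ a
    by-residue isZero = begin
      ∑ (λ x → δ (x ⊠ x ⊟ 0#)) ≡⟨ ∑-cong (λ x → δ-cong
                                     ( (λ eq → square≡0 x (x⊟y≡0⇒x≡y eq))
                                     , λ { refl → x≡y⇒x⊟y≡0 (K.zeroˡ 0#) })) ⟩
      ∑ δ                        ≡⟨ ∑-δ1 ⟩
      1ℤ + 0ℤ                    ≡⟨ cong (_+_ 1ℤ) (χ-0 refl) ⟨
      1ℤ + χ 0# ∎
      where
      square≡0 : ∀ x → x ⊠ x ≡ 0# → x ≡ 0#
      square≡0 x x²≡0 with x ≟ 0#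
      ... | yes x≡0 = x≡0
      ... | no  x≢0 = *-cancelˡ-0 x≢0 x²≡0
    by-residue (isSquare b b≢0) = begin
      ∑ (λ x → δ (x ⊠ x ⊟ b ⊠ b))              ≡⟨ ∑-cong split ⟩
      ∑ (λ x → δ (x ⊟ b) + δ (x ⊞ b))          ≡⟨ ∑-+ (λ x → δ (x ⊟ b)) (λ x → δ (x ⊞ b)) ⟩
      ∑ (λ x → δ (x ⊟ b)) + ∑ (λ x → δ (x ⊞ b)) ≡⟨ cong₂ _+_ (∑-shift (⊟ b) δ) (∑-shift b δ) ⟩
      ∑ δ + ∑ δ                                   ≡⟨ cong₂ _+_ ∑-δ1 ∑-δ1 ⟩
      1ℤ + 1ℤ                                     ≡⟨ cong (_+_ 1ℤ) (χ-square b≢0) ⟨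
      1ℤ + χ (b ⊠ b) ∎
      where
      disjoint : ∀ x → x ⊟ b ≡ 0# → δ (x ⊞ b) ≡ 0ℤ
      disjoint x x≡b = δ-≢0 λ x≡-b → *-≢0 2≢0 b≢0 (begin
        # 2 ⊠ b             ≡⟨ S.solve 2 (λ x b → con (+ 2) :* b := x :+ b :- (x :- b)) refl x b ⟩
        x ⊞ b ⊟ (x ⊟ b)   ≡⟨ cong₂ _⊟_ x≡-b x≡b ⟩
        0# ⊟ 0#            ≡⟨ K.-‿inverseʳ 0# ⟩
        0# ∎)
      split : ∀ x → δ (x ⊠ x ⊟ b ⊠ b) ≡ δ (x ⊟ b) + δ (x ⊞ b)
      split x = begin
        δ (x ⊠ x ⊟ b ⊠ b)
          ≡⟨ cong δ (S.solve 2 (λ x b → x :* x :- b :* b := (x :- b) :* (x :+ b)) refl x b) ⟩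
        δ ((x ⊟ b) ⊠ (x ⊞ b)) ≡⟨ δ-* _ _ ⟩
        δ (x ⊟ b) + δ (x ⊞ b) - δ (x ⊟ b) * δ (x ⊞ b)
          ≡⟨ cong (λ t → δ (x ⊟ b) + δ (x ⊞ b) - t) (δ-guard (x ⊟ b) (disjoint x)) ⟩
        δ (x ⊟ b) + δ (x ⊞ b) - δ (x ⊟ b) * 0ℤ
          ≡⟨ Z.solve 2 (λ u v → u Z.:+ v Z.:- u Z.:* Z.con 0ℤ Z.:= u Z.:+ v) refl (δ (x ⊟ b)) (δ (x ⊞ b)) ⟩
        δ (x ⊟ b) + δ (x ⊞ b) ∎
    by-residue {a} (isNonsquare a≢0 ¬sq) = begin
      ∑ (λ x → δ (x ⊠ x ⊟ a)) ≡⟨ ∑-cong (λ x → δ-≢0 (λ eq → ¬sq (x , x⊟y≡0⇒x≡y eq))) ⟩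
      ∑ (λ _ → 0ℤ)             ≡⟨ ∑-const 0ℤ ⟩
      P * 0ℤ                   ≡⟨ ℤ.*-zeroʳ P ⟩
      1ℤ + -1ℤ                 ≡⟨ cong (_+_ 1ℤ) (χ-nonsquare a≢0 ¬sq) ⟨
      1ℤ + χ a ∎

  -- The substitution v = x²: the fibre over v has 1 + χ(v) points.
  ∑-square : ∀ g → ∑ (λ x → g (x ⊠ x)) ≡ ∑ g + ∑ (λ v → χ v * g v)
  ∑-square g = begin
    ∑ (λ x → g (x ⊠ x))            ≡⟨ ∑-fibre (λ x → x ⊠ x) g ⟩
    ∑ (λ v → roots v * g v)         ≡⟨ ∑-cong (λ v → cong (_* g v) (roots≡1+χ v)) ⟩
    ∑ (λ v → (1ℤ + χ v) * g v)
      ≡⟨ ∑-cong (λ v → Z.solve 2 (λ c g → (Z.con 1ℤ Z.:+ c) Z.:* g Z.:= g Z.:+ c Z.:* g)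
                                                  refl (χ v) (g v)) ⟩
    ∑ (λ v → g v + χ v * g v)       ≡⟨ ∑-+ g (λ v → χ v * g v) ⟩
    ∑ g + ∑ (λ v → χ v * g v) ∎

  -- The case g = 1 of `∑-square`, where the left side and the first term on the right are both
  -- `∑ 1` and cancel.
  ∑-χ : ∑ χ ≡ 0ℤ
  ∑-χ = begin
    ∑ χ                  ≡⟨ ∑-cong (λ v → sym (ℤ.*-identityʳ (χ v))) ⟩
    ∑ (λ v → χ v * 1ℤ)   ≡⟨ ℤ.+-identityˡ _ ⟨
    0ℤ + ∑ (λ v → χ v * 1ℤ)   ≡⟨ cong (_+ ∑ (λ v → χ v * 1ℤ)) (ℤ.+-inverseˡ (∑ (λ _ → 1ℤ))) ⟨
    - ∑ (λ _ → 1ℤ) + ∑ (λ _ → 1ℤ) + ∑ (λ v → χ v * 1ℤ) ≡⟨ ℤ.+-assoc (- ∑ (λ _ → 1ℤ)) _ _ ⟩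
    - ∑ (λ _ → 1ℤ) + (∑ (λ _ → 1ℤ) + ∑ (λ v → χ v * 1ℤ)) ≡⟨ cong (_+_ (- ∑ (λ _ → 1ℤ))) (∑-square (λ _ → 1ℤ)) ⟨
    - ∑ (λ _ → 1ℤ) + ∑ (λ _ → 1ℤ) ≡⟨ ℤ.+-inverseˡ (∑ (λ _ → 1ℤ)) ⟩
    0ℤ ∎

  -- χ(ax) + χ(x) is nowhere positive when a is not a square, but its sum over x vanishes.
  χ-nonsquare-nonsquare : ∀ {a b} → a ≢ 0# → ¬ IsSquare a → b ≢ 0# → ¬ IsSquare b → χ (a ⊠ b) ≡ 1ℤ
  χ-nonsquare-nonsquare {a} {b} a≢0 ¬sqa b≢0 ¬sqb = begin
    χ (a ⊠ b)             ≡⟨ Z.solve 1 (λ c → c Z.:= c Z.:+ Z.con -1ℤ Z.:+ Z.con 1ℤ) refl (χ (a ⊠ b)) ⟩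
    χ (a ⊠ b) + -1ℤ + 1ℤ  ≡⟨ cong (λ t → χ (a ⊠ b) + t + 1ℤ) (χ-nonsquare b≢0 ¬sqb) ⟨
    χ (a ⊠ b) + χ b + 1ℤ  ≡⟨ cong (_+ 1ℤ) (sum-nonPositive-≡0 {f = f} (λ x → f≤0 (residue x)) ∑f≡0 b) ⟩
    1ℤ ∎
    where
    f : Fin p → ℤ
    f x = χ (a ⊠ x) + χ x
    ∑f≡0 : ∑ f ≡ 0ℤ
    ∑f≡0 = trans (∑-+ (λ x → χ (a ⊠ x)) χ) (cong₂ _+_ (trans (∑-scale a a≢0 χ) ∑-χ) ∑-χ)
    f≤0 : ∀ {x} → Residue x → f x ℤ.≤ 0ℤ
    f≤0 isZero = ℤ.≤-reflexive (cong₂ _+_ (χ-0 (K.zeroʳ a)) (χ-0 refl))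
    f≤0 (isSquare c c≢0) = ℤ.≤-reflexive
      (cong₂ _+_ (trans (χ-*-square a c≢0) (χ-nonsquare a≢0 ¬sqa)) (χ-square c≢0))
    f≤0 (isNonsquare x≢0 ¬sqx) = ℤ.+-mono-≤ (χ≤1 (a ⊠ _)) (ℤ.≤-reflexive (χ-nonsquare x≢0 ¬sqx))

  χ-* : ∀ a b → χ (a ⊠ b) ≡ χ a * χ b
  χ-* a b = by-residue (residue a) (residue b)
    where
    by-residue : ∀ {a b} → Residue a → Residue b → χ (a ⊠ b) ≡ χ a * χ b
    by-residue {b = b} isZero _ = trans (χ-0 (K.zeroˡ b)) (sym (cong (_* χ b) (χ-0 refl)))
    by-residue {b = b} (isSquare c c≢0) _ = begin
      χ (c ⊠ c ⊠ b)    ≡⟨ cong χ (K.*-comm (c ⊠ c) b) ⟩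
      χ (b ⊠ (c ⊠ c))  ≡⟨ χ-*-square b c≢0 ⟩
      χ b                ≡⟨ ℤ.*-identityˡ (χ b) ⟨
      1ℤ * χ b           ≡⟨ cong (_* χ b) (χ-square c≢0) ⟨
      χ (c ⊠ c) * χ b ∎
    by-residue {a} (isNonsquare _ _) isZero =
      trans (χ-0 (K.zeroʳ a)) (sym (trans (cong (χ a *_) (χ-0 refl)) (ℤ.*-zeroʳ (χ a))))
    by-residue {a} (isNonsquare _ _) (isSquare c c≢0) = begin
      χ (a ⊠ (c ⊠ c))  ≡⟨ χ-*-square a c≢0 ⟩
      χ a                ≡⟨ ℤ.*-identityʳ (χ a) ⟨
      χ a * 1ℤ           ≡⟨ cong (χ a *_) (χ-square c≢0) ⟨
      χ a * χ (c ⊠ c) ∎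
    by-residue (isNonsquare a≢0 ¬sqa) (isNonsquare b≢0 ¬sqb) = trans
      (χ-nonsquare-nonsquare a≢0 ¬sqa b≢0 ¬sqb)
      (sym (cong₂ _*_ (χ-nonsquare a≢0 ¬sqa) (χ-nonsquare b≢0 ¬sqb)))

  χ-≡ : ∀ {a b} c → c ≢ 0# → a ≡ b ⊠ (c ⊠ c) → χ a ≡ χ b
  χ-≡ {b = b} c c≢0 eq = trans (cong χ eq) (χ-*-square b c≢0)

  χ²≡1 : ∀ {a} → a ≢ 0# → χ a * χ a ≡ 1ℤ
  χ²≡1 {a} a≢0 = trans (sym (χ-* a a)) (χ-square a≢0)

  -- Completing the square: four times the polynomial is (2x + m)² minus the discriminant, and x ↦
  -- 2x + m permutes the field.
  ∑-δ-quadratic : ∀ m n → ∑ (λ x → δ (x ⊠ x ⊞ m ⊠ x ⊞ n)) ≡ 1ℤ + χ (m ⊠ m ⊟ # 4 ⊠ n)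
  ∑-δ-quadratic m n = begin
    ∑ (λ x → δ (x ⊠ x ⊞ m ⊠ x ⊞ n))
      ≡⟨ ∑-cong (λ x → sym (δ-scale (# 4) 4≢0 (S.solve 3 (λ x m n →
           let y = con (+ 2) :* x :+ m in
           y :* y :- (m :* m :- con (+ 4) :* n) := con (+ 4) :* (x :* x :+ m :* x :+ n)) refl x m n))) ⟩
    ∑ (λ x → δ ((# 2 ⊠ x ⊞ m) ⊠ (# 2 ⊠ x ⊞ m) ⊟ (m ⊠ m ⊟ # 4 ⊠ n)))
      ≡⟨ ∑-affine (# 2) m 2≢0 (λ y → δ (y ⊠ y ⊟ (m ⊠ m ⊟ # 4 ⊠ n))) ⟩
    roots (m ⊠ m ⊟ # 4 ⊠ n)
      ≡⟨ roots≡1+χ _ ⟩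
    1ℤ + χ (m ⊠ m ⊟ # 4 ⊠ n) ∎

  ⁻¹-involutive : ∀ x → x ⁻¹ ⁻¹ ≡ x
  ⁻¹-involutive x with x ≟ 0#
  ... | yes refl = trans (cong _⁻¹ 0⁻¹≡0) 0⁻¹≡0
  ... | no x≢0 = begin
    x ⁻¹ ⁻¹               ≡⟨ K.*-identityˡ _ ⟨
    1# ⊠ x ⁻¹ ⁻¹          ≡⟨ cong (_⊠ x ⁻¹ ⁻¹) (*-inverseʳ x≢0) ⟨
    x ⊠ x ⁻¹ ⊠ x ⁻¹ ⁻¹    ≡⟨ K.*-assoc x _ _ ⟩
    x ⊠ (x ⁻¹ ⊠ x ⁻¹ ⁻¹)  ≡⟨ cong (x ⊠_) (*-inverseʳ (⁻¹-≢0 x≢0)) ⟩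
    x ⊠ 1#                 ≡⟨ K.*-identityʳ x ⟩
    x ∎

  w-⁻¹ : ∀ x → w (x ⁻¹) ≡ w x
  w-⁻¹ x with x ≟ 0#
  ... | yes refl = w-≡0 0⁻¹≡0
  ... | no x≢0 = w-≢0 (⁻¹-≢0 x≢0)

  -- As 0⁻¹ = 0, inversion permutes the whole field and preserves the weight `w`, so sums over the
  -- units need no index set of their own.
  ∑-⁻¹ : ∀ (g : Fin p → ℤ) → ∑ (λ x → w x * g (x ⁻¹)) ≡ ∑ (λ x → w x * g x)
  ∑-⁻¹ g = trans (∑-cong λ x → cong (_* g (x ⁻¹)) (sym (w-⁻¹ x)))
    (∑-bij _⁻¹ _⁻¹ ⁻¹-involutive ⁻¹-involutive (λ x → w x * g x))

  ∑-w* : ∀ (g : Fin p → ℤ) → ∑ (λ x → w x * g x) ≡ ∑ g - g 0#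
  ∑-w* g = begin
    ∑ (λ x → w x * g x)         ≡⟨ ∑-cong (λ x → Z.solve 2 (λ d g →
                                     (Z.con 1ℤ Z.:- d) Z.:* g Z.:= g Z.:- d Z.:* g) refl (δ x) (g x)) ⟩
    ∑ (λ x → g x - δ x * g x)   ≡⟨ ∑-- g (λ x → δ x * g x) ⟩
    ∑ g - ∑ (λ x → δ x * g x)   ≡⟨ cong (_-_ (∑ g)) (∑-δ g) ⟩
    ∑ g - g 0# ∎


  -- For dividing the argument of `χ` by x²: legitimate where x ≠ 0, while at x = 0 the weight `w x`
  -- accounts for the vanishing left side.
  χ-w-square : ∀ x {y z} → (x ≡ 0# → y ≡ 0#) → (x ≢ 0# → y ≡ z ⊠ (x ⊠ x)) → χ y ≡ w x * χ z
  χ-w-square x {y} {z} at0 off0 = by-cases (x ≟ 0#)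
    where
    by-cases : Dec (x ≡ 0#) → χ y ≡ w x * χ z
    by-cases (yes x≡0) = trans (χ-0 (at0 x≡0)) (sym (cong (_* χ z) (w-≡0 x≡0)))
    by-cases (no x≢0)  = trans (χ-≡ x x≢0 (off0 x≢0))
      (trans (sym (ℤ.*-identityˡ (χ z))) (sym (cong (_* χ z) (w-≢0 x≢0))))

  -- For k ≠ 0, dividing by x² gives χ(1 - k u) with u = 1/x. Over all u this sums to 0, and the
  -- missing term u = 0 is χ(1) = 1. For k = 0 the argument is x².
  ∑-χ-x[x-k] : ∀ k → ∑ (λ x → χ (x ⊠ (x ⊟ k))) ≡ P * δ k - 1ℤ
  ∑-χ-x[x-k] k = by-cases (k ≟ 0#)
    where
    by-cases : Dec (k ≡ 0#) → ∑ (λ x → χ (x ⊠ (x ⊟ k))) ≡ P * δ k - 1ℤ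
    by-cases (yes refl) = begin
      ∑ (λ x → χ (x ⊠ (x ⊟ 0#))) ≡⟨ ∑-cong (λ x → trans (cong (χ ∘ (x ⊠_))
                                       (trans (cong (λ z → x ⊞ z) (trans (sym (K.+-identityˡ _))
                                           (K.-‿inverseʳ 0#)))
                                              (K.+-identityʳ x))) (χ-square-w x)) ⟩
      ∑ w                          ≡⟨ ∑-w ⟩
      P - 1ℤ                       ≡⟨ cong (_- 1ℤ) (trans (cong (P *_) (δ-≡0 refl)) (ℤ.*-identityʳ P)) ⟨
      P * δ 0# - 1ℤ ∎
    by-cases (no k≢0) = begin
      ∑ (λ x → χ (x ⊠ (x ⊟ k)))           ≡⟨ ∑-cong (λ x → χ-w-square x (λ { refl → K.zeroˡ _ }) (divide x)) ⟩
      ∑ (λ x → w x * χ (⊟ k ⊠ x ⁻¹ ⊞ 1#)) ≡⟨ ∑-⁻¹ (λ x → χ (⊟ k ⊠ x ⊞ 1#)) ⟩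
      ∑ (λ x → w x * χ (⊟ k ⊠ x ⊞ 1#))    ≡⟨ ∑-w* (λ x → χ (⊟ k ⊠ x ⊞ 1#)) ⟩
      ∑ (λ x → χ (⊟ k ⊠ x ⊞ 1#)) - χ (⊟ k ⊠ 0# ⊞ 1#)
        ≡⟨ cong₂ _-_ (trans (∑-affine (⊟ k) 1# (⊟-≢0 k≢0) χ) ∑-χ)
             (trans (cong χ (trans (cong (_⊞ 1#) (K.zeroʳ _))
                (trans (K.+-identityˡ 1#) (sym (K.*-identityˡ 1#))))) (χ-square 1≢0)) ⟩
      0ℤ - 1ℤ                               ≡⟨ cong (_- 1ℤ) (trans (cong (P *_) (δ-≢0 k≢0)) (ℤ.*-zeroʳ P)) ⟨
      P * δ k - 1ℤ ∎
      where
      divide : ∀ x → x ≢ 0# → x ⊠ (x ⊟ k) ≡ (⊟ k ⊠ x ⁻¹ ⊞ 1#) ⊠ (x ⊠ x)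
      divide x x≢0 = begin
        x ⊠ (x ⊟ k)
          ≡⟨ S.solve 2 (λ x k → x :* (x :- k) := :- k :* con 1ℤ :* x :+ x :* x) refl x k ⟩
        ⊟ k ⊠ ι 1ℤ ⊠ x ⊞ x ⊠ x
          ≡⟨ cong (λ u → ⊟ k ⊠ u ⊠ x ⊞ x ⊠ x) (trans ι-1 (sym (*-inverseʳ x≢0))) ⟩
        ⊟ k ⊠ (x ⊠ x ⁻¹) ⊠ x ⊞ x ⊠ x     ≡⟨ S.solve 3 (λ x i k → :- k :* (x :* i) :* x :+ x :* x
                                                  := (:- k :* i :+ con 1ℤ) :* (x :* x)) refl x (x ⁻¹) k ⟩
        (⊟ k ⊠ x ⁻¹ ⊞ ι 1ℤ) ⊠ (x ⊠ x)     ≡⟨ cong (λ u → (⊟ k ⊠ x ⁻¹ ⊞ u) ⊠ (x ⊠ x)) ι-1 ⟩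
        (⊟ k ⊠ x ⁻¹ ⊞ 1#) ⊠ (x ⊠ x) ∎

  -- Multiplying the argument by b² gives a b · y (y - c) with y = b x, which is the previous sum.
  -- For b = 0 the argument is linear in x and both sides vanish.
  ∑-χ-quadratic : ∀ a b c → ∑ (λ x → χ (a ⊠ x ⊠ (b ⊠ x ⊟ c))) ≡ χ (a ⊠ b) * (P * δ c - 1ℤ)
  ∑-χ-quadratic a b c = by-cases (b ≟ 0#)
    where
    by-cases : Dec (b ≡ 0#) → ∑ (λ x → χ (a ⊠ x ⊠ (b ⊠ x ⊟ c))) ≡ χ (a ⊠ b) * (P * δ c - 1ℤ)
    by-cases (yes refl) = begin
      ∑ (λ x → χ (a ⊠ x ⊠ (0# ⊠ x ⊟ c))) ≡⟨ ∑-cong (λ x → trans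
          (cong χ (trans (cong (λ z → a ⊠ x ⊠ (z ⊟ c)) (K.zeroˡ x))
              (trans (cong (a ⊠ x ⊠_) (K.+-identityˡ (⊟ c)))
            (S.solve 3 (λ a x c → a :* x :* (:- c) := a :* (:- c) :* x) refl a x c)))) (χ-* (a ⊠ ⊟ c) x)) ⟩
      ∑ (λ x → χ (a ⊠ ⊟ c) * χ x)         ≡⟨ ∑-*ˡ (χ (a ⊠ ⊟ c)) χ ⟩
      χ (a ⊠ ⊟ c) * ∑ χ                    ≡⟨ cong (χ (a ⊠ ⊟ c) *_) ∑-χ ⟩
      χ (a ⊠ ⊟ c) * 0ℤ                     ≡⟨ ℤ.*-zeroʳ (χ (a ⊠ ⊟ c)) ⟩
      0ℤ * (P * δ c - 1ℤ)                   ≡⟨ cong (_* (P * δ c - 1ℤ)) (χ-0 (K.zeroʳ a)) ⟨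
      χ (a ⊠ 0#) * (P * δ c - 1ℤ) ∎
    by-cases (no b≢0) = begin
      ∑ (λ x → χ (a ⊠ x ⊠ (b ⊠ x ⊟ c)))             ≡⟨ ∑-cong (λ x → trans (sym (χ-≡ b b≢0
          (S.solve 4 (λ a b c x → a :* b :* (b :* x :* (b :* x :- c)) := a :* x :* (b :* x :- c) :* (b :* b))
            refl a b c x))) (χ-* (a ⊠ b) _)) ⟩
      ∑ (λ x → χ (a ⊠ b) * χ (b ⊠ x ⊠ (b ⊠ x ⊟ c))) ≡⟨ ∑-*ˡ (χ (a ⊠ b)) (λ x → χ (b ⊠ x ⊠ (b ⊠ x ⊟ c))) ⟩
      χ (a ⊠ b) * ∑ (λ x → χ (b ⊠ x ⊠ (b ⊠ x ⊟ c))) ≡⟨ cong (χ (a ⊠ b) *_)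
          (trans (∑-scale b b≢0 (λ y → χ (y ⊠ (y ⊟ c)))) (∑-χ-x[x-k] c)) ⟩
      χ (a ⊠ b) * (P * δ c - 1ℤ) ∎

  -- The 2-isogeny x ↦ x + b/x: the fibre over u consists of the roots of x² - ux + b.
  ∑-χ-isogeny : ∀ b → b ≢ 0# → ∑ (λ x → χ (x ⊠ (x ⊠ x ⊞ b))) ≡ ∑ (λ u → χ (u ⊠ (u ⊠ u ⊟ # 4 ⊠ b)))
  ∑-χ-isogeny b b≢0 = begin
    ∑ (λ x → χ (x ⊠ (x ⊠ x ⊞ b)))       ≡⟨ ∑-cong (λ x → χ-w-square x (λ { refl → K.zeroˡ _ }) (divide x)) ⟩
    ∑ (λ x → w x * χ (x ⊞ b ⊠ x ⁻¹))     ≡⟨ ∑-cong (λ x → cong (w x *_) (sym (∑-select (x ⊞ b ⊠ x ⁻¹)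
                                                (λ u → x ⊞ b ⊠ x ⁻¹ ⊟ u) (λ _ eq → sym (x⊟y≡0⇒x≡y eq))
                                                (K.-‿inverseʳ _) χ))) ⟩
    ∑ (λ x → w x * ∑ (λ u → δ (x ⊞ b ⊠ x ⁻¹ ⊟ u) * χ u))
                                           ≡⟨ ∑-cong (λ x → trans (sym (∑-*ˡ (w x)
                                              (λ u → δ (x ⊞ b ⊠ x ⁻¹ ⊟ u) * χ u)))
                                                (∑-cong λ u → trans (sym (ℤ.*-assoc (w x) _ _))
                                                    (cong (_* χ u) (fibre x u)))) ⟩
    ∑ (λ x → ∑ (λ u → δ (x ⊠ x ⊞ ⊟ u ⊠ x ⊞ b) * χ u))
                                           ≡⟨ ∑-swap (λ x u → δ (x ⊠ x ⊞ ⊟ u ⊠ x ⊞ b) * χ u) ⟩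
    ∑ (λ u → ∑ (λ x → δ (x ⊠ x ⊞ ⊟ u ⊠ x ⊞ b) * χ u))
                                           ≡⟨ ∑-cong (λ u → trans (∑-*ʳ (λ x → δ (x ⊠ x ⊞ ⊟ u ⊠ x ⊞ b)) (χ u))
                                                (cong (_* χ u) (∑-δ-quadratic (⊟ u) b))) ⟩
    ∑ (λ u → (1ℤ + χ (⊟ u ⊠ ⊟ u ⊟ # 4 ⊠ b)) * χ u)
                                           ≡⟨ ∑-cong (λ u → trans (Z.solve 2
                                              (λ c d → (Z.con 1ℤ Z.:+ c) Z.:* d Z.:= d Z.:+ d Z.:* c)
                                                refl (χ (⊟ u ⊠ ⊟ u ⊟ # 4 ⊠ b)) (χ u))
                                                (cong (_+_ (χ u)) (trans (sym (χ-* u _))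
                                                    (cong χ (S.solve 2 (λ u b →
                                                  u :* (:- u :* (:- u) :- con (+ 4) :* b) := u :*
                                                      (u :* u :- con (+ 4) :* b))
                                                  refl u b))))) ⟩
    ∑ (λ u → χ u + χ (u ⊠ (u ⊠ u ⊟ # 4 ⊠ b)))
                                           ≡⟨ ∑-+ χ (λ u → χ (u ⊠ (u ⊠ u ⊟ # 4 ⊠ b))) ⟩
    ∑ χ + ∑ (λ u → χ (u ⊠ (u ⊠ u ⊟ # 4 ⊠ b)))
                                           ≡⟨ trans (cong (_+ ∑ (λ u → χ (u ⊠ (u ⊠ u ⊟ # 4 ⊠ b)))) ∑-χ)
                                              (ℤ.+-identityˡ _) ⟩
    ∑ (λ u → χ (u ⊠ (u ⊠ u ⊟ # 4 ⊠ b))) ∎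
    where
    divide : ∀ x → x ≢ 0# → x ⊠ (x ⊠ x ⊞ b) ≡ (x ⊞ b ⊠ x ⁻¹) ⊠ (x ⊠ x)
    divide x x≢0 = begin
      x ⊠ (x ⊠ x ⊞ b)
        ≡⟨ S.solve 2 (λ x b → x :* (x :* x :+ b) := x :* (x :* x :+ b :* con 1ℤ)) refl x b ⟩
      x ⊠ (x ⊠ x ⊞ b ⊠ ι 1ℤ)       ≡⟨ cong (λ u → x ⊠ (x ⊠ x ⊞ b ⊠ u)) (trans ι-1 (sym (*-inverseʳ x≢0))) ⟩
      x ⊠ (x ⊠ x ⊞ b ⊠ (x ⊠ x ⁻¹))
        ≡⟨ S.solve 3 (λ x i b → x :* (x :* x :+ b :* (x :* i)) := (x :+ b :* i) :* (x :* x))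
                                           refl x (x ⁻¹) b ⟩
      (x ⊞ b ⊠ x ⁻¹) ⊠ (x ⊠ x) ∎
    -- Clears the denominator of x + b/x = u. The quadratic takes the value b ≠ 0 at x = 0, so no
    -- root is added there, in agreement with `w`.
    fibre : ∀ x u → w x * δ (x ⊞ b ⊠ x ⁻¹ ⊟ u) ≡ δ (x ⊠ x ⊞ ⊟ u ⊠ x ⊞ b)
    fibre x u = by-cases (x ≟ 0#)
      where
      by-cases : Dec (x ≡ 0#) → w x * δ (x ⊞ b ⊠ x ⁻¹ ⊟ u) ≡ δ (x ⊠ x ⊞ ⊟ u ⊠ x ⊞ b)
      by-cases (yes refl) = trans (cong (_* δ (0# ⊞ b ⊠ 0# ⁻¹ ⊟ u)) (w-≡0 refl)) (sym (δ-≢0 λ eq → b≢0 (begin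
        b                            ≡⟨ K.+-identityˡ b ⟨
        0# ⊞ b
          ≡⟨ cong (_⊞ b) (trans (cong₂ _⊞_ (K.zeroʳ 0#) (K.zeroʳ (⊟ u))) (K.+-identityˡ 0#)) ⟨
        0# ⊠ 0# ⊞ ⊟ u ⊠ 0# ⊞ b     ≡⟨ eq ⟩
        0# ∎)))
      by-cases (no x≢0) = begin
        w x * δ (x ⊞ b ⊠ x ⁻¹ ⊟ u)    ≡⟨ cong (_* δ (x ⊞ b ⊠ x ⁻¹ ⊟ u)) (w-≢0 x≢0) ⟩
        1ℤ * δ (x ⊞ b ⊠ x ⁻¹ ⊟ u)     ≡⟨ ℤ.*-identityˡ _ ⟩
        δ (x ⊞ b ⊠ x ⁻¹ ⊟ u)          ≡⟨ δ-scale x x≢0 (begin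
          x ⊠ x ⊞ ⊟ u ⊠ x ⊞ b
            ≡⟨ S.solve 3 (λ x u b → x :* x :+ (:- u) :* x :+ b := x :* (x :- u) :+ b :* con 1ℤ) refl x u b ⟩
          x ⊠ (x ⊟ u) ⊞ b ⊠ ι 1ℤ      ≡⟨ cong (λ t → x ⊠ (x ⊟ u) ⊞ b ⊠ t) (trans ι-1 (sym (*-inverseʳ x≢0))) ⟩
          x ⊠ (x ⊟ u) ⊞ b ⊠ (x ⊠ x ⁻¹)
            ≡⟨ S.solve 4 (λ x i u b → x :* (x :- u) :+ b :* (x :* i) := x :* (x :+ b :* i :- u))
                                               refl x (x ⁻¹) u b ⟩
          x ⊠ (x ⊞ b ⊠ x ⁻¹ ⊟ u) ∎) ⟨
        δ (x ⊠ x ⊞ ⊟ u ⊠ x ⊞ b) ∎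

-- The number of vertices as a cubic character sum

module VertexCount {p : ℕ} (F : OddField p) where

  open OddField F
  open FieldTheory F
  open QuadraticCharacter F
  open S using (_:+_; _:*_; _:-_; :-_; _:=_; con)
  private module K = CommutativeRing commutativeRing

  φ : ℤ
  φ = ∑ λ x → χ (x ⊠ x ⊠ x ⊞ x)

  -- For e different from 0 and 1, minus the trace of Frobenius of the Legendre curve y² = v (v - 1)
  -- (v - e).
  legendre : Fin p → ℤ
  legendre e = ∑ λ v → χ (v ⊠ ((v ⊟ # 1) ⊠ (v ⊟ e)))

  -- The isogeny with b = -1 leads to u (u² + 4), and u = 2x turns this into 2 (x³ + x) · 2², whence
  -- the factor χ(2).
  ∑-χ-x[x²-1] : ∑ (λ x → χ (x ⊠ (x ⊠ x ⊞ ι -1ℤ))) ≡ χ (# 2) * φ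
  ∑-χ-x[x²-1] = begin
    ∑ (λ x → χ (x ⊠ (x ⊠ x ⊞ ι -1ℤ)))  ≡⟨ ∑-χ-isogeny (ι -1ℤ) -1≢0 ⟩
    ∑ g                                   ≡⟨ ∑-scale (# 2) 2≢0 g ⟨
    ∑ (λ x → g (# 2 ⊠ x))                 ≡⟨ ∑-cong (λ x → trans (χ-≡ (# 2) 2≢0 (S.solve 1 (λ x →
                                               let y = con (+ 2) :* x in
                                               y :* (y :* y :- con (+ 4) :* con -1ℤ) :=
                                               con (+ 2) :* (x :* x :* x :+ x) :* (con (+ 2) :* con (+ 2)))
                                                   refl x))
                                               (χ-* (# 2) (x ⊠ x ⊠ x ⊞ x))) ⟩
    ∑ (λ x → χ (# 2) * χ (x ⊠ x ⊠ x ⊞ x)) ≡⟨ ∑-*ˡ (χ (# 2)) (λ x → χ (x ⊠ x ⊠ x ⊞ x)) ⟩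
    χ (# 2) * φ ∎
    where
    g : Fin p → ℤ
    g u = χ (u ⊠ (u ⊠ u ⊟ # 4 ⊠ ι -1ℤ))

  legendre[-1] : legendre (ι -1ℤ) ≡ χ (# 2) * φ
  legendre[-1] = trans (∑-cong λ v → cong χ (S.solve 1 (λ v →
    v :* ((v :- con 1ℤ) :* (v :- con -1ℤ)) := v :* (v :* v :+ con -1ℤ)) refl v)) ∑-χ-x[x²-1]

  -- The shift by 1 moves the roots 0, 1, 2 to -1, 0, 1.
  legendre[2] : legendre (# 2) ≡ χ (# 2) * φ
  legendre[2] = begin
    ∑ g                   ≡⟨ ∑-shift (# 1) g ⟨
    ∑ (λ v → g (v ⊞ # 1)) ≡⟨ ∑-cong (λ v → cong χ (S.solve 1 (λ v → let y = v :+ con 1ℤ in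
                               y :* ((y :- con 1ℤ) :* (y :- con (+ 2))) := v :* (v :* v :+ con -1ℤ)) refl v)) ⟩
    ∑ (λ x → χ (x ⊠ (x ⊠ x ⊞ ι -1ℤ))) ≡⟨ ∑-χ-x[x²-1] ⟩
    χ (# 2) * φ ∎
    where
    g : Fin p → ℤ
    g v = χ (v ⊠ ((v ⊟ # 1) ⊠ (v ⊟ # 2)))

  -- The map v ↦ (v + 1)/2 sends -1, 0, 1 to 0, 1/2, 1 and multiplies the cubic by h³ with h = 1/2.
  -- The resulting χ(h) cancels the χ(2) of `∑-χ-x[x²-1]`.
  legendre[½] : legendre (# 2 ⁻¹) ≡ φ
  legendre[½] = begin
    ∑ g                     ≡⟨ ∑-affine h h (⁻¹-≢0 2≢0) g ⟨
    ∑ (λ v → g (h ⊠ v ⊞ h)) ≡⟨ ∑-cong (λ v → trans (χ-≡ h (⁻¹-≢0 2≢0) (rescale v)) (χ-* h (cubic v))) ⟩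
    ∑ (λ v → χ h * χ (cubic v)) ≡⟨ ∑-*ˡ (χ h) (χ ∘ cubic) ⟩
    χ h * ∑ (χ ∘ cubic)     ≡⟨ cong (χ h *_) ∑-χ-x[x²-1] ⟩
    χ h * (χ (# 2) * φ)     ≡⟨ ℤ.*-assoc (χ h) _ _ ⟨
    χ h * χ (# 2) * φ       ≡⟨ cong (_* φ) (χ-* h (# 2)) ⟨
    χ (h ⊠ # 2) * φ         ≡⟨ cong (_* φ) (trans (cong χ (trans (K.*-comm h _) (trans (*-inverseʳ 2≢0)
                                 (sym (K.*-identityˡ 1#))))) (χ-square 1≢0)) ⟩
    1ℤ * φ                  ≡⟨ ℤ.*-identityˡ φ ⟩
    φ ∎
    where
    h : Fin p
    h = # 2 ⁻¹
    g : Fin p → ℤ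
    g v = χ (v ⊠ ((v ⊟ # 1) ⊠ (v ⊟ h)))
    cubic : Fin p → Fin p
    cubic x = x ⊠ (x ⊠ x ⊞ ι -1ℤ)
    2h≡1 : # 1 ≡ # 2 ⊠ h
    2h≡1 = trans ι-1 (sym (*-inverseʳ 2≢0))
    rescale : ∀ v → (h ⊠ v ⊞ h) ⊠ ((h ⊠ v ⊞ h ⊟ # 1) ⊠ (h ⊠ v ⊞ h ⊟ h)) ≡ h ⊠ cubic v ⊠ (h ⊠ h)
    rescale v = trans (cong (λ u → (h ⊠ v ⊞ h) ⊠ ((h ⊠ v ⊞ h ⊟ u) ⊠ (h ⊠ v ⊞ h ⊟ h))) 2h≡1)
      (S.solve 2 (λ h v → let y = h :* v :+ h in
        y :* ((y :- con (+ 2) :* h) :* (y :- h)) := h :* (v :* (v :* v :+ con -1ℤ)) :* (h :* h)) refl h v)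

  -- The cubic degenerates to v² (v - 1), so the sum of χ(v - 1) runs over v ≠ 0 and lacks just the
  -- term χ(-1).
  legendre[0] : legendre (ι 0ℤ) ≡ - χ (ι -1ℤ)
  legendre[0] = begin
    legendre (ι 0ℤ)                ≡⟨ ∑-cong (λ v → χ-w-square v (λ { refl → K.zeroˡ _ }) (λ _ →
                                        S.solve 1 (λ v → v :* ((v :- con 1ℤ) :* (v :- con 0ℤ)) :=
                                          (v :+ con -1ℤ) :* (v :* v)) refl v)) ⟩
    ∑ (λ v → w v * χ (v ⊞ ι -1ℤ)) ≡⟨ ∑-w* (λ v → χ (v ⊞ ι -1ℤ)) ⟩
    ∑ (λ v → χ (v ⊞ ι -1ℤ)) - χ (0# ⊞ ι -1ℤ)
      ≡⟨ cong₂ _-_ (trans (∑-shift (ι -1ℤ) χ) ∑-χ) (cong χ (K.+-identityˡ _)) ⟩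
    0ℤ - χ (ι -1ℤ)                 ≡⟨ ℤ.+-identityˡ _ ⟩
    - χ (ι -1ℤ) ∎

  -- What survives, for a fixed first coordinate x, of the sums over the others: χ(a (a - 4)) with a
  -- = k x y, taken on the line x + y + 1 = 0, where a = -k x (x + 1).
  quartic-term : Fin p → Fin p → ℤ
  quartic-term k y = χ (k ⊠ y ⊠ (y ⊞ # 1) ⊠ (k ⊠ y ⊠ (y ⊞ # 1) ⊞ # 4))

  -- With w = 2y + 1 the summand becomes χ((w² - 1)(w² - e)), and then v = w².
  1+∑-quartic-term : ∀ {k e} → k ≢ 0# → k ⊠ e ≡ k ⊟ # 16 → 1ℤ + ∑ (quartic-term k) ≡ legendre e
  1+∑-quartic-term {k} {e} k≢0 ke = begin
    1ℤ + ∑ (quartic-term k)                       ≡⟨ cong (_+_ 1ℤ) (∑-cong complete) ⟩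
    1ℤ + ∑ (λ y → g ((# 2 ⊠ y ⊞ # 1) ⊠ (# 2 ⊠ y ⊞ # 1)))
      ≡⟨ cong (_+_ 1ℤ) (∑-affine (# 2) (# 1) 2≢0 (λ w → g (w ⊠ w))) ⟩
    1ℤ + ∑ (λ w → g (w ⊠ w))                      ≡⟨ cong (_+_ 1ℤ) (∑-square g) ⟩
    1ℤ + (∑ g + ∑ (λ v → χ v * g v))              ≡⟨ cong (λ t → 1ℤ + (t + ∑ (λ v → χ v * g v))) ∑g ⟩
    1ℤ + (-1ℤ + ∑ (λ v → χ v * g v))
      ≡⟨ Z.solve 1 (λ x → Z.con 1ℤ Z.:+ (Z.con -1ℤ Z.:+ x) Z.:= x) refl _ ⟩
    ∑ (λ v → χ v * g v)                           ≡⟨ ∑-cong (λ v → sym (χ-* v ((v ⊟ # 1) ⊠ (v ⊟ e)))) ⟩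
    legendre e ∎
    where
    g : Fin p → ℤ
    g v = χ ((v ⊟ # 1) ⊠ (v ⊟ e))
    -- k (1 - e) = 16, so the two roots of the quadratic in `g` are distinct.
    e-1≢0 : e ⊟ # 1 ≢ 0#
    e-1≢0 eq = 16≢0 (begin
      # 16                       ≡⟨ S.solve 1 (λ k → con (+ 16) := k :- (k :- con (+ 16))) refl k ⟩
      k ⊟ (k ⊟ # 16)            ≡⟨ cong (_⊟_ k) ke ⟨
      k ⊟ k ⊠ e                 ≡⟨ S.solve 2 (λ k e → k :- k :* e := :- k :* (e :- con 1ℤ)) refl k e ⟩
      ⊟ k ⊠ (e ⊟ # 1)           ≡⟨ factor-0 (⊟ k) refl eq ⟩
      0# ∎)
    ∑g : ∑ g ≡ -1ℤ
    ∑g = begin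
      ∑ g                                ≡⟨ ∑-shift (# 1) g ⟨
      ∑ (λ v → g (v ⊞ # 1))              ≡⟨ ∑-cong (λ v → cong χ (S.solve 2 (λ v e →
                                              (v :+ con 1ℤ :- con 1ℤ) :* (v :+ con 1ℤ :- e) := v :*
                                                  (v :- (e :- con 1ℤ))) refl v e)) ⟩
      ∑ (λ v → χ (v ⊠ (v ⊟ (e ⊟ # 1)))) ≡⟨ ∑-χ-x[x-k] (e ⊟ # 1) ⟩
      P * δ (e ⊟ # 1) - 1ℤ               ≡⟨ cong (_- 1ℤ) (trans (cong (P *_) (δ-≢0 e-1≢0)) (ℤ.*-zeroʳ P)) ⟩
      0ℤ - 1ℤ ∎
    complete : ∀ y → quartic-term k y ≡ g ((# 2 ⊠ y ⊞ # 1) ⊠ (# 2 ⊠ y ⊞ # 1))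
    complete y = begin
      -- Multiplying by 16 = 4² turns each 4 y (y + 1) into (2y + 1)² - 1.
      χ X                          ≡⟨ χ-≡ (# 4) 4≢0 refl ⟨
      χ (X ⊠ (# 4 ⊠ # 4))         ≡⟨ cong χ (S.solve 2 (λ k y → let u = con (+ 2) :* y :+ con 1ℤ in
          k :* y :* (y :+ con 1ℤ) :* (k :* y :* (y :+ con 1ℤ) :+ con (+ 4)) :* (con (+ 4) :* con (+ 4))
          := (u :* u :- con 1ℤ) :* k :* (u :* u :* k :- (k :- con (+ 16)))) refl k y) ⟩
      χ ((V ⊟ # 1) ⊠ k ⊠ (V ⊠ k ⊟ (k ⊟ # 16))) ≡⟨ cong (λ t → χ ((V ⊟ # 1) ⊠ k ⊠ (V ⊠ k ⊟ t))) ke ⟨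
      χ ((V ⊟ # 1) ⊠ k ⊠ (V ⊠ k ⊟ k ⊠ e)) ≡⟨ χ-≡ k k≢0 (S.solve 3 (λ V k e →
          (V :- con 1ℤ) :* k :* (V :* k :- k :* e) := (V :- con 1ℤ) :* (V :- e) :* (k :* k)) refl V k e) ⟩
      g V ∎
      where
      X = k ⊠ y ⊠ (y ⊞ # 1) ⊠ (k ⊠ y ⊠ (y ⊞ # 1) ⊞ # 4)
      V = (# 2 ⊠ y ⊞ # 1) ⊠ (# 2 ⊠ y ⊞ # 1)

  s : Fin p → Fin p → Fin p → Fin p → Fin p
  s x y z t = x ⊞ y ⊞ z ⊞ t ⊞ # 1

  q : Fin p → Fin p → Fin p → Fin p → Fin p → Fin p
  q k x y z t = s x y z t ⊠ s x y z t ⊟ k ⊠ x ⊠ y ⊠ z ⊠ t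

  #solutions : Fin p → ℤ
  #solutions k = ∑ λ x → ∑ λ y → ∑ λ z → ∑ λ t → δ (q k x y z t)

  -- As a quadratic in t with A = x + y + z + 1 and a = k x y, the equation has discriminant (2A - a
  -- z)² - 4A² = a z (a z - 4A). This is a z times a linear form in z, so `∑-χ-quadratic` performs
  -- the sum over z.
  ∑-χ-last : ∀ k x y → ∑ (λ z → ∑ λ t → δ (q k x y z t)) ≡
    P + (P * (δ (# 4 ⊠ (x ⊞ y ⊞ # 1)) * χ (k ⊠ x ⊠ y ⊠ (k ⊠ x ⊠ y ⊟ # 4))) - χ (k ⊠ x ⊠ y ⊠ (k ⊠ x ⊠ y ⊟ # 4)))
  ∑-χ-last k x y = begin
    ∑ (λ z → ∑ λ t → δ (q k x y z t))
      ≡⟨ ∑-cong (λ z → trans (∑-cong λ t → cong δ (S.solve 5 (λ k x y z t →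
           let A = x :+ y :+ z :+ con 1ℤ ; r = x :+ y :+ z :+ t :+ con 1ℤ in
           r :* r :- k :* x :* y :* z :* t := t :* t :+ (con (+ 2) :* A :- k :* x :* y :* z) :* t :+ A :* A)
           refl k x y z t)) (∑-δ-quadratic _ _)) ⟩
    ∑ (λ z → let A = x ⊞ y ⊞ z ⊞ # 1 ; m = # 2 ⊠ A ⊟ k ⊠ x ⊠ y ⊠ z in 1ℤ + χ (m ⊠ m ⊟ # 4 ⊠ (A ⊠ A)))
      ≡⟨ ∑-cong (λ z → cong (λ u → 1ℤ + χ u) (S.solve 4 (λ k x y z →
           let A = x :+ y :+ z :+ con 1ℤ ; m = con (+ 2) :* A :- k :* x :* y :* z ; a = k :* x :* y in
           m :* m :- con (+ 4) :* (A :* A) := a :* z :*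
               ((a :- con (+ 4)) :* z :- con (+ 4) :* (x :+ y :+ con 1ℤ)))
           refl k x y z)) ⟩
    ∑ (λ z → 1ℤ + χ (a ⊠ z ⊠ ((a ⊟ # 4) ⊠ z ⊟ c)))
      ≡⟨ ∑-+ (λ _ → 1ℤ) (λ z → χ (a ⊠ z ⊠ ((a ⊟ # 4) ⊠ z ⊟ c))) ⟩
    ∑ (λ _ → 1ℤ) + ∑ (λ z → χ (a ⊠ z ⊠ ((a ⊟ # 4) ⊠ z ⊟ c)))
      ≡⟨ cong₂ _+_ (sum-1 p) (∑-χ-quadratic a (a ⊟ # 4) c) ⟩
    P + χ (a ⊠ (a ⊟ # 4)) * (P * δ c - 1ℤ)
      ≡⟨ Z.solve 3 (λ P X d → P Z.:+ X Z.:* (P Z.:* d Z.:- Z.con 1ℤ) Z.:= P Z.:+ (P Z.:* (d Z.:* X) Z.:- X))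
           refl P (χ (a ⊠ (a ⊟ # 4))) (δ c) ⟩
    P + (P * (δ c * χ (a ⊠ (a ⊟ # 4))) - χ (a ⊠ (a ⊟ # 4))) ∎
    where
    a = k ⊠ x ⊠ y
    c = # 4 ⊠ (x ⊞ y ⊞ # 1)

  -- The `δ` selects y = -x - 1. The other term is a product of two linear forms in y with constant
  -- 4 ≠ 0, so its sum is -χ((k x)²) = -w(x).
  ∑-χ-middle : ∀ k x → k ≢ 0# → ∑ (λ y → ∑ λ z → ∑ λ t → δ (q k x y z t)) ≡ P * P + (P * quartic-term k x + w x)
  ∑-χ-middle k x k≢0 = begin
    ∑ (λ y → ∑ λ z → ∑ λ t → δ (q k x y z t))    ≡⟨ ∑-cong (∑-χ-last k x) ⟩
    ∑ (λ y → P + (P * (f y * h y) - h y))          ≡⟨ ∑-+ (λ _ → P) (λ y → P * (f y * h y) - h y) ⟩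
    ∑ (λ _ → P) + ∑ (λ y → P * (f y * h y) - h y)  ≡⟨ cong₂ _+_ (∑-const P) (∑-- (λ y → P * (f y * h y)) h) ⟩
    P * P + (∑ (λ y → P * (f y * h y)) - ∑ h)      ≡⟨ cong (_+_ (P * P)) (cong₂ _-_
                                                         (trans (∑-*ˡ P (λ y → f y * h y)) (cong (P *_) ∑fh))
                                                             ∑h) ⟩
    P * P + (P * quartic-term k x - - w x)
      ≡⟨ cong (λ t → P * P + (P * quartic-term k x + t)) (ℤ.neg-involutive (w x)) ⟩
    P * P + (P * quartic-term k x + w x) ∎
    where
    f h : Fin p → ℤ
    f y = δ (# 4 ⊠ (x ⊞ y ⊞ # 1))
    h y = χ (k ⊠ x ⊠ y ⊠ (k ⊠ x ⊠ y ⊟ # 4))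
    ∑fh : ∑ (λ y → f y * h y) ≡ quartic-term k x
    ∑fh = trans (∑-select (⊟ x ⊟ # 1) (λ y → # 4 ⊠ (x ⊞ y ⊞ # 1))
      (λ y eq → x⊟y≡0⇒x≡y (trans (S.solve 2 (λ x y → y :- (:- x :- con 1ℤ) := x :+ y :+ con 1ℤ) refl x y)
          (*-cancelˡ-0 4≢0 eq)))
      (factor-0 (# 4) (S.solve 1 (λ x → con (+ 4) :* (x :+ (:- x :- con 1ℤ) :+ con 1ℤ) := con (+ 4) :* con 0ℤ)
          refl x) ι-0) h)
      (cong χ (S.solve 2 (λ k x → let a = k :* x :* (:- x :- con 1ℤ) ; b = k :* x :* (x :+ con 1ℤ) in
        a :* (a :- con (+ 4)) := b :* (b :+ con (+ 4))) refl k x))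
    ∑h : ∑ h ≡ - w x
    ∑h = begin
      ∑ h                                        ≡⟨ ∑-χ-quadratic (k ⊠ x) (k ⊠ x) (# 4) ⟩
      χ (k ⊠ x ⊠ (k ⊠ x)) * (P * δ (# 4) - 1ℤ)
        ≡⟨ cong₂ (λ u v → u * (P * v - 1ℤ)) (χ-square-w (k ⊠ x)) (δ-≢0 4≢0) ⟩
      w (k ⊠ x) * (P * 0ℤ - 1ℤ)
        ≡⟨ cong (_* (P * 0ℤ - 1ℤ)) (trans (w-* k x) (trans (cong (_* w x) (w-≢0 k≢0)) (ℤ.*-identityˡ _))) ⟩
      w x * (P * 0ℤ - 1ℤ)
        ≡⟨ Z.solve 2 (λ P w → w Z.:* (P Z.:* Z.con 0ℤ Z.:- Z.con 1ℤ) Z.:= Z.:- w) refl P (w x) ⟩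
      - w x ∎

  #solutions≡ : ∀ {k e} → k ≢ 0# → k ⊠ e ≡ k ⊟ # 16 → #solutions k ≡ P ^ 3 - + 1 + legendre e * P
  #solutions≡ {k} {e} k≢0 ke = begin
    #solutions k                                        ≡⟨ ∑-cong (λ x → ∑-χ-middle k x k≢0) ⟩
    ∑ (λ x → P * P + (P * quartic-term k x + w x))
      ≡⟨ ∑-+ (λ _ → P * P) (λ x → P * quartic-term k x + w x) ⟩
    ∑ (λ _ → P * P) + ∑ (λ x → P * quartic-term k x + w x)
      ≡⟨ cong₂ _+_ (∑-const (P * P)) (∑-+ (λ x → P * quartic-term k x) w) ⟩
    P * (P * P) + (∑ (λ x → P * quartic-term k x) + ∑ w)
      ≡⟨ cong (_+_ (P * (P * P))) (cong₂ _+_ (∑-*ˡ P (quartic-term k)) ∑-w) ⟩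
    -- The `P` in ∑ w = P - 1 supplies the 1 that `1+∑-quartic-term` adds to the sum.
    P * (P * P) + (P * ∑ (quartic-term k) + (P - 1ℤ))
      ≡⟨ Z.solve 2 (λ P T → P Z.:* (P Z.:* P) Z.:+ (P Z.:* T Z.:+ (P Z.:- Z.con 1ℤ))
                                                             Z.:= P Z.:^ 3 Z.:- Z.con 1ℤ Z.:+ (Z.con 1ℤ Z.:+ T)
                                                                 Z.:* P) refl P (∑ (quartic-term k)) ⟩
    P ^ 3 - + 1 + (1ℤ + ∑ (quartic-term k)) * P
      ≡⟨ cong (λ t → P ^ 3 - + 1 + t * P) (1+∑-quartic-term k≢0 ke) ⟩
    P ^ 3 - + 1 + legendre e * P ∎

-- Boolean patterns of coordinates and inclusion-exclusion

prod₄ : (f g h i : Bool → ℤ) → Bool → Bool → Bool → Bool → ℤ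
prod₄ f g h i α β γ κ = f α * (g β * (h γ * i κ))

-- eⱼ sums over the masks with exactly j entries true.
e₀ e₁ e₂ e₃ e₄ : (Bool → Bool → Bool → Bool → ℤ) → ℤ
e₀ u = u false false false false
e₁ u = u true false false false + u false true false false + u false false true false + u false false false true
e₂ u = u true true false false + u true false true false + u true false false true
     + u false true true false + u false true false true + u false false true true
e₃ u = u false true true true + u true false true true + u true true false true + u true true true false
e₄ u = u true true true true

count-false : Bool → Bool → Bool → Bool → ℕ
count-false a b c d = f a ℕ.+ (f b ℕ.+ (f c ℕ.+ f d))
  where
  f : Bool → ℕ
  f b = if b then 0 else 1

bit : Bool → ℤ
bit b = if b then 1ℤ else 0ℤ

-- The first argument is the truth value found at a coordinate, the second the entry of the mask.
-- The product over the coordinates is then the indicator of the pattern being equal to the mask.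
exactly : Bool → Bool → ℤ
exactly b true  = bit b
exactly b false = 1ℤ - bit b

-- A mask entry `false` imposes nothing here, as inclusion-exclusion requires.
atLeast : Bool → Bool → ℤ
atLeast b true  = bit b
atLeast b false = 1ℤ

-- For s = 0 a flip moves its coordinate exactly when the other three coordinates are nonzero, so the
-- degree is 1 if there is exactly one zero coordinate and 0 if there are more.
degenerate : ℕ → (Bool → Bool → Bool → Bool → ℤ) → ℤ
degenerate 0 u = 1ℤ - e₀ u - e₁ u
degenerate 1 u = e₁ u
degenerate _ u = 0ℤ

-- For s ≠ 0 the degree is 4 minus the number of coordinates with 2xᵢ = s; that number being exactly
-- 4 - n is expressed by inclusion-exclusion.
generic : ℕ → (Bool → Bool → Bool → Bool → ℤ) → ℤ
generic 0 u = e₄ u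
generic 1 u = e₃ u - + 4 * e₄ u
generic 2 u = e₂ u - + 3 * e₃ u + + 6 * e₄ u
generic 3 u = e₁ u - + 2 * e₂ u + + 3 * e₃ u - + 4 * e₄ u
generic _ u = 0ℤ

allBool? : ∀ {P : Bool → Set} → (∀ b → Dec (P b)) → Dec (∀ b → P b)
allBool? P? = map′ (λ { (t , f) true → t ; (t , f) false → f }) (λ all → all true , all false)
  (P? true ×-dec P? false)

from-true : ∀ {A : Set} (d : Dec A) → does d ≡ true → A
from-true (yes x) _ = x

-- Decided by evaluation on sixteen patterns for each degree. The factor `bit (a ∨ b ∨ c ∨ e)` is
-- the equation of the surface, which for s = 0 says that some coordinate vanishes.
degenerate-count : ∀ (d : Fin 4) a b c e →
  bit (a ∨ b ∨ c ∨ e) * iverson (count-false (b ∨ c ∨ e) (a ∨ c ∨ e) (a ∨ b ∨ e) (a ∨ b ∨ c) ℕ.≟ toℕ d)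
  ≡ degenerate (toℕ d) (prod₄ (exactly a) (exactly b) (exactly c) (exactly e))
degenerate-count = from-true (all? λ d → allBool? λ a → allBool? λ b → allBool? λ c → allBool? λ e → _ ℤ.≟ _)
    refl

generic-count : ∀ (d : Fin 4) a b c e →
  iverson (count-false a b c e ℕ.≟ toℕ d)
  ≡ generic (toℕ d) (prod₄ (atLeast a) (atLeast b) (atLeast c) (atLeast e))
generic-count = from-true (all? λ d → allBool? λ a → allBool? λ b → allBool? λ c → allBool? λ e → _ ℤ.≟ _) refl

cong₄ : ∀ {A B : Set} (f : A → A → A → A → B) {x x′ y y′ z z′ t t′} →
        x ≡ x′ → y ≡ y′ → z ≡ z′ → t ≡ t′ → f x y z t ≡ f x′ y′ z′ t′
cong₄ f refl refl refl refl = refl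

-- Which flips move a given solution

module DegreeCount {p : ℕ} (F : OddField p) where

  open OddField F
  open FieldTheory F
  open QuadraticCharacter F
  open VertexCount F
  open S using (_:+_; _:*_; _:-_; :-_; _:=_; con)
  private module K = CommutativeRing commutativeRing

  -- The Boolean behind `δ`: `bit (null x)` computes to `δ x`, so that the Boolean tables apply to
  -- field elements.
  null : Fin p → Bool
  null x = does (x ≟ 0#)

  null-* : ∀ x y → null (x ⊠ y) ≡ null x ∨ null y
  null-* x y with x ≟ 0# | y ≟ 0#
  ... | yes refl | _        = dec-true (_ ≟ 0#) (K.zeroˡ y)
  ... | no x≢0   | yes refl = dec-true (_ ≟ 0#) (K.zeroʳ x)
  ... | no x≢0   | no y≢0 with x ⊠ y ≟ 0#
  ...   | yes xy≡0 = contradiction xy≡0 (*-≢0 x≢0 y≢0)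
  ...   | no _     = refl

  null-cong : ∀ {x y} → (x ≡ 0# → y ≡ 0#) × (y ≡ 0# → x ≡ 0#) → null x ≡ null y
  null-cong {x} {y} (f , g) with x ≟ 0# | y ≟ 0#
  ... | yes _   | yes _   = refl
  ... | no _    | no _    = refl
  ... | yes x≡0 | no y≢0  = contradiction (f x≡0) y≢0
  ... | no x≢0  | yes y≡0 = contradiction (g y≡0) x≢0

  null-scale : ∀ {x y} c → c ≢ 0# → y ≡ c ⊠ x → null y ≡ null x
  null-scale c c≢0 eq = sym (null-cong (factor-0-⇔ c c≢0 eq))

  -- ∂f/∂xᵢ, where r is the value of s and π is k times the product of the other coordinates.
  partial : Fin p → Fin p → Fin p
  partial r π = # 2 ⊠ r ⊟ π

  moves : Fin p → Fin p → Fin p → Fin p → Fin p → ℕ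
  moves k a b c d = count-false (null (partial r (k ⊠ (b ⊠ (c ⊠ d))))) (null (partial r (k ⊠ (a ⊠ (c ⊠ d)))))
                                (null (partial r (k ⊠ (a ⊠ (b ⊠ d))))) (null (partial r (k ⊠ (a ⊠ (b ⊠ c)))))
    where r = s a b c d

  exactly-null atLeast-½ : Fin p → Fin p → Bool → ℤ
  exactly-null r x α = exactly (null x) α
  atLeast-½ r x α = atLeast (null (# 2 ⊠ x ⊟ r)) α

  on : (Fin p → Fin p → Bool → ℤ) → Fin p → Fin p → Fin p → Fin p → Fin p → Bool → Bool → Bool → Bool → ℤ
  on f r a b c d = prod₄ (f r a) (f r b) (f r c) (f r d)

  -- The indicator of solutions with s ≠ 0, as a function of s and the product alone; this is what
  -- makes the sums below symmetric.
  V : Fin p → Fin p → ℤ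
  V r π = δ (r ⊠ r ⊟ π) * w r

  -- Separates the strata s = 0 and s ≠ 0 pointwise. Both terms are linear in products of one factor
  -- per coordinate, the form in which they can be summed.
  moves-split : ∀ k → k ≢ 0# → ∀ (j : Fin 4) a b c d → let r = s a b c d ; n = toℕ j in
    δ (q k a b c d) * iverson (moves k a b c d ℕ.≟ n)
    ≡ δ r * degenerate n (on exactly-null r a b c d) + V r (k ⊠ a ⊠ b ⊠ c ⊠ d) * generic n
        (on atLeast-½ r a b c d)
  moves-split k k≢0 j a b c d = by-cases (r ≟ 0#) (r ⊠ r ⊟ π ≟ 0#)
    where
    n = toℕ j
    r = s a b c d
    π = k ⊠ a ⊠ b ⊠ c ⊠ d
    D = degenerate n (on exactly-null r a b c d)
    G = generic n (on atLeast-½ r a b c d)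
    by-cases : Dec (r ≡ 0#) → Dec (r ⊠ r ⊟ π ≡ 0#) →
      δ (r ⊠ r ⊟ π) * iverson (moves k a b c d ℕ.≟ n) ≡ δ r * D + V r π * G
    by-cases (yes r≡0) _ = begin
      δ (r ⊠ r ⊟ π) * iverson (moves k a b c d ℕ.≟ n)
        ≡⟨ cong₂ (λ u v → bit u * iverson (v ℕ.≟ n)) null-q
             (cong₄ count-false (null-∂ b c d) (null-∂ a c d) (null-∂ a b d) (null-∂ a b c)) ⟩
      bit (null a ∨ null b ∨ null c ∨ null d) * iverson
          (count-false (null b ∨ null c ∨ null d) (null a ∨ null c ∨ null d)
          (null a ∨ null b ∨ null d) (null a ∨ null b ∨ null c) ℕ.≟ n)
        ≡⟨ degenerate-count j (null a) (null b) (null c) (null d) ⟩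
      D ≡⟨ Z.solve 3 (λ D x G → D Z.:= Z.con 1ℤ Z.:* D Z.:+ x Z.:* Z.con 0ℤ Z.:* G) refl D (δ (r ⊠ r ⊟ π)) G ⟩
      1ℤ * D + δ (r ⊠ r ⊟ π) * 0ℤ * G
        ≡⟨ cong₂ (λ u v → u * D + δ (r ⊠ r ⊟ π) * v * G) (sym (δ-≡0 r≡0)) (sym (w-≡0 r≡0)) ⟩
      δ r * D + V r π * G ∎
      where
      null-prod₃ : ∀ x y z → null (x ⊠ (y ⊠ z)) ≡ null x ∨ null y ∨ null z
      null-prod₃ x y z = trans (null-* x _) (cong (null x ∨_) (null-* y z))
      null-∂ : ∀ x y z → null (partial r (k ⊠ (x ⊠ (y ⊠ z)))) ≡ null x ∨ null y ∨ null z
      null-∂ x y z = trans (null-scale (⊟ k) (⊟-≢0 k≢0)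
          (trans (cong (λ r → partial r (k ⊠ (x ⊠ (y ⊠ z)))) (trans r≡0 (sym ι-0)))
        (S.solve 4 (λ k x y z → con (+ 2) :* con 0ℤ :- k :* (x :* (y :* z)) := :- k :* (x :* (y :* z))) refl k
            x y z)))
        (null-prod₃ x y z)
      null-q : null (r ⊠ r ⊟ π) ≡ null a ∨ null b ∨ null c ∨ null d
      null-q = trans (null-scale (⊟ k) (⊟-≢0 k≢0) (trans (cong (λ r → r ⊠ r ⊟ π) (trans r≡0 (sym ι-0)))
        (S.solve 5 (λ k a b c d → con 0ℤ :* con 0ℤ :- k :* a :* b :* c :* d := :- k :* (a :* (b :* (c :* d))))
            refl k a b c d)))
        (trans (null-* a _) (cong (null a ∨_) (null-prod₃ b c d)))
    by-cases (no r≢0) (no q≢0) = begin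
      δ (r ⊠ r ⊟ π) * iverson (moves k a b c d ℕ.≟ n) ≡⟨ cong (_* iverson (moves k a b c d ℕ.≟ n)) (δ-≢0 q≢0) ⟩
      0ℤ ≡⟨ Z.solve 3 (λ D x G → Z.con 0ℤ Z.:= Z.con 0ℤ Z.:* D Z.:+ Z.con 0ℤ Z.:* x Z.:* G) refl D (w r) G ⟩
      0ℤ * D + 0ℤ * w r * G ≡⟨ cong₂ (λ u v → u * D + v * w r * G) (sym (δ-≢0 r≢0)) (sym (δ-≢0 q≢0)) ⟩
      δ r * D + V r π * G ∎
    by-cases (no r≢0) (yes q≡0) = begin
      δ (r ⊠ r ⊟ π) * iverson (moves k a b c d ℕ.≟ n) ≡⟨ cong (_* iverson (moves k a b c d ℕ.≟ n)) (δ-≡0 q≡0) ⟩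
      1ℤ * iverson (moves k a b c d ℕ.≟ n)
        ≡⟨ cong (λ v → 1ℤ * iverson (v ℕ.≟ n)) (cong₄ count-false
             (null-∂ a (k ⊠ (b ⊠ (c ⊠ d))) (S.solve 5
                 (λ k a b c d → k :* a :* b :* c :* d := a :* (k :* (b :* (c :* d)))) refl k a b c d))
             (null-∂ b (k ⊠ (a ⊠ (c ⊠ d))) (S.solve 5
                 (λ k a b c d → k :* a :* b :* c :* d := b :* (k :* (a :* (c :* d)))) refl k a b c d))
             (null-∂ c (k ⊠ (a ⊠ (b ⊠ d))) (S.solve 5
                 (λ k a b c d → k :* a :* b :* c :* d := c :* (k :* (a :* (b :* d)))) refl k a b c d))
             (null-∂ d (k ⊠ (a ⊠ (b ⊠ c))) (S.solve 5
                 (λ k a b c d → k :* a :* b :* c :* d := d :* (k :* (a :* (b :* c)))) refl k a b c d))) ⟩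
      1ℤ * iverson (count-false (null (# 2 ⊠ a ⊟ r)) (null (# 2 ⊠ b ⊟ r)) (null (# 2 ⊠ c ⊟ r))
          (null (# 2 ⊠ d ⊟ r)) ℕ.≟ n)
        ≡⟨ cong (1ℤ *_) (generic-count j (null (# 2 ⊠ a ⊟ r)) (null (# 2 ⊠ b ⊟ r)) (null (# 2 ⊠ c ⊟ r))
           (null (# 2 ⊠ d ⊟ r))) ⟩
      1ℤ * G
        ≡⟨ Z.solve 2 (λ D G → Z.con 1ℤ Z.:* G Z.:= Z.con 0ℤ Z.:* D Z.:+ Z.con 1ℤ Z.:* Z.con 1ℤ Z.:* G) refl D G
           ⟩
      0ℤ * D + 1ℤ * 1ℤ * G
        ≡⟨ cong₂ (λ u v → u * D + v * G) (sym (δ-≢0 r≢0)) (sym (cong₂ _*_ (δ-≡0 q≡0) (w-≢0 r≢0))) ⟩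
      δ r * D + V r π * G ∎
      where
      r²≡π : r ⊠ r ≡ π
      r²≡π = x⊟y≡0⇒x≡y q≡0
      -- On the solution set x ∂f/∂x = 2sx - s² = s(2x - s).
      null-∂ : ∀ x y → π ≡ x ⊠ y → null (partial r y) ≡ null (# 2 ⊠ x ⊟ r)
      null-∂ x y π≡xy = trans (sym (null-scale x x≢0 (begin
        r ⊠ (# 2 ⊠ x ⊟ r)
          ≡⟨ S.solve 2 (λ r x → r :* (con (+ 2) :* x :- r) := con (+ 2) :* r :* x :- r :* r) refl r x ⟩
        # 2 ⊠ r ⊠ x ⊟ r ⊠ r        ≡⟨ cong (λ t → # 2 ⊠ r ⊠ x ⊟ t) (trans r²≡π π≡xy) ⟩
        # 2 ⊠ r ⊠ x ⊟ x ⊠ y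
          ≡⟨ S.solve 3 (λ r x y → con (+ 2) :* r :* x :- x :* y := x :* (con (+ 2) :* r :- y)) refl r x y ⟩
        x ⊠ partial r y ∎))) (null-scale r r≢0 refl)
        where
        x≢0 : x ≢ 0#
        -- x y = π = r² is nonzero, so x is.
        x≢0 = *-≢0ˡ (subst (_≢ 0#) (trans r²≡π π≡xy) (*-≢0 r≢0 r≢0))

-- Fourfold sums, their symmetry, and the stratum s = 0

module DegreeSums {p : ℕ} (F : OddField p) where

  open OddField F
  open FieldTheory F
  open QuadraticCharacter F
  open VertexCount F
  open DegreeCount F
  open S using (_:+_; _:*_; _:-_; :-_; _:=_; con)
  private module K = CommutativeRing commutativeRing

  Fun₄ : Set
  Fun₄ = Fin p → Fin p → Fin p → Fin p → ℤ

  infixl 6 _+̇_ _-̇_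
  _+̇_ _-̇_ : Fun₄ → Fun₄ → Fun₄
  (f +̇ g) a b c d = f a b c d + g a b c d
  (f -̇ g) a b c d = f a b c d - g a b c d

  ∑₂ : (Fin p → Fin p → ℤ) → ℤ
  ∑₂ f = ∑ λ a → ∑ (f a)

  ∑₄ : Fun₄ → ℤ
  ∑₄ f = ∑₂ λ a b → ∑₂ (f a b)

  ∑₂-cong : ∀ {f g : Fin p → Fin p → ℤ} → (∀ a b → f a b ≡ g a b) → ∑₂ f ≡ ∑₂ g
  ∑₂-cong eq = ∑-cong λ a → ∑-cong (eq a)

  ∑₂-+ : ∀ (f g : Fin p → Fin p → ℤ) → ∑₂ (λ a b → f a b + g a b) ≡ ∑₂ f + ∑₂ g
  ∑₂-+ f g = trans (∑-cong λ a → ∑-+ (f a) (g a)) (∑-+ (λ a → ∑ (f a)) (λ a → ∑ (g a)))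

  ∑₂-*ˡ : ∀ c (f : Fin p → Fin p → ℤ) → ∑₂ (λ a b → c * f a b) ≡ c * ∑₂ f
  ∑₂-*ˡ c f = trans (∑-cong λ a → ∑-*ˡ c (f a)) (∑-*ˡ c (λ a → ∑ (f a)))

  ∑₄-cong : ∀ {f g : Fun₄} → (∀ a b c d → f a b c d ≡ g a b c d) → ∑₄ f ≡ ∑₄ g
  ∑₄-cong eq = ∑₂-cong λ a b → ∑₂-cong (eq a b)

  ∑₄-+ : ∀ (f g : Fun₄) → ∑₄ (f +̇ g) ≡ ∑₄ f + ∑₄ g
  ∑₄-+ f g = trans (∑₂-cong λ a b → ∑₂-+ (f a b) (g a b)) (∑₂-+ (λ a b → ∑₂ (f a b)) (λ a b → ∑₂ (g a b)))

  ∑₄-*ˡ : ∀ c (f : Fun₄) → ∑₄ (λ x y z t → c * f x y z t) ≡ c * ∑₄ f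
  ∑₄-*ˡ c f = trans (∑₂-cong λ a b → ∑₂-*ˡ c (f a b)) (∑₂-*ˡ c (λ a b → ∑₂ (f a b)))

  -- Summation against a fixed weight as a linear functional. Its linearity carries `eⱼ` and
  -- `generic` from the pointwise products to the sums.
  module Weighted (W : Fun₄) where

    T : Fun₄ → ℤ
    T f = ∑₄ λ a b c d → W a b c d * f a b c d

    T-+ : ∀ f g → T (f +̇ g) ≡ T f + T g
    T-+ f g = trans (∑₄-cong λ a b c d → ℤ.*-distribˡ-+ (W a b c d) (f a b c d) (g a b c d))
      (∑₄-+ (λ a b c d → W a b c d * f a b c d) (λ a b c d → W a b c d * g a b c d))

    T-* : ∀ c f → T (λ x y z t → c * f x y z t) ≡ c * T f
    T-* c f = trans (∑₄-cong λ x y z t → Z.solve 3 (λ W c f → W Z.:* (c Z.:* f) Z.:= c Z.:* (W Z.:* f)) refl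
        (W x y z t) c (f x y z t))
      (∑₄-*ˡ c (λ x y z t → W x y z t * f x y z t))

    T-- : ∀ f g → T (f -̇ g) ≡ T f - T g
    T-- f g = begin
      T (f -̇ g)
        ≡⟨ ∑₄-cong (λ a b c d → cong (λ t → W a b c d * (f a b c d + t)) (sym (ℤ.-1*i≡-i (g a b c d)))) ⟩
      T (f +̇ (λ x y z t → -1ℤ * g x y z t))     ≡⟨ T-+ f (λ x y z t → -1ℤ * g x y z t) ⟩
      T f + T (λ x y z t → -1ℤ * g x y z t)     ≡⟨ cong (_+_ (T f)) (trans (T-* -1ℤ g) (ℤ.-1*i≡-i (T g))) ⟩
      T f - T g ∎

    T-+₃ : ∀ f g h → T (f +̇ g +̇ h) ≡ T f + T g + T h
    T-+₃ f g h = trans (T-+ (f +̇ g) h) (cong (_+ T h) (T-+ f g))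

    T-+₄ : ∀ f g h i → T (f +̇ g +̇ h +̇ i) ≡ T f + T g + T h + T i
    T-+₄ f g h i = trans (T-+ (f +̇ g +̇ h) i) (cong (_+ T i) (T-+₃ f g h))

    module _ (u : Bool → Bool → Bool → Bool → Fun₄) where

      private
        at : Fin p → Fin p → Fin p → Fin p → Bool → Bool → Bool → Bool → ℤ
        at a b c d α β γ κ = u α β γ κ a b c d
        Tu : Bool → Bool → Bool → Bool → ℤ
        Tu α β γ κ = T (u α β γ κ)
        E₁ E₂ E₃ E₄ : Fun₄
        E₁ a b c d = e₁ (at a b c d)
        E₂ a b c d = e₂ (at a b c d)
        E₃ a b c d = e₃ (at a b c d)
        E₄ a b c d = e₄ (at a b c d)

      T-e₁ : T E₁ ≡ e₁ Tu
      T-e₁ = T-+₄ (u true false false false) (u false true false false) (u false false true false)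
          (u false false false true)

      T-e₂ : T E₂ ≡ e₂ Tu
      T-e₂ = trans (T-+₃ (ab +̇ ac +̇ ad +̇ bc) bd cd) (cong (λ t → t + T bd + T cd) (T-+₄ ab ac ad bc))
        where
        ab ac ad bc bd cd : Fun₄
        ab = u true true false false
        ac = u true false true false
        ad = u true false false true
        bc = u false true true false
        bd = u false true false true
        cd = u false false true true

      T-e₃ : T E₃ ≡ e₃ Tu
      T-e₃ = T-+₄ (u false true true true) (u true false true true) (u true true false true)
          (u true true true false)

      T-generic : ∀ n → T (λ a b c d → generic n (at a b c d)) ≡ generic n Tu
      T-generic 0 = refl
      T-generic 1 = trans (T-- E₃ (λ a b c d → + 4 * E₄ a b c d)) (cong₂ _-_ T-e₃ (T-* (+ 4) E₄))
      T-generic 2 = trans (T-+ (E₂ -̇ (λ a b c d → + 3 * E₃ a b c d)) (λ a b c d → + 6 * E₄ a b c d))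
        (cong₂ _+_ (trans (T-- E₂ (λ a b c d → + 3 * E₃ a b c d))
          (cong₂ _-_ T-e₂ (trans (T-* (+ 3) E₃) (cong (+ 3 *_) T-e₃)))) (T-* (+ 6) E₄))
      T-generic 3 = trans (T-- (E₁ -̇ 2E₂ +̇ 3E₃) (λ a b c d → + 4 * E₄ a b c d))
        (cong₂ _-_ (trans (T-+ (E₁ -̇ 2E₂) 3E₃) (cong₂ _+_
          (trans (T-- E₁ 2E₂) (cong₂ _-_ T-e₁ (trans (T-* (+ 2) E₂) (cong (+ 2 *_) T-e₂))))
          (trans (T-* (+ 3) E₃) (cong (+ 3 *_) T-e₃)))) (T-* (+ 4) E₄))
        where
        2E₂ 3E₃ : Fun₄
        2E₂ a b c d = + 2 * E₂ a b c d
        3E₃ a b c d = + 3 * E₃ a b c d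
      T-generic (ℕ.suc (ℕ.suc (ℕ.suc (ℕ.suc n)))) = trans (T-* 0ℤ (λ _ _ _ _ → 0ℤ))
          (ℤ.*-zeroˡ (T (λ _ _ _ _ → 0ℤ)))

  -- The kernel sees only s and the product of the coordinates, so adjacent transpositions, and with
  -- them all permutations of the mask, preserve the sum. Each `eⱼ` thus reduces to one mask; its
  -- `true` entries come last, so that the innermost variables are the ones eliminated.
  module Symmetric (k : Fin p) (kernel : Fin p → Fin p → ℤ) (f : Fin p → Fin p → Bool → ℤ) where

    summand : Bool → Bool → Bool → Bool → Fun₄
    summand α β γ κ a b c d = kernel (s a b c d) (k ⊠ a ⊠ b ⊠ c ⊠ d) * on f (s a b c d) a b c d α β γ κ

    U : Bool → Bool → Bool → Bool → ℤ
    U α β γ κ = ∑₄ (summand α β γ κ)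

    private
      transfer : ∀ {r r′ π π′} a b c d α β γ κ {Y} → r ≡ r′ → π ≡ π′ → on f r′ a b c d α β γ κ ≡ Y →
                 kernel r π * on f r a b c d α β γ κ ≡ kernel r′ π′ * Y
      transfer a b c d α β γ κ refl refl refl = refl

    U-swap₁ : ∀ α β γ κ → U α β γ κ ≡ U β α γ κ
    U-swap₁ α β γ κ = trans (∑-swap (λ a b → ∑₂ (summand α β γ κ a b)))
        (∑₄-cong λ a b c d → let r = s a b c d in
      transfer b a c d α β γ κ
        (S.solve 4 (λ a b c d → b :+ a :+ c :+ d :+ con 1ℤ := a :+ b :+ c :+ d :+ con 1ℤ) refl a b c d)
        (S.solve 5 (λ k a b c d → k :* b :* a :* c :* d := k :* a :* b :* c :* d) refl k a b c d)
        (Z.solve 4 (λ x y z t → x Z.:* (y Z.:* (z Z.:* t)) Z.:= y Z.:* (x Z.:* (z Z.:* t))) refl (f r b α)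
            (f r a β) (f r c γ) (f r d κ)))

    U-swap₂ : ∀ α β γ κ → U α β γ κ ≡ U α γ β κ
    U-swap₂ α β γ κ = trans (∑-cong λ a → ∑-swap (λ b c → ∑ (summand α β γ κ a b c)))
        (∑₄-cong λ a b c d → let r = s a b c d in
      transfer a c b d α β γ κ
        (S.solve 4 (λ a b c d → a :+ c :+ b :+ d :+ con 1ℤ := a :+ b :+ c :+ d :+ con 1ℤ) refl a b c d)
        (S.solve 5 (λ k a b c d → k :* a :* c :* b :* d := k :* a :* b :* c :* d) refl k a b c d)
        (Z.solve 4 (λ x y z t → x Z.:* (y Z.:* (z Z.:* t)) Z.:= x Z.:* (z Z.:* (y Z.:* t))) refl (f r a α)
            (f r c β) (f r b γ) (f r d κ)))

    U-swap₃ : ∀ α β γ κ → U α β γ κ ≡ U α β κ γ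
    U-swap₃ α β γ κ = trans (∑₂-cong λ a b → ∑-swap (summand α β γ κ a b))
        (∑₄-cong λ a b c d → let r = s a b c d in
      transfer a b d c α β γ κ
        (S.solve 4 (λ a b c d → a :+ b :+ d :+ c :+ con 1ℤ := a :+ b :+ c :+ d :+ con 1ℤ) refl a b c d)
        (S.solve 5 (λ k a b c d → k :* a :* b :* d :* c := k :* a :* b :* c :* d) refl k a b c d)
        (Z.solve 4 (λ x y z t → x Z.:* (y Z.:* (z Z.:* t)) Z.:= x Z.:* (y Z.:* (t Z.:* z))) refl (f r a α)
            (f r b β) (f r d γ) (f r c κ)))

    e₁-U : e₁ U ≡ + 4 * U false false false true
    e₁-U = trans (cong₂ _+_ (cong₂ _+_ (cong₂ _+_ a≡d b≡d) c≡d) refl)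
        (Z.solve 1 (λ x → x Z.:+ x Z.:+ x Z.:+ x Z.:= Z.con (+ 4) Z.:* x) refl _)
      where
      c≡d = U-swap₃ false false true false
      b≡d = trans (U-swap₂ false true false false) c≡d
      a≡d = trans (U-swap₁ true false false false) b≡d

    e₂-U : e₂ U ≡ + 6 * U false false true true
    e₂-U = trans (cong₂ _+_ (cong₂ _+_ (cong₂ _+_ (cong₂ _+_ (cong₂ _+_ ab ac) ad) bc) bd) refl)
      (Z.solve 1 (λ x → x Z.:+ x Z.:+ x Z.:+ x Z.:+ x Z.:+ x Z.:= Z.con (+ 6) Z.:* x) refl _)
      where
      bd = U-swap₂ false true false true
      bc = trans (U-swap₃ false true true false) bd
      ad = trans (U-swap₁ true false false true) bd
      ac = trans (U-swap₁ true false true false) bc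
      ab = trans (U-swap₂ true true false false) ac

    e₃-U : e₃ U ≡ + 4 * U false true true true
    e₃-U = trans (cong₂ _+_ (cong₂ _+_ (cong₂ _+_ (refl {x = U false true true true}) acd) abd) abc)
        (Z.solve 1 (λ x → x Z.:+ x Z.:+ x Z.:+ x Z.:= Z.con (+ 4) Z.:* x) refl (U false true true true))
      where
      acd = U-swap₁ true false true true
      abd = trans (U-swap₂ true true false true) acd
      abc = trans (U-swap₃ true true true false) abd

  -- The excluded values 0 and -m coincide exactly when m = 0.
  ∑-w-w : ∀ m → ∑ (λ b → w b * w (b ⊞ m)) ≡ P - + 2 + δ m
  ∑-w-w m = begin
    ∑ (λ b → w b * w (b ⊞ m))      ≡⟨ ∑-w* (λ b → w (b ⊞ m)) ⟩
    ∑ (λ b → w (b ⊞ m)) - w (0# ⊞ m) ≡⟨ cong₂ _-_ (trans (∑-shift m w) ∑-w) (cong w (K.+-identityˡ m)) ⟩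
    P - 1ℤ - (1ℤ - δ m)
      ≡⟨ Z.solve 2 (λ P d → P Z.:- Z.con 1ℤ Z.:- (Z.con 1ℤ Z.:- d) Z.:= P Z.:- Z.con (+ 2) Z.:+ d) refl P (δ m)
         ⟩
    P - + 2 + δ m ∎

  ∑-w*-const : ∀ c → ∑ (λ a → w a * c) ≡ (P - 1ℤ) * c
  ∑-w*-const c = trans (∑-*ʳ w c) (cong (_* c) ∑-w)

  -- Each a ≠ 0 allows p - 2 values of b, and a = -1 one more.
  ∑₂-www : ∑₂ (λ a b → w a * (w b * w (b ⊞ (a ⊞ # 1)))) ≡ (P - 1ℤ) * (P - + 2) + 1ℤ
  ∑₂-www = begin
    ∑₂ (λ a b → w a * (w b * w (b ⊞ (a ⊞ # 1))))
      ≡⟨ ∑-cong (λ a → trans (∑-*ˡ (w a) (λ b → w b * w (b ⊞ (a ⊞ # 1)))) (cong (w a *_) (∑-w-w (a ⊞ # 1)))) ⟩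
    ∑ (λ a → w a * (P - + 2 + δ (a ⊞ # 1)))       ≡⟨ ∑-w* (λ a → P - + 2 + δ (a ⊞ # 1)) ⟩
    ∑ (λ a → P - + 2 + δ (a ⊞ # 1)) - (P - + 2 + δ (0# ⊞ # 1))
      ≡⟨ cong₂ _-_ (trans (∑-+ (λ _ → P - + 2) (λ a → δ (a ⊞ # 1)))
         (cong₂ _+_ (∑-const (P - + 2)) (trans (∑-shift (# 1) δ) ∑-δ1)))
           (cong (λ t → P - + 2 + t) (δ-≢0 (λ eq → 1≢0 (trans (sym ι-1) (trans (sym (K.+-identityˡ _)) eq))))) ⟩
    P * (P - + 2) + 1ℤ - (P - + 2 + 0ℤ)
      ≡⟨ Z.solve 1 (λ P → P Z.:* (P Z.:- Z.con (+ 2)) Z.:+ Z.con 1ℤ Z.:- (P Z.:- Z.con (+ 2) Z.:+ Z.con 0ℤ)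
                                                        Z.:= (P Z.:- Z.con 1ℤ) Z.:* (P Z.:- Z.con (+ 2)) Z.:+
                                                            Z.con 1ℤ) refl P ⟩
    (P - 1ℤ) * (P - + 2) + 1ℤ ∎

  w-neg : ∀ {x y} → y ≡ ι -1ℤ ⊠ x → w y ≡ w x
  w-neg eq = cong (_-_ 1ℤ) (δ-scale (ι -1ℤ) -1≢0 eq)

  x≡ι0⇒x≡0 : ∀ {x} → x ≡ ι 0ℤ → x ≡ 0#
  x≡ι0⇒x≡0 eq = trans eq ι-0

  module Degenerate (k : Fin p) where

    open Symmetric k (λ r _ → δ r) exactly-null

    ∑-δ-s : ∀ a b c (g : Fin p → ℤ) → ∑ (λ d → δ (s a b c d) * g d) ≡ g (⊟ (a ⊞ b ⊞ c ⊞ # 1))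
    ∑-δ-s a b c = ∑-select (⊟ (a ⊞ b ⊞ c ⊞ # 1)) (s a b c)
      (λ d eq → x⊟y≡0⇒x≡y (trans (S.solve 4 (λ a b c d →
        d :- (:- (a :+ b :+ c :+ con 1ℤ)) := a :+ b :+ c :+ d :+ con 1ℤ) refl a b c d) eq))
      (x≡ι0⇒x≡0 (S.solve 3 (λ a b c → a :+ b :+ c :+ (:- (a :+ b :+ c :+ con 1ℤ)) :+ con 1ℤ := con 0ℤ) refl a b
          c))

    -- With d = 0 and s = 0 the coordinate c is forced to be -(a + b + 1), and the pairs counted by
    -- `∑₂-www` remain.
    one-zero : U false false false true ≡ (P - 1ℤ) * (P - + 2) + 1ℤ
    one-zero = trans (∑₂-cong inner) ∑₂-www
      where
      inner : ∀ a b → ∑₂ (summand false false false true a b) ≡ w a * (w b * w (b ⊞ (a ⊞ # 1)))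
      inner a b = begin
        ∑₂ (λ c d → δ (s a b c d) * (w a * (w b * (w c * δ d))))
          ≡⟨ ∑-cong (λ c → trans (∑-cong λ d → Z.solve 5 (λ e x y z t → e Z.:* (x Z.:* (y Z.:* (z Z.:* t))) Z.:=
               t Z.:* (e Z.:* (x Z.:* (y Z.:* z)))) refl (δ (s a b c d)) (w a) (w b) (w c) (δ d))
               (∑-δ (λ d → δ (s a b c d) * (w a * (w b * w c))))) ⟩
        ∑ (λ c → δ (s a b c 0#) * (w a * (w b * w c)))
          -- Moves c to the last slot of `s`, where `∑-δ-s` can eliminate it.
          ≡⟨ ∑-cong (λ c → cong (λ r → δ r * (w a * (w b * w c)))
             (cong (_⊞ # 1) (trans (K.+-identityʳ _)
                 (sym (trans (cong (λ t → a ⊞ b ⊞ t ⊞ c) ι-0) (cong (_⊞ c) (K.+-identityʳ _))))))) ⟩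
        ∑ (λ c → δ (s a b (ι 0ℤ) c) * (w a * (w b * w c)))
          ≡⟨ ∑-δ-s a b (ι 0ℤ) (λ c → w a * (w b * w c)) ⟩
        w a * (w b * w (⊟ (a ⊞ b ⊞ ι 0ℤ ⊞ # 1)))
          ≡⟨ cong (λ t → w a * (w b * t))
             (w-neg (S.solve 2 (λ a b → :- (a :+ b :+ con 0ℤ :+ con 1ℤ) := con -1ℤ :* (b :+ (a :+ con 1ℤ)))
                 refl a b)) ⟩
        w a * (w b * w (b ⊞ (a ⊞ # 1))) ∎

    -- Eliminating d leaves nonzero a, b, c with a + b + c + 1 ≠ 0. The excess of `∑-w-w` at a + b +
    -- 1 = 0 is written as `s 0# a 0# b`, so that `∑-δ-s` applies to b.
    no-zero : U false false false false ≡ (P - 1ℤ) * ((P - 1ℤ) * (P - + 2)) + (P - + 2)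
    no-zero = begin
      U false false false false ≡⟨ ∑₂-cong inner ⟩
      ∑₂ (λ a b → w a * (w b * (P - + 2) + δ (s 0# a 0# b) * w b)) ≡⟨ ∑-cong outer ⟩
      ∑ (λ a → w a * ((P - 1ℤ) * (P - + 2) + w (a ⊞ # 1)))
        ≡⟨ trans (∑-cong λ a → ℤ.*-distribˡ-+ (w a) ((P - 1ℤ) * (P - + 2)) (w (a ⊞ # 1)))
             (∑-+ (λ a → w a * ((P - 1ℤ) * (P - + 2))) (λ a → w a * w (a ⊞ # 1))) ⟩
      ∑ (λ a → w a * ((P - 1ℤ) * (P - + 2))) + ∑ (λ a → w a * w (a ⊞ # 1))
        ≡⟨ cong₂ _+_ (∑-w*-const ((P - 1ℤ) * (P - + 2)))
           (trans (∑-w-w (# 1)) (trans (cong (_+_ (P - + 2)) (δ-≢0 λ eq → 1≢0 (trans (sym ι-1) eq)))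
             (ℤ.+-identityʳ _))) ⟩
      (P - 1ℤ) * ((P - 1ℤ) * (P - + 2)) + (P - + 2) ∎
      where
      s₀ : ∀ a b → s 0# a 0# b ≡ b ⊞ (a ⊞ # 1)
      s₀ a b = trans (cong (λ t → t ⊞ a ⊞ t ⊞ b ⊞ # 1) (sym ι-0)) (S.solve 2 (λ a b →
        con 0ℤ :+ a :+ con 0ℤ :+ b :+ con 1ℤ := b :+ (a :+ con 1ℤ)) refl a b)
      inner : ∀ a b → ∑₂ (summand false false false false a b) ≡ w a * (w b * (P - + 2) + δ (s 0# a 0# b) * w b)
      inner a b = begin
        ∑₂ (λ c d → δ (s a b c d) * (w a * (w b * (w c * w d))))
          ≡⟨ ∑-cong (λ c → trans (∑-δ-s a b c (λ d → w a * (w b * (w c * w d))))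
             (cong (λ t → w a * (w b * (w c * t)))
               (w-neg (S.solve 3 (λ a b c → :- (a :+ b :+ c :+ con 1ℤ) := con -1ℤ :*
                   (c :+ (b :+ (a :+ con 1ℤ)))) refl a b c)))) ⟩
        ∑ (λ c → w a * (w b * (w c * w (c ⊞ (b ⊞ (a ⊞ # 1))))))
          ≡⟨ trans (∑-*ˡ (w a) (λ c → w b * (w c * w (c ⊞ (b ⊞ (a ⊞ # 1)))))) (cong (w a *_)
               (trans (∑-*ˡ (w b) (λ c → w c * w (c ⊞ (b ⊞ (a ⊞ # 1)))))
                   (cong (w b *_) (∑-w-w (b ⊞ (a ⊞ # 1)))))) ⟩
        w a * (w b * (P - + 2 + δ (b ⊞ (a ⊞ # 1))))
          ≡⟨ cong (w a *_) (trans (ℤ.*-distribˡ-+ (w b) (P - + 2) (δ (b ⊞ (a ⊞ # 1))))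
             (cong (_+_ (w b * (P - + 2)))
               (trans (ℤ.*-comm (w b) (δ (b ⊞ (a ⊞ # 1)))) (cong (λ t → δ t * w b) (sym (s₀ a b)))))) ⟩
        w a * (w b * (P - + 2) + δ (s 0# a 0# b) * w b) ∎
      outer : ∀ a → ∑ (λ b → w a * (w b * (P - + 2) + δ (s 0# a 0# b) * w b)) ≡ w a *
          ((P - 1ℤ) * (P - + 2) + w (a ⊞ # 1))
      outer a = begin
        ∑ (λ b → w a * (w b * (P - + 2) + δ (s 0# a 0# b) * w b))
          ≡⟨ ∑-*ˡ (w a) (λ b → w b * (P - + 2) + δ (s 0# a 0# b) * w b) ⟩
        w a * ∑ (λ b → w b * (P - + 2) + δ (s 0# a 0# b) * w b)
          ≡⟨ cong (w a *_) (∑-+ (λ b → w b * (P - + 2)) (λ b → δ (s 0# a 0# b) * w b)) ⟩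
        w a * (∑ (λ b → w b * (P - + 2)) + ∑ (λ b → δ (s 0# a 0# b) * w b))
          ≡⟨ cong (w a *_) (cong₂ _+_ (∑-w*-const (P - + 2)) (trans (∑-δ-s 0# a 0# w) (w-neg
               (trans (cong (λ t → ⊟ (t ⊞ a ⊞ t ⊞ # 1)) (sym ι-0))
                   (S.solve 1 (λ a → :- (con 0ℤ :+ a :+ con 0ℤ :+ con 1ℤ) := con -1ℤ :* (a :+ con 1ℤ)) refl
                       a))))) ⟩
        w a * ((P - 1ℤ) * (P - + 2) + w (a ⊞ # 1)) ∎

    total : ∑₄ (λ a b c d → δ (s a b c d) * 1ℤ) ≡ P * (P * P)
    total = trans (∑₂-cong λ a b → trans (∑-cong λ c → ∑-δ-s a b c (λ _ → 1ℤ)) (sum-1 p))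
      (trans (∑-cong λ a → ∑-const P) (∑-const (P * P)))

    open Weighted (λ a b c d → δ (s a b c d))

    -- Computed as a complement in the p³ points of the hyperplane. The set is the union of six
    -- lines xᵢ = xⱼ = 0 of p points each, which meet three at a time in the four points with three
    -- zeros: 6p - 2 · 4.
    degenerate-sum₀ : ∑₄ (λ a b c d → δ (s a b c d) * degenerate 0 (on exactly-null (s a b c d) a b c d)) ≡ + 6
        * P - + 8
    degenerate-sum₀ = begin
      T (one -̇ U₀ -̇ U₁)  ≡⟨ trans (T-- (one -̇ U₀) U₁) (cong (_- T U₁) (T-- one U₀)) ⟩
      T one - T U₀ - T U₁ ≡⟨ cong₂ _-_ (cong₂ _-_ total no-zero)
                               (trans (T-e₁ (λ α β γ κ a b c d → on exactly-null (s a b c d) a b c d α β γ κ))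
                                   (trans e₁-U (cong (+ 4 *_) one-zero))) ⟩
      P * (P * P) - ((P - 1ℤ) * ((P - 1ℤ) * (P - + 2)) + (P - + 2)) - + 4 * ((P - 1ℤ) * (P - + 2) + 1ℤ)
        ≡⟨ Z.solve 1 (λ P → let P-1 = P Z.:- Z.con 1ℤ ; P-2 = P Z.:- Z.con (+ 2) in
             P Z.:* (P Z.:* P) Z.:- (P-1 Z.:* (P-1 Z.:* P-2) Z.:+ P-2) Z.:- Z.con (+ 4) Z.:*
                 (P-1 Z.:* P-2 Z.:+ Z.con 1ℤ)
             Z.:= Z.con (+ 6) Z.:* P Z.:- Z.con (+ 8)) refl P ⟩
      + 6 * P - + 8 ∎
      where
      one U₀ U₁ : Fun₄
      one a b c d = 1ℤ
      U₀ a b c d = e₀ (on exactly-null (s a b c d) a b c d)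
      U₁ a b c d = e₁ (on exactly-null (s a b c d) a b c d)

    degenerate-sum₁ : ∑₄ (λ a b c d → δ (s a b c d) * degenerate 1 (on exactly-null (s a b c d) a b c d))
                      ≡ + 4 * ((P - 1ℤ) * (P - + 2) + 1ℤ)
    degenerate-sum₁ = trans (T-e₁ (λ α β γ κ a b c d → on exactly-null (s a b c d) a b c d α β γ κ))
        (trans e₁-U (cong (+ 4 *_) one-zero))

    T-0 : T (λ _ _ _ _ → 0ℤ) ≡ 0ℤ
    T-0 = trans (T-* 0ℤ (λ _ _ _ _ → 0ℤ)) (ℤ.*-zeroˡ (T (λ _ _ _ _ → 0ℤ)))

-- The stratum s ≠ 0: solutions with prescribed coordinates equal to s/2

module GenericSums {p : ℕ} (F : OddField p) where

  open OddField F
  open FieldTheory F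
  open QuadraticCharacter F
  open VertexCount F
  open DegreeCount F
  open DegreeSums F
  open S using (_:+_; _:*_; _:-_; :-_; _:=_; con)
  private module K = CommutativeRing commutativeRing

  module Generic (k : Fin p) (k≢0 : k ≢ 0#) (e : Fin p) (ke : k ⊠ e ≡ k ⊟ # 16) where

    open Symmetric k V atLeast-½

    -- A is the value of d forced by 2d = s, and b₀ the value of b forced by 2c = 2d = s.
    A : Fin p → Fin p → Fin p → Fin p
    A a b c = a ⊞ b ⊞ c ⊞ # 1

    -- What `V` becomes once 2d = s is imposed: then d = A and s = 2A, and the equation 4A² = k a b
    -- c A loses the nonzero factor A.
    R : Fin p → Fin p → Fin p → ℤ
    R a b c = w (A a b c) * δ (# 4 ⊠ A a b c ⊟ k ⊠ a ⊠ b ⊠ c)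

    V-at : ∀ a b c → V (# 2 ⊠ A a b c) (k ⊠ a ⊠ b ⊠ c ⊠ A a b c) ≡ R a b c
    V-at a b c = begin
      δ (# 2 ⊠ A′ ⊠ (# 2 ⊠ A′) ⊟ B ⊠ A′) * w (# 2 ⊠ A′) ≡⟨ ℤ.*-comm _ (w (# 2 ⊠ A′)) ⟩
      w (# 2 ⊠ A′) * δ (# 2 ⊠ A′ ⊠ (# 2 ⊠ A′) ⊟ B ⊠ A′)
        ≡⟨ cong (_* δ (# 2 ⊠ A′ ⊠ (# 2 ⊠ A′) ⊟ B ⊠ A′)) (cong (_-_ 1ℤ) (δ-scale (# 2) 2≢0 refl)) ⟩
      w A′ * δ (# 2 ⊠ A′ ⊠ (# 2 ⊠ A′) ⊟ B ⊠ A′)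
        ≡⟨ w-guard A′ (λ A≢0 → δ-scale A′ A≢0 (S.solve 2 (λ A B →
             con (+ 2) :* A :* (con (+ 2) :* A) :- B :* A := A :* (con (+ 4) :* A :- B)) refl A′ B)) ⟩
      w A′ * δ (# 4 ⊠ A′ ⊟ B) ∎
      where
      A′ = A a b c
      B = k ⊠ a ⊠ b ⊠ c

    -- The functions `x`, `y`, `z` stand for the conditions on the other coordinates; these may
    -- involve s, which becomes 2A. One elimination of d thus serves all the masks.
    sum-last : ∀ a b c (x y z : Fin p → ℤ) →
      ∑ (λ d → let r = s a b c d in V r (k ⊠ a ⊠ b ⊠ c ⊠ d) * (x r * (y r * (z r * δ (# 2 ⊠ d ⊟ r)))))
      ≡ R a b c * (x (# 2 ⊠ A a b c) * (y (# 2 ⊠ A a b c) * z (# 2 ⊠ A a b c)))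
    sum-last a b c x y z = begin
      ∑ (λ d → let r = s a b c d in V r (k ⊠ a ⊠ b ⊠ c ⊠ d) * (x r * (y r * (z r * δ (# 2 ⊠ d ⊟ r)))))
        ≡⟨ ∑-cong (λ d → let r = s a b c d in Z.solve 5 (λ v x y z t → v Z.:* (x Z.:* (y Z.:* (z Z.:* t))) Z.:=
             t Z.:* (v Z.:* (x Z.:* (y Z.:* z)))) refl (V r (k ⊠ a ⊠ b ⊠ c ⊠ d)) (x r) (y r) (z r)
                 (δ (# 2 ⊠ d ⊟ r))) ⟩
      ∑ (λ d → δ (# 2 ⊠ d ⊟ s a b c d) * g (s a b c d) d)
        ≡⟨ ∑-select A′ (λ d → # 2 ⊠ d ⊟ s a b c d)
             (λ d eq → x⊟y≡0⇒x≡y (trans (S.solve 4 (λ a b c d → d :- (a :+ b :+ c :+ con 1ℤ) :=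
                con (+ 2) :* d :- (a :+ b :+ c :+ d :+ con 1ℤ)) refl a b c d) eq))
             (x≡ι0⇒x≡0 (S.solve 3 (λ a b c → let A = a :+ b :+ c :+ con 1ℤ in
                con (+ 2) :* A :- (a :+ b :+ c :+ A :+ con 1ℤ) := con 0ℤ) refl a b c))
             (λ d → g (s a b c d) d) ⟩
      g (s a b c A′) A′
        ≡⟨ cong (λ r → g r A′) (S.solve 3 (λ a b c → let A = a :+ b :+ c :+ con 1ℤ in
             a :+ b :+ c :+ A :+ con 1ℤ := con (+ 2) :* A) refl a b c) ⟩
      g (# 2 ⊠ A′) A′
        ≡⟨ cong (_* (x (# 2 ⊠ A′) * (y (# 2 ⊠ A′) * z (# 2 ⊠ A′)))) (V-at a b c) ⟩
      R a b c * (x (# 2 ⊠ A′) * (y (# 2 ⊠ A′) * z (# 2 ⊠ A′))) ∎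
      where
      A′ = A a b c
      g : Fin p → Fin p → ℤ
      g r d = V r (k ⊠ a ⊠ b ⊠ c ⊠ d) * (x r * (y r * z r))

    b₀ : Fin p → Fin p
    b₀ a = ⊟ a ⊟ # 1

    -- The equation that remains on a when 2c = 2d = s. It does not involve c, which stays free in
    -- the units.
    m : Fin p → ℤ
    m a = δ (k ⊠ a ⊠ b₀ a ⊟ # 4)

    -- As s = 2A, the condition 2c = s says A = c, that is, b = -a - 1. The equation 4c = k a b c
    -- then loses its factor c ≠ 0 and becomes k a b = 4.
    sum-middle : ∀ a (x : Fin p → ℤ) (y : Fin p → Fin p → ℤ) →
      ∑₂ (λ b c → let A′ = A a b c in R a b c * (x (# 2 ⊠ A′) * (y b (# 2 ⊠ A′) * δ (# 2 ⊠ c ⊟ # 2 ⊠ A′))))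
      ≡ ∑ (λ c → m a * (w c * (x (# 2 ⊠ c) * y (b₀ a) (# 2 ⊠ c))))
    sum-middle a x y = begin
      ∑₂ (λ b c → let A′ = A a b c in R a b c * (x (# 2 ⊠ A′) * (y b (# 2 ⊠ A′) * δ (# 2 ⊠ c ⊟ # 2 ⊠ A′))))
        ≡⟨ ∑-cong (λ b → trans (∑-cong (pointwise b)) (∑-*ˡ (δ (b ⊟ b₀ a)) (h b))) ⟩
      ∑ (λ b → δ (b ⊟ b₀ a) * ∑ (h b))  ≡⟨ ∑-δ⊟ (b₀ a) (λ b → ∑ (h b)) ⟩
      ∑ (h (b₀ a)) ∎
      where
      h : Fin p → Fin p → ℤ
      h b c = δ (k ⊠ a ⊠ b ⊟ # 4) * (w c * (x (# 2 ⊠ c) * y b (# 2 ⊠ c)))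
      pointwise : ∀ b c → let A′ = A a b c in
        R a b c * (x (# 2 ⊠ A′) * (y b (# 2 ⊠ A′) * δ (# 2 ⊠ c ⊟ # 2 ⊠ A′))) ≡ δ (b ⊟ b₀ a) * h b c
      pointwise b c = begin
        R a b c * (x (# 2 ⊠ A′) * (y b (# 2 ⊠ A′) * δ (# 2 ⊠ c ⊟ # 2 ⊠ A′)))
          ≡⟨ Z.solve 4 (λ r x y d → r Z.:* (x Z.:* (y Z.:* d)) Z.:= d Z.:* (r Z.:* (x Z.:* y))) refl
               (R a b c) (x (# 2 ⊠ A′)) (y b (# 2 ⊠ A′)) (δ (# 2 ⊠ c ⊟ # 2 ⊠ A′)) ⟩
        δ (# 2 ⊠ c ⊟ # 2 ⊠ A′) * (R a b c * (x (# 2 ⊠ A′) * y b (# 2 ⊠ A′)))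
          ≡⟨ cong (_* (R a b c * (x (# 2 ⊠ A′) * y b (# 2 ⊠ A′)))) (δ-scale (⊟ # 2) (⊟-≢0 2≢0)
               (S.solve 3 (λ a b c → con (+ 2) :* c :- con (+ 2) :* (a :+ b :+ c :+ con 1ℤ) :=
                 :- con (+ 2) :* (b :- (:- a :- con 1ℤ))) refl a b c)) ⟩
        δ (b ⊟ b₀ a) * (R a b c * (x (# 2 ⊠ A′) * y b (# 2 ⊠ A′)))
          ≡⟨ δ-guard (b ⊟ b₀ a) at-b₀ ⟩
        δ (b ⊟ b₀ a) * h b c ∎
        where
        A′ = A a b c
        at-b₀ : b ⊟ b₀ a ≡ 0# → R a b c * (x (# 2 ⊠ A′) * y b (# 2 ⊠ A′)) ≡ h b c
        at-b₀ eq = begin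
          R a b c * (x (# 2 ⊠ A′) * y b (# 2 ⊠ A′))
            ≡⟨ cong (λ t → w t * δ (# 4 ⊠ t ⊟ k ⊠ a ⊠ b ⊠ c) * (x (# 2 ⊠ t) * y b (# 2 ⊠ t))) A≡c ⟩
          w c * δ (# 4 ⊠ c ⊟ k ⊠ a ⊠ b ⊠ c) * (x (# 2 ⊠ c) * y b (# 2 ⊠ c))
            ≡⟨ cong (_* (x (# 2 ⊠ c) * y b (# 2 ⊠ c))) (w-guard c (λ c≢0 → δ-scale (⊟ c) (⊟-≢0 c≢0)
                 (S.solve 4 (λ k a b c → con (+ 4) :* c :- k :* a :* b :* c := :- c :*
                     (k :* a :* b :- con (+ 4))) refl k a b c))) ⟩
          w c * δ (k ⊠ a ⊠ b ⊟ # 4) * (x (# 2 ⊠ c) * y b (# 2 ⊠ c))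
            ≡⟨ Z.solve 3 (λ w d x → w Z.:* d Z.:* x Z.:= d Z.:* (w Z.:* x)) refl (w c) (δ (k ⊠ a ⊠ b ⊟ # 4))
               (x (# 2 ⊠ c) * y b (# 2 ⊠ c)) ⟩
          h b c ∎
          where
          A≡c : A′ ≡ c
          A≡c = x⊟y≡0⇒x≡y (trans (S.solve 3 (λ a b c → a :+ b :+ c :+ con 1ℤ :- c := b :- (:- a :- con 1ℤ))
              refl a b c) eq)

    m-w : ∀ a t → m a * (w (b₀ a) * t) ≡ m a * t
    m-w a t = δ-guard (k ⊠ a ⊠ b₀ a ⊟ # 4) λ eq →
      trans (cong (_* t) (w-≢0 (*-≢0ʳ (subst (_≢ 0#) (sym (x⊟y≡0⇒x≡y eq)) 4≢0)))) (ℤ.*-identityˡ t)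

    -- Divided by -k, the equation k a (-a - 1) = 4 is a² + a + 4/k = 0, with discriminant 1 - 16/k
    -- = e.
    ∑-m : ∑ m ≡ 1ℤ + χ e
    ∑-m = begin
      ∑ (λ a → δ (k ⊠ a ⊠ b₀ a ⊟ # 4))
        ≡⟨ ∑-cong (λ a → δ-scale (⊟ k) (⊟-≢0 k≢0) (monic a)) ⟩
      ∑ (λ a → δ (a ⊠ a ⊞ # 1 ⊠ a ⊞ # 4 ⊠ k ⁻¹))
        ≡⟨ ∑-δ-quadratic (# 1) (# 4 ⊠ k ⁻¹) ⟩
      1ℤ + χ (# 1 ⊠ # 1 ⊟ # 4 ⊠ (# 4 ⊠ k ⁻¹))
        ≡⟨ cong (λ t → 1ℤ + χ t) disc ⟩
      1ℤ + χ e ∎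
      where
      kk⁻¹ : # 1 ≡ k ⊠ k ⁻¹
      kk⁻¹ = trans ι-1 (sym (*-inverseʳ k≢0))
      monic : ∀ a → k ⊠ a ⊠ b₀ a ⊟ # 4 ≡ ⊟ k ⊠ (a ⊠ a ⊞ # 1 ⊠ a ⊞ # 4 ⊠ k ⁻¹)
      monic a = begin
        k ⊠ a ⊠ b₀ a ⊟ # 4             ≡⟨ S.solve 2 (λ k a → k :* a :* (:- a :- con 1ℤ) :- con (+ 4) :=
                                             k :* a :* (:- a :- con 1ℤ) :- con (+ 4) :* con 1ℤ) refl k a ⟩
        k ⊠ a ⊠ b₀ a ⊟ # 4 ⊠ # 1       ≡⟨ cong (λ t → k ⊠ a ⊠ b₀ a ⊟ # 4 ⊠ t) kk⁻¹ ⟩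
        k ⊠ a ⊠ b₀ a ⊟ # 4 ⊠ (k ⊠ k ⁻¹)
          ≡⟨ S.solve 3 (λ k i a → k :* a :* (:- a :- con 1ℤ) :- con (+ 4) :* (k :* i) :=
                                             :- k :* (a :* a :+ con 1ℤ :* a :+ con (+ 4) :* i)) refl k (k ⁻¹) a
                                                 ⟩
        ⊟ k ⊠ (a ⊠ a ⊞ # 1 ⊠ a ⊞ # 4 ⊠ k ⁻¹) ∎
      disc : # 1 ⊠ # 1 ⊟ # 4 ⊠ (# 4 ⊠ k ⁻¹) ≡ e
      disc = begin
        # 1 ⊠ # 1 ⊟ # 4 ⊠ (# 4 ⊠ k ⁻¹) ≡⟨ S.solve 1 (λ i → con 1ℤ :* con 1ℤ :- con (+ 4) :* (con (+ 4) :* i) :=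
                                             con 1ℤ :- con (+ 16) :* i) refl (k ⁻¹) ⟩
        # 1 ⊟ # 16 ⊠ k ⁻¹               ≡⟨ cong (_⊟ # 16 ⊠ k ⁻¹) kk⁻¹ ⟩
        k ⊠ k ⁻¹ ⊟ # 16 ⊠ k ⁻¹
          ≡⟨ S.solve 2 (λ k i → k :* i :- con (+ 16) :* i := (k :- con (+ 16)) :* i) refl k (k ⁻¹) ⟩
        (k ⊟ # 16) ⊠ k ⁻¹                ≡⟨ cong (_⊠ k ⁻¹) ke ⟨
        k ⊠ e ⊠ k ⁻¹                     ≡⟨ S.solve 3 (λ k i e → k :* e :* i := k :* i :* e) refl k (k ⁻¹) e ⟩
        k ⊠ k ⁻¹ ⊠ e                     ≡⟨ cong (_⊠ e) kk⁻¹ ⟨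
        # 1 ⊠ e                          ≡⟨ S.solve 1 (λ e → con 1ℤ :* e := e) refl e ⟩
        e ∎

    two-fixed : U false false true true ≡ (P - 1ℤ) * (1ℤ + χ e)
    two-fixed = begin
      U false false true true
        ≡⟨ ∑-cong (λ a → trans (∑₂-cong λ b c → sum-last a b c (λ _ → 1ℤ) (λ _ → 1ℤ) (λ r → δ (# 2 ⊠ c ⊟ r)))
             (sum-middle a (λ _ → 1ℤ) (λ _ _ → 1ℤ))) ⟩
      ∑ (λ a → ∑ (λ c → m a * (w c * (1ℤ * 1ℤ))))
        ≡⟨ ∑-cong (λ a → trans (∑-*ˡ (m a) (λ c → w c * (1ℤ * 1ℤ))) (cong (m a *_) (∑-w*-const (1ℤ * 1ℤ)))) ⟩
      ∑ (λ a → m a * ((P - 1ℤ) * (1ℤ * 1ℤ)))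
        ≡⟨ ∑-*ʳ m ((P - 1ℤ) * (1ℤ * 1ℤ)) ⟩
      ∑ m * ((P - 1ℤ) * (1ℤ * 1ℤ))
        ≡⟨ cong (_* ((P - 1ℤ) * (1ℤ * 1ℤ))) ∑-m ⟩
      (1ℤ + χ e) * ((P - 1ℤ) * (1ℤ * 1ℤ))
        ≡⟨ Z.solve 2 (λ P m → m Z.:* ((P Z.:- Z.con 1ℤ) Z.:* (Z.con 1ℤ Z.:* Z.con 1ℤ)) Z.:= (P Z.:- Z.con 1ℤ)
           Z.:* m) refl P (1ℤ + χ e) ⟩
      (P - 1ℤ) * (1ℤ + χ e) ∎

    sum-third : ∀ a (x : Fin p → ℤ) →
      ∑ (λ c → m a * (w c * (x (# 2 ⊠ c) * δ (# 2 ⊠ b₀ a ⊟ # 2 ⊠ c)))) ≡ m a * x (# 2 ⊠ b₀ a)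
    sum-third a x = begin
      ∑ (λ c → m a * (w c * (x (# 2 ⊠ c) * δ (# 2 ⊠ b₀ a ⊟ # 2 ⊠ c))))
        ≡⟨ ∑-cong (λ c → Z.solve 4 (λ m w x d → m Z.:* (w Z.:* (x Z.:* d)) Z.:= d Z.:* (m Z.:* (w Z.:* x))) refl
             (m a) (w c) (x (# 2 ⊠ c)) (δ (# 2 ⊠ b₀ a ⊟ # 2 ⊠ c))) ⟩
      ∑ (λ c → δ (# 2 ⊠ b₀ a ⊟ # 2 ⊠ c) * (m a * (w c * x (# 2 ⊠ c))))
        ≡⟨ ∑-select (b₀ a) (λ c → # 2 ⊠ b₀ a ⊟ # 2 ⊠ c)
             (λ c eq → sym (x⊟y≡0⇒x≡y (*-cancelˡ-0 2≢0 (trans (S.solve 2 (λ b c →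
               con (+ 2) :* (b :- c) := con (+ 2) :* b :- con (+ 2) :* c) refl (b₀ a) c) eq))))
             (K.-‿inverseʳ _) (λ c → m a * (w c * x (# 2 ⊠ c))) ⟩
      m a * (w (b₀ a) * x (# 2 ⊠ b₀ a))
        ≡⟨ m-w a (x (# 2 ⊠ b₀ a)) ⟩
      m a * x (# 2 ⊠ b₀ a) ∎

    three-fixed : U false true true true ≡ 1ℤ + χ e
    three-fixed = begin
      U false true true true
        ≡⟨ ∑-cong (λ a → trans (∑₂-cong λ b c → sum-last a b c (λ _ → 1ℤ) (λ r → δ (# 2 ⊠ b ⊟ r))
           (λ r → δ (# 2 ⊠ c ⊟ r)))
             (trans (sum-middle a (λ _ → 1ℤ) (λ b r → δ (# 2 ⊠ b ⊟ r))) (sum-third a (λ _ → 1ℤ)))) ⟩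
      ∑ (λ a → m a * 1ℤ)  ≡⟨ ∑-cong (λ a → ℤ.*-identityʳ (m a)) ⟩
      ∑ m                 ≡⟨ ∑-m ⟩
      1ℤ + χ e ∎

    -- The conditions force a = b₀ = -a - 1, so a = -1/2, and then k a b₀ = k/4 equals 4 only for k
    -- = 16. The single point is the one with all coordinates -1/2.
    four-fixed : U true true true true ≡ δ (k ⊟ # 16)
    four-fixed = begin
      U true true true true
        ≡⟨ ∑-cong (λ a → trans (∑₂-cong λ b c →
               sum-last a b c (λ r → δ (# 2 ⊠ a ⊟ r)) (λ r → δ (# 2 ⊠ b ⊟ r)) (λ r → δ (# 2 ⊠ c ⊟ r)))
             (trans (sum-middle a (λ r → δ (# 2 ⊠ a ⊟ r)) (λ b r → δ (# 2 ⊠ b ⊟ r)))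
                 (sum-third a (λ r → δ (# 2 ⊠ a ⊟ r))))) ⟩
      ∑ (λ a → m a * δ (# 2 ⊠ a ⊟ # 2 ⊠ b₀ a))
        ≡⟨ ∑-cong (λ a → ℤ.*-comm (m a) (δ (# 2 ⊠ a ⊟ # 2 ⊠ b₀ a))) ⟩
      ∑ (λ a → δ (# 2 ⊠ a ⊟ # 2 ⊠ b₀ a) * m a)
        ≡⟨ ∑-select (⊟ h) (λ a → # 2 ⊠ a ⊟ # 2 ⊠ b₀ a) unique root m ⟩
      δ (k ⊠ ⊟ h ⊠ b₀ (⊟ h) ⊟ # 4)
        ≡⟨ δ-scale (# 4) 4≢0 (begin
             k ⊟ # 16
               ≡⟨ S.solve 1 (λ k → k :- con (+ 16) := k :* con 1ℤ :* (con (+ 2) :* con 1ℤ :- con 1ℤ) :- con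
                  (+ 16)) refl k ⟩
             k ⊠ # 1 ⊠ (# 2 ⊠ # 1 ⊟ # 1) ⊟ # 16
               ≡⟨ cong₂ (λ u v → k ⊠ u ⊠ (# 2 ⊠ # 1 ⊟ v) ⊟ # 16) 1≡2h 1≡2h ⟩
             k ⊠ (# 2 ⊠ h) ⊠ (# 2 ⊠ # 1 ⊟ # 2 ⊠ h) ⊟ # 16
               ≡⟨ S.solve 2 (λ k h → k :* (con (+ 2) :* h) :* (con (+ 2) :* con 1ℤ :- con (+ 2) :* h) :- con
                  (+ 16) :=
                    con (+ 4) :* (k :* (:- h) :* (:- (:- h) :- con 1ℤ) :- con (+ 4))) refl k h ⟩
             # 4 ⊠ (k ⊠ ⊟ h ⊠ b₀ (⊟ h) ⊟ # 4) ∎) ⟨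
      δ (k ⊟ # 16) ∎
      where
      h : Fin p
      h = # 2 ⁻¹
      1≡2h : # 1 ≡ # 2 ⊠ h
      1≡2h = trans ι-1 (sym (*-inverseʳ 2≢0))
      unique : ∀ a → # 2 ⊠ a ⊟ # 2 ⊠ b₀ a ≡ 0# → a ≡ ⊟ h
      unique a eq = x⊟y≡0⇒x≡y (*-cancelˡ-0 4≢0 (begin
        # 4 ⊠ (a ⊟ ⊟ h)
          ≡⟨ S.solve 2 (λ a h → con (+ 4) :* (a :- (:- h)) := con (+ 4) :* a :+ con (+ 2) :* (con (+ 2) :* h))
             refl a h ⟩
        # 4 ⊠ a ⊞ # 2 ⊠ (# 2 ⊠ h)  ≡⟨ cong (λ t → # 4 ⊠ a ⊞ # 2 ⊠ t) 1≡2h ⟨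
        # 4 ⊠ a ⊞ # 2 ⊠ # 1         ≡⟨ S.solve 1 (λ a → con (+ 4) :* a :+ con (+ 2) :* con 1ℤ :=
                                         con (+ 2) :* a :- con (+ 2) :* (:- a :- con 1ℤ)) refl a ⟩
        # 2 ⊠ a ⊟ # 2 ⊠ b₀ a        ≡⟨ eq ⟩
        0# ∎))
      root : # 2 ⊠ ⊟ h ⊟ # 2 ⊠ b₀ (⊟ h) ≡ 0#
      root = x≡ι0⇒x≡0 (begin
        # 2 ⊠ ⊟ h ⊟ # 2 ⊠ b₀ (⊟ h)
          ≡⟨ S.solve 1 (λ h → con (+ 2) :* (:- h) :- con (+ 2) :* (:- (:- h) :- con 1ℤ) :=
                                            con (+ 2) :* con 1ℤ :- con (+ 2) :* (con (+ 2) :* h)) refl h ⟩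
        # 2 ⊠ # 1 ⊟ # 2 ⊠ (# 2 ⊠ h)   ≡⟨ cong (λ t → # 2 ⊠ # 1 ⊟ # 2 ⊠ t) 1≡2h ⟨
        # 2 ⊠ # 1 ⊟ # 2 ⊠ # 1
          ≡⟨ S.solve 0 (con (+ 2) :* con 1ℤ :- con (+ 2) :* con 1ℤ := con 0ℤ) refl ⟩
        ι 0ℤ ∎)

    -- For fixed a and b the equation 4A = k a b c is linear in c, namely (k a b - 4) c = 4 (a + b +
    -- 1). From its solutions the one with A = 0, that is c = -(a + b + 1), is removed.
    one-fixed : U false false false true ≡ (P - + 2) * (P - + 2) + P * (1ℤ + χ e)
    one-fixed = begin
      U false false false true
        ≡⟨ ∑₂-cong (λ a b → trans (∑-cong λ c → sum-last a b c (λ _ → 1ℤ) (λ _ → 1ℤ) (λ _ → 1ℤ)) (sum-c a b)) ⟩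
      ∑₂ (λ a b → w (κ a b) + P * (δ (b ⊟ b₀ a) * δ (κ a b)) - (1ℤ - w a * (w b * w (b ⊞ (a ⊞ # 1)))))
        ≡⟨ ∑-cong sum-b ⟩
      ∑ (λ a → (P - w a) + P * m a - P + ∑ (λ b → w a * (w b * w (b ⊞ (a ⊞ # 1)))))
        ≡⟨ ∑-cong (λ a → Z.solve 4 (λ P w m t → (P Z.:- w) Z.:+ P Z.:* m Z.:- P Z.:+ t Z.:= P Z.:* m Z.:- w
           Z.:+ t) refl
             P (w a) (m a) (∑ (λ b → w a * (w b * w (b ⊞ (a ⊞ # 1)))))) ⟩
      ∑ (λ a → P * m a - w a + ∑ (λ b → w a * (w b * w (b ⊞ (a ⊞ # 1)))))
        ≡⟨ trans (∑-+ (λ a → P * m a - w a) (λ a → ∑ (λ b → w a * (w b * w (b ⊞ (a ⊞ # 1))))))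
             (cong₂ _+_ (trans (∑-- (λ a → P * m a) w) (cong₂ _-_ (trans (∑-*ˡ P m) (cong (P *_) ∑-m)) ∑-w))
                 ∑₂-www) ⟩
      P * (1ℤ + χ e) - (P - 1ℤ) + ((P - 1ℤ) * (P - + 2) + 1ℤ)
        ≡⟨ Z.solve 2 (λ P M → P Z.:* M Z.:- (P Z.:- Z.con 1ℤ) Z.:+
           ((P Z.:- Z.con 1ℤ) Z.:* (P Z.:- Z.con (+ 2)) Z.:+ Z.con 1ℤ)
             Z.:= (P Z.:- Z.con (+ 2)) Z.:* (P Z.:- Z.con (+ 2)) Z.:+ P Z.:* M) refl P (1ℤ + χ e) ⟩
      (P - + 2) * (P - + 2) + P * (1ℤ + χ e) ∎
      where
      κ : Fin p → Fin p → Fin p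
      κ a b = k ⊠ a ⊠ b ⊟ # 4
      linear : Fin p → Fin p → Fin p → Fin p
      linear a b c = κ a b ⊠ c ⊟ # 4 ⊠ (b ⊟ b₀ a)
      sum-c : ∀ a b → ∑ (λ c → R a b c * (1ℤ * (1ℤ * 1ℤ))) ≡
              w (κ a b) + P * (δ (b ⊟ b₀ a) * δ (κ a b)) - (1ℤ - w a * (w b * w (b ⊞ (a ⊞ # 1))))
      sum-c a b = begin
        ∑ (λ c → R a b c * (1ℤ * (1ℤ * 1ℤ)))
          ≡⟨ ∑-cong (λ c → trans (Z.solve 2
             (λ d f → (Z.con 1ℤ Z.:- d) Z.:* f Z.:* (Z.con 1ℤ Z.:* (Z.con 1ℤ Z.:* Z.con 1ℤ)) Z.:= f Z.:- d Z.:*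
                 f) refl
               (δ (A a b c)) (δ (# 4 ⊠ A a b c ⊟ k ⊠ a ⊠ b ⊠ c)))
               (cong (λ t → t - δ (A a b c) * t) (δ-scale (ι -1ℤ) -1≢0 (S.solve 4 (λ k a b c →
                 con (+ 4) :* (a :+ b :+ c :+ con 1ℤ) :- k :* a :* b :* c :=
                 con -1ℤ :* ((k :* a :* b :- con (+ 4)) :* c :- con (+ 4) :* (b :- (:- a :- con 1ℤ)))) refl k a
                     b c)))) ⟩
        ∑ (λ c → δ (linear a b c) - δ (A a b c) * δ (linear a b c))
          ≡⟨ ∑-- (λ c → δ (linear a b c)) (λ c → δ (A a b c) * δ (linear a b c)) ⟩
        ∑ (λ c → δ (linear a b c)) - ∑ (λ c → δ (A a b c) * δ (linear a b c))
          ≡⟨ cong₂ _-_ (trans (∑-δ-linear (κ a b) (# 4 ⊠ (b ⊟ b₀ a))) (cong (λ t → w (κ a b) + P * t)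
               (trans (cong (δ (κ a b) *_) (δ-scale (# 4) 4≢0 refl)) (ℤ.*-comm (δ (κ a b)) _))))
               (∑-select (⊟ (a ⊞ b ⊞ # 1)) (A a b)
                 (λ c eq → x⊟y≡0⇒x≡y (trans (S.solve 3
                     (λ a b c → c :- (:- (a :+ b :+ con 1ℤ)) := a :+ b :+ c :+ con 1ℤ) refl a b c) eq))
                 (x≡ι0⇒x≡0 (S.solve 2 (λ a b → a :+ b :+ (:- (a :+ b :+ con 1ℤ)) :+ con 1ℤ := con 0ℤ) refl a b))
                 (λ c → δ (linear a b c))) ⟩
        w (κ a b) + P * (δ (b ⊟ b₀ a) * δ (κ a b)) - δ (linear a b (⊟ (a ⊞ b ⊞ # 1)))
          -- At c = -(a + b + 1) the linear equation reads k a b (a + b + 1) = 0, whose complement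
          -- is the indicator summed in `∑₂-www`.
          ≡⟨ cong (λ t → w (κ a b) + P * (δ (b ⊟ b₀ a) * δ (κ a b)) - t)
             (trans (δ-scale (⊟ k) (⊟-≢0 k≢0) (S.solve 3 (λ k a b →
               (k :* a :* b :- con (+ 4)) :* (:- (a :+ b :+ con 1ℤ)) :- con (+ 4) :* (b :- (:- a :- con 1ℤ)) :=
               :- k :* (a :* (b :* (b :+ (a :+ con 1ℤ))))) refl k a b))
               (trans (δ-1-w (a ⊠ (b ⊠ (b ⊞ (a ⊞ # 1)))))
                   (cong (_-_ 1ℤ) (trans (w-* a (b ⊠ (b ⊞ (a ⊞ # 1))))
                       (cong (w a *_) (w-* b (b ⊞ (a ⊞ # 1)))))))) ⟩
        w (κ a b) + P * (δ (b ⊟ b₀ a) * δ (κ a b)) - (1ℤ - w a * (w b * w (b ⊞ (a ⊞ # 1)))) ∎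
      sum-b : ∀ a → ∑ (λ b → w (κ a b) + P * (δ (b ⊟ b₀ a) * δ (κ a b)) -
          (1ℤ - w a * (w b * w (b ⊞ (a ⊞ # 1))))) ≡
              (P - w a) + P * m a - P + ∑ (λ b → w a * (w b * w (b ⊞ (a ⊞ # 1))))
      sum-b a = begin
        ∑ (λ b → f b + g b - (1ℤ - h b))
          ≡⟨ trans (∑-- (λ b → f b + g b) (λ b → 1ℤ - h b)) (cong₂ _-_ (∑-+ f g) (∑-- (λ _ → 1ℤ) h)) ⟩
        ∑ f + ∑ g - (∑ (λ _ → 1ℤ) - ∑ h)
          ≡⟨ cong₂ (λ u v → u - (v - ∑ h)) (cong₂ _+_ ∑f (trans (∑-*ˡ P (λ b → δ (b ⊟ b₀ a) * δ (κ a b)))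
               (cong (P *_) (∑-δ⊟ (b₀ a) (λ b → δ (κ a b)))))) (sum-1 p) ⟩
        (P - w a) + P * m a - (P - ∑ h)
          ≡⟨ Z.solve 3 (λ x P h → x Z.:- (P Z.:- h) Z.:= x Z.:- P Z.:+ h) refl ((P - w a) + P * m a) P (∑ h) ⟩
        (P - w a) + P * m a - P + ∑ h ∎
        where
        f g h : Fin p → ℤ
        f b = w (κ a b)
        g b = P * (δ (b ⊟ b₀ a) * δ (κ a b))
        h b = w a * (w b * w (b ⊞ (a ⊞ # 1)))
        ∑f : ∑ f ≡ P - w a
        -- k a b = 4 has one solution b if a ≠ 0, and none if a = 0.
        ∑f = begin
          ∑ f                                          ≡⟨ ∑-- (λ _ → 1ℤ) (λ b → δ (κ a b)) ⟩
          ∑ (λ _ → 1ℤ) - ∑ (λ b → δ (κ a b))          ≡⟨ cong₂ _-_ (sum-1 p) (∑-δ-linear (k ⊠ a) (# 4)) ⟩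
          P - (w (k ⊠ a) + P * (δ (k ⊠ a) * δ (# 4))) ≡⟨ cong₂ (λ u v → P - (u + P * (δ (k ⊠ a) * v)))
                                                             (trans (w-* k a) (trans (cong (_* w a) (w-≢0 k≢0))
                                                                 (ℤ.*-identityˡ (w a)))) (δ-≢0 4≢0) ⟩
          P - (w a + P * (δ (k ⊠ a) * 0ℤ))
            ≡⟨ Z.solve 3 (λ P w d → P Z.:- (w Z.:+ P Z.:* (d Z.:* Z.con 0ℤ)) Z.:= P Z.:- w) refl P (w a)
               (δ (k ⊠ a)) ⟩
          P - w a ∎

-- The degree counts in terms of p, χ(e) and the case k = 16

module DegreeFormulas {p : ℕ} (F : OddField p) where

  open OddField F
  open FieldTheory F
  open QuadraticCharacter F
  open VertexCount F
  open DegreeCount F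
  open DegreeSums F
  open GenericSums F

  #moving : Fin p → ℕ → ℤ
  #moving k n = ∑₄ λ a b c d → δ (q k a b c d) * iverson (moves k a b c d ℕ.≟ n)

  module _ {k e : Fin p} (k≢0 : k ≢ 0#) (ke : k ⊠ e ≡ k ⊟ # 16) where

    open Degenerate k
    open Generic k k≢0 e ke
    open Symmetric k V atLeast-½

    private
      W : Fun₄
      W a b c d = V (s a b c d) (k ⊠ a ⊠ b ⊠ c ⊠ d)
      module D = Weighted (λ a b c d → δ (s a b c d))
      module G = Weighted W

    #moving-split : ∀ (j : Fin 4) → #moving k (toℕ j) ≡
      D.T (λ a b c d → degenerate (toℕ j) (on exactly-null (s a b c d) a b c d)) + generic (toℕ j) U
    #moving-split j = begin
      #moving k (toℕ j)   ≡⟨ ∑₄-cong (moves-split k k≢0 j) ⟩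
      ∑₄ ((λ a b c d → δ (s a b c d) * Dⱼ a b c d) +̇ (λ a b c d → W a b c d * Gⱼ a b c d))
                          ≡⟨ ∑₄-+ (λ a b c d → δ (s a b c d) * Dⱼ a b c d) (λ a b c d → W a b c d * Gⱼ a b c d)
                             ⟩
      D.T Dⱼ + G.T Gⱼ
        ≡⟨ cong (_+_ (D.T Dⱼ)) (G.T-generic (λ α β γ κ a b c d → on atLeast-½ (s a b c d) a b c d α β γ κ)
           (toℕ j)) ⟩
      D.T Dⱼ + generic (toℕ j) U ∎
      where
      Dⱼ Gⱼ : Fun₄
      Dⱼ a b c d = degenerate (toℕ j) (on exactly-null (s a b c d) a b c d)
      Gⱼ a b c d = generic (toℕ j) (on atLeast-½ (s a b c d) a b c d)

    #moving₀ : #moving k 0 ≡ + 6 * P - + 8 + δ (k ⊟ # 16)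
    #moving₀ = trans (#moving-split 0F) (cong₂ _+_ degenerate-sum₀ four-fixed)

    #moving₁ : #moving k 1 ≡ + 4 * ((P - 1ℤ) * (P - + 2) + 1ℤ) + (+ 4 * (1ℤ + χ e) - + 4 * δ (k ⊟ # 16))
    #moving₁ = trans (#moving-split 1F) (cong₂ _+_ degenerate-sum₁
      (cong₂ _-_ (trans e₃-U (cong (+ 4 *_) three-fixed)) (cong (+ 4 *_) four-fixed)))

    #moving₂ : #moving k 2 ≡ + 6 * ((P - 1ℤ) * (1ℤ + χ e)) - + 3 * (+ 4 * (1ℤ + χ e)) + + 6 * δ (k ⊟ # 16)
    #moving₂ = trans (#moving-split 2F) (trans (cong₂ _+_ T-0
      (cong₂ _+_ (cong₂ _-_ (trans e₂-U (cong (+ 6 *_) two-fixed))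
          (cong (+ 3 *_) (trans e₃-U (cong (+ 4 *_) three-fixed))))
        (cong (+ 6 *_) four-fixed))) (ℤ.+-identityˡ _))

    #moving₃ : #moving k 3 ≡ + 4 * ((P - + 2) * (P - + 2) + P * (1ℤ + χ e)) - + 2 *
        (+ 6 * ((P - 1ℤ) * (1ℤ + χ e)))
                             + + 3 * (+ 4 * (1ℤ + χ e)) - + 4 * δ (k ⊟ # 16)
    #moving₃ = trans (#moving-split 3F) (trans (cong₂ _+_ T-0
      (cong₂ _-_ (cong₂ _+_ (cong₂ _-_ (trans e₁-U (cong (+ 4 *_) one-fixed))
          (cong (+ 2 *_) (trans e₂-U (cong (+ 6 *_) two-fixed))))
        (cong (+ 3 *_) (trans e₃-U (cong (+ 4 *_) three-fixed)))) (cong (+ 4 *_) four-fixed)))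
            (ℤ.+-identityˡ _))

-- The residues modulo a prime as a field of odd order

-- The difference of the residues is a multiple of p of absolute value less than p.
residue-unique : ∀ {p r r′} q q′ → r ℕ.< p → r′ ℕ.< p → + r + q * + p ≡ + r′ + q′ * + p → r ≡ r′
residue-unique {p} {r} {r′} q q′ r<p r′<p eq = ℤ.+-injective (ℤ.i-j≡0⇒i≡j (+ r) (+ r′) (ℤ.∣i∣≡0⇒i≡0 ∣r-r′∣≡0))
  where
  difference : + r - + r′ ≡ (q′ - q) * + p
  difference = begin
    + r - + r′
      ≡⟨ Z.solve 4 (λ r r′ q p → r Z.:- r′ Z.:= r Z.:+ q Z.:* p Z.:- (r′ Z.:+ q Z.:* p)) refl (+ r) (+ r′) q
         (+ p) ⟩
    + r + q * + p - (+ r′ + q * + p)             ≡⟨ cong (_- (+ r′ + q * + p)) eq ⟩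
    + r′ + q′ * + p - (+ r′ + q * + p)
      ≡⟨ Z.solve 4 (λ r′ q q′ p → r′ Z.:+ q′ Z.:* p Z.:- (r′ Z.:+ q Z.:* p) Z.:= (q′ Z.:- q) Z.:* p) refl
         (+ r′) q q′ (+ p) ⟩
    (q′ - q) * + p ∎
  ∣r-r′∣<p : ∣ + r - + r′ ∣ ℕ.< p
  ∣r-r′∣<p = ℕ.≤-<-trans (subst (λ t → ∣ t ∣ ℕ.≤ r ℕ.⊔ r′) (sym (ℤ.m-n≡m⊖n r r′)) (ℤ.∣m⊝n∣≤m⊔n r r′))
      (ℕ.⊔-lub r<p r′<p)
  multiple : ∣ + r - + r′ ∣ ≡ ∣ q′ - q ∣ ℕ.* p
  multiple = trans (cong ∣_∣ difference) (ℤ.abs-* (q′ - q) (+ p))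
  ∣r-r′∣≡0 : ∣ + r - + r′ ∣ ≡ 0
  ∣r-r′∣≡0 with ∣ q′ - q ∣ in eq′
  ... | ℕ.zero  = trans multiple (cong (ℕ._* p) eq′)
  ... | ℕ.suc n = contradiction (subst (ℕ._< p) (trans multiple (cong (ℕ._* p) eq′)) ∣r-r′∣<p)
                    (ℕ.≤⇒≯ (ℕ.m≤m+n p (n ℕ.* p)))

module _ (p : ℕ) .{{_ : NonZero p}} where

  -- Congruence is carried by an explicit quotient, so that compatibility with the operations
  -- becomes a polynomial identity over the integers.
  toℤ-reduce : ∀ a → ∃[ q ] toℤ (reduce p a) ≡ a + q * + p
  toℤ-reduce a = - (a /ℕ p) , (begin
    + toℕ (reduce p a)                ≡⟨ cong +_ (toℕ-fromℕ< (n%ℕd<d a p)) ⟩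
    + (a %ℕ p)
      ≡⟨ Z.solve 3 (λ r q P → r Z.:= r Z.:+ q Z.:* P Z.:+ (Z.:- q) Z.:* P) refl (+ (a %ℕ p)) (a /ℕ p) (+ p) ⟩
    + (a %ℕ p) + a /ℕ p * + p + - (a /ℕ p) * + p ≡⟨ cong (_+ - (a /ℕ p) * + p) (a≡a%ℕn+[a/ℕn]*n a p) ⟨
    a + - (a /ℕ p) * + p ∎)

  reduce-≡ : ∀ {a} b q → a ≡ b + q * + p → reduce p a ≡ reduce p b
  reduce-≡ {a} b q eq = let q₁ , eq₁ = toℤ-reduce a ; q₂ , eq₂ = toℤ-reduce b in
    toℕ-injective (residue-unique (q₂ - q) q₁ (toℕ<n (reduce p a)) (toℕ<n (reduce p b)) (begin
      toℤ (reduce p a) + (q₂ - q) * + p  ≡⟨ cong (_+ (q₂ - q) * + p) (trans eq₁ (cong (_+ q₁ * + p) eq)) ⟩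
      b + q * + p + q₁ * + p + (q₂ - q) * + p
        ≡⟨ Z.solve 5 (λ b q q₁ q₂ P → b Z.:+ q Z.:* P Z.:+ q₁ Z.:* P Z.:+ (q₂ Z.:- q) Z.:* P
                                                   Z.:= b Z.:+ q₂ Z.:* P Z.:+ q₁ Z.:* P) refl b q q₁ q₂ (+ p) ⟩
      b + q₂ * + p + q₁ * + p            ≡⟨ cong (_+ q₁ * + p) eq₂ ⟨
      toℤ (reduce p b) + q₁ * + p ∎))

  reduce-toℤ : ∀ (a : 𝔽 p) → reduce p (toℤ a) ≡ a
  reduce-toℤ a = toℕ-injective (trans (toℕ-fromℕ< (n%ℕd<d (toℤ a) p)) (ℕ.m<n⇒m%n≡m (toℕ<n a)))

  negₚ : 𝔽 p → 𝔽 p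
  negₚ a = reduce p (- toℤ a)

  1ₚ : 𝔽 p
  1ₚ = reduce p 1ℤ

  reduce-+ : ∀ a b → reduce p (a + b) ≡ reduce p a +ₚ reduce p b
  reduce-+ a b = let q₁ , eq₁ = toℤ-reduce a ; q₂ , eq₂ = toℤ-reduce b in
    sym (reduce-≡ (a + b) (q₁ + q₂) (trans (cong₂ _+_ eq₁ eq₂)
      (Z.solve 5 (λ a b q₁ q₂ P → a Z.:+ q₁ Z.:* P Z.:+ (b Z.:+ q₂ Z.:* P) Z.:= a Z.:+ b Z.:+ (q₁ Z.:+ q₂) Z.:*
          P) refl a b q₁ q₂ (+ p))))

  reduce-* : ∀ a b → reduce p (a * b) ≡ reduce p a *ₚ reduce p b
  reduce-* a b = let q₁ , eq₁ = toℤ-reduce a ; q₂ , eq₂ = toℤ-reduce b in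
    sym (reduce-≡ (a * b) (q₁ * b + a * q₂ + q₁ * q₂ * + p) (trans (cong₂ _*_ eq₁ eq₂)
      (Z.solve 5 (λ a b q₁ q₂ P → (a Z.:+ q₁ Z.:* P) Z.:* (b Z.:+ q₂ Z.:* P) Z.:=
        a Z.:* b Z.:+ (q₁ Z.:* b Z.:+ a Z.:* q₂ Z.:+ q₁ Z.:* q₂ Z.:* P) Z.:* P) refl a b q₁ q₂ (+ p))))

  reduce-neg : ∀ a → reduce p (- a) ≡ negₚ (reduce p a)
  reduce-neg a = let q , eq = toℤ-reduce a in
    sym (reduce-≡ (- a) (- q) (trans (cong -_ eq)
        (Z.solve 3 (λ a q P → Z.:- (a Z.:+ q Z.:* P) Z.:= Z.:- a Z.:+ (Z.:- q) Z.:* P) refl a q (+ p))))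

  -- `_-ₚ_` reduces an integer difference, whereas `_⊟_` adds a negative; this is the bridge between
  -- them.
  -ₚ≡+neg : ∀ (a b : 𝔽 p) → a -ₚ b ≡ a +ₚ (negₚ b)
  -ₚ≡+neg a b = trans (reduce-+ (toℤ a) (- toℤ b)) (cong (_+ₚ (negₚ b)) (reduce-toℤ a))

  private
    -- Reduction is surjective, so the ring laws can be transported from the integers.
    via-reduce : ∀ {P : 𝔽 p → Set} → (∀ a → P (reduce p a)) → ∀ a → P a
    via-reduce {P} f a = subst P (reduce-toℤ a) (f (toℤ a))

  +ₚ-*ₚ-isCommutativeRing : IsCommutativeRing _≡_ _+ₚ_ _*ₚ_ negₚ 0ₚ 1ₚ
  +ₚ-*ₚ-isCommutativeRing = record
    { isRing = record
      { +-isAbelianGroup = record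
        { isGroup = record
          { isMonoid = record
            { isSemigroup = record
              { isMagma = isMagma _+ₚ_
              ; assoc = via-reduce λ a → via-reduce λ b → via-reduce λ c → begin
                  reduce p a +ₚ reduce p b +ₚ reduce p c   ≡⟨ cong (_+ₚ reduce p c) (reduce-+ a b) ⟨
                  reduce p (a + b) +ₚ reduce p c           ≡⟨ reduce-+ (a + b) c ⟨
                  reduce p (a + b + c)                     ≡⟨ cong (reduce p) (ℤ.+-assoc a b c) ⟩
                  reduce p (a + (b + c))                   ≡⟨ reduce-+ a (b + c) ⟩
                  reduce p a +ₚ reduce p (b + c)           ≡⟨ cong (reduce p a +ₚ_) (reduce-+ b c) ⟩
                  reduce p a +ₚ (reduce p b +ₚ reduce p c) ∎ }
            ; identity = +-idˡ , λ a → trans (+-comm a 0ₚ) (+-idˡ a) }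
          ; inverse = +-invˡ , λ a → trans (+-comm a (negₚ a)) (+-invˡ a)
          ; ⁻¹-cong = cong negₚ }
        ; comm = +-comm }
      ; *-cong = cong₂ _*ₚ_
      ; *-assoc = via-reduce λ a → via-reduce λ b → via-reduce λ c → begin
          reduce p a *ₚ reduce p b *ₚ reduce p c   ≡⟨ cong (_*ₚ reduce p c) (reduce-* a b) ⟨
          reduce p (a * b) *ₚ reduce p c           ≡⟨ reduce-* (a * b) c ⟨
          reduce p (a * b * c)                     ≡⟨ cong (reduce p) (ℤ.*-assoc a b c) ⟩
          reduce p (a * (b * c))                   ≡⟨ reduce-* a (b * c) ⟩
          reduce p a *ₚ reduce p (b * c)           ≡⟨ cong (reduce p a *ₚ_) (reduce-* b c) ⟩
          reduce p a *ₚ (reduce p b *ₚ reduce p c) ∎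
      ; *-identity = *-idˡ , λ a → trans (*-comm a 1ₚ) (*-idˡ a)
      ; distrib = distribˡ , λ a b c → trans (*-comm (b +ₚ c) a)
          (trans (distribˡ a b c) (cong₂ _+ₚ_ (*-comm a b) (*-comm a c))) }
    ; *-comm = *-comm }
    where
    +-comm : ∀ a b → a +ₚ b ≡ b +ₚ a
    +-comm a b = cong (reduce p) (ℤ.+-comm (toℤ a) (toℤ b))
    *-comm : ∀ a b → a *ₚ b ≡ b *ₚ a
    *-comm a b = cong (reduce p) (ℤ.*-comm (toℤ a) (toℤ b))
    +-idˡ : ∀ a → 0ₚ +ₚ a ≡ a
    +-idˡ = via-reduce λ a → trans (sym (reduce-+ 0ℤ a)) (cong (reduce p) (ℤ.+-identityˡ a))
    *-idˡ : ∀ a → 1ₚ *ₚ a ≡ a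
    *-idˡ = via-reduce λ a → trans (sym (reduce-* 1ℤ a)) (cong (reduce p) (ℤ.*-identityˡ a))
    +-invˡ : ∀ a → (negₚ a) +ₚ a ≡ 0ₚ
    +-invˡ = via-reduce λ a → begin
      (negₚ (reduce p a)) +ₚ reduce p a  ≡⟨ cong (_+ₚ reduce p a) (reduce-neg a) ⟨
      reduce p (- a) +ₚ reduce p a   ≡⟨ reduce-+ (- a) a ⟨
      reduce p (- a + a)             ≡⟨ cong (reduce p) (ℤ.+-inverseˡ a) ⟩
      0ₚ ∎
    distribˡ : ∀ a b c → a *ₚ (b +ₚ c) ≡ a *ₚ b +ₚ a *ₚ c
    distribˡ = via-reduce λ a → via-reduce λ b → via-reduce λ c → begin
      reduce p a *ₚ (reduce p b +ₚ reduce p c)  ≡⟨ cong (reduce p a *ₚ_) (reduce-+ b c) ⟨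
      reduce p a *ₚ reduce p (b + c)            ≡⟨ reduce-* a (b + c) ⟨
      reduce p (a * (b + c))                    ≡⟨ cong (reduce p) (ℤ.*-distribˡ-+ a b c) ⟩
      reduce p (a * b + a * c)                  ≡⟨ reduce-+ (a * b) (a * c) ⟩
      reduce p (a * b) +ₚ reduce p (a * c)      ≡⟨ cong₂ _+ₚ_ (reduce-* a b) (reduce-* a c) ⟩
      reduce p a *ₚ reduce p b +ₚ reduce p a *ₚ reduce p c ∎

  reduce-≢0 : ∀ n .{{_ : NonZero n}} → n ℕ.< p → reduce p (+ n) ≢ 0ₚ
  reduce-≢0 n n<p eq = ℕ.≢-nonZero⁻¹ n (begin
    n                       ≡⟨ ℕ.m<n⇒m%n≡m n<p ⟨
    n ℕ.% p                 ≡⟨ toℕ-fromℕ< (n%ℕd<d (+ n) p) ⟨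
    toℕ (reduce p (+ n))    ≡⟨ cong toℕ eq ⟩
    toℕ (reduce p 0ℤ)       ≡⟨ toℕ-fromℕ< (n%ℕd<d 0ℤ p) ⟩
    0 ℕ.% p                 ≡⟨ ℕ.m<n⇒m%n≡m (ℕ.≤-<-trans ℕ.z≤n n<p) ⟩
    0 ∎)

  -- A nonzero residue n is smaller than the prime p, hence coprime to it, and the Bézout
  -- coefficient of n is an inverse.
  invertible : Prime p → ∀ (a : 𝔽 p) → a ≢ 0ₚ → ∃[ b ] a *ₚ b ≡ 1ₚ
  invertible p-prime a a≢0 = by-residue (toℕ a) refl
    where
    by-residue : ∀ n → toℕ a ≡ n → ∃[ b ] a *ₚ b ≡ 1ₚ
    by-residue ℕ.zero eq = contradiction (trans (sym (reduce-toℤ a)) (cong (reduce p ∘ +_) eq)) a≢0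
    by-residue n@(ℕ.suc _) eq = by-Bézout (coprime-Bézout (prime⇒coprime p-prime (subst (ℕ._< p) eq (toℕ<n a))))
      where
      product : ∀ b q → + n * b ≡ 1ℤ + q * + p → a *ₚ reduce p b ≡ 1ₚ
      product b q eq′ = trans (cong (_*ₚ reduce p b) (trans (sym (reduce-toℤ a)) (cong (reduce p ∘ +_) eq)))
        (trans (sym (reduce-* (+ n) b)) (reduce-≡ 1ℤ q eq′))
      by-Bézout : Bézout.Identity 1 p n → ∃[ b ] a *ₚ b ≡ 1ₚ
      -- Here 1 + y n = x p, so the inverse is -y; in the other case it is y.
      by-Bézout (Bézout.+- x y 1+yn≡xp) = reduce p (- + y) , product (- + y) (- + x) (begin
        + n * - + y
          ≡⟨ Z.solve 2 (λ n y → n Z.:* (Z.:- y) Z.:= Z.con 1ℤ Z.:- (Z.con 1ℤ Z.:+ y Z.:* n)) refl (+ n) (+ y) ⟩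
        1ℤ - (1ℤ + + y * + n)           ≡⟨ cong (λ t → 1ℤ - (1ℤ + t)) (ℤ.pos-* y n) ⟨
        1ℤ - (+ (1 ℕ.+ y ℕ.* n))        ≡⟨ cong (λ t → 1ℤ - + t) 1+yn≡xp ⟩
        1ℤ - + (x ℕ.* p)                ≡⟨ cong (_-_ 1ℤ) (ℤ.pos-* x p) ⟩
        1ℤ - + x * + p                  ≡⟨ cong (_+_ 1ℤ) (ℤ.neg-distribˡ-* (+ x) (+ p)) ⟩
        1ℤ + - + x * + p ∎)
      by-Bézout (Bézout.-+ x y 1+xp≡yn) = reduce p (+ y) , product (+ y) (+ x) (begin
        + n * + y                       ≡⟨ ℤ.*-comm (+ n) (+ y) ⟩
        + y * + n                       ≡⟨ ℤ.pos-* y n ⟨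
        + (y ℕ.* n)                     ≡⟨ cong +_ 1+xp≡yn ⟨
        1ℤ + + (x ℕ.* p)                ≡⟨ cong (_+_ 1ℤ) (ℤ.pos-* x p) ⟩
        1ℤ + + x * + p ∎)

  module _ (p-prime : Prime p) (2<p : 2 ℕ.< p) where

    inverse : 𝔽 p → 𝔽 p
    inverse a with a ≟ 0ₚ
    ... | yes _   = 0ₚ
    ... | no a≢0 = proj₁ (invertible p-prime a a≢0)

    inverse-0 : inverse 0ₚ ≡ 0ₚ
    inverse-0 with 0ₚ {p} ≟ 0ₚ
    ... | yes _  = refl
    ... | no 0≢0 = contradiction refl 0≢0

    inverseʳ : ∀ {a} → a ≢ 0ₚ → a *ₚ inverse a ≡ 1ₚ
    inverseʳ {a} a≢0 with a ≟ 0ₚ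
    ... | yes a≡0 = contradiction a≡0 a≢0
    ... | no a≢0′ = proj₂ (invertible p-prime a a≢0′)

    𝔽-oddField : OddField p
    𝔽-oddField = record
      { _⊞_ = _+ₚ_ ; _⊠_ = _*ₚ_ ; ⊟_ = negₚ ; _⁻¹ = inverse ; 0# = 0ₚ ; 1# = 1ₚ
      ; isCommutativeRing = +ₚ-*ₚ-isCommutativeRing
      ; *-inverseʳ = inverseʳ
      ; 0⁻¹≡0 = inverse-0
      ; ι = reduce p ; ι-+ = reduce-+ ; ι-* = reduce-* ; ι-neg = reduce-neg ; ι-0 = refl ; ι-1 = refl
      ; 2≢0 = reduce-≢0 2 2<p }

-- From lengths of filtered lists to sums

length-≡ : ∀ {A : Set} {xs ys : List A} → Unique xs → Unique ys → (∀ {z} → z ∈ xs ⇔ z ∈ ys) → length xs ≡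
    length ys
length-≡ uxs uys eq = ↭-length (∼bag⇒↭ (unique∧set⇒bag uxs uys eq))

-- Injectivity is asked only where `Q` holds: flips that fix a vertex have the same image there, so
-- only those that move it yield distinct neighbours.
unique-map : ∀ {A B : Set} {Q : A → Set} {f : A → B} → (∀ {x y} → Q x → Q y → f x ≡ f y → x ≡ y) →
             ∀ {xs} → All Q xs → Unique xs → Unique (map f xs)
unique-map inj []         []        = []
unique-map inj (qx ∷ qxs) (x∉ ∷ u) =
  All.map⁺ (All.zipWith (λ (qy , x≢y) eq → x≢y (inj qx qy eq)) (qxs , x∉)) ∷ unique-map inj qxs u

listSum : ∀ {A : Set} → (A → ℤ) → List A → ℤ
listSum f []       = 0ℤ
listSum f (x ∷ xs) = f x + listSum f xs

listSum-cong : ∀ {A : Set} {f g : A → ℤ} → (∀ x → f x ≡ g x) → ∀ xs → listSum f xs ≡ listSum g xs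
listSum-cong eq []       = refl
listSum-cong eq (x ∷ xs) = cong₂ _+_ (eq x) (listSum-cong eq xs)

listSum-++ : ∀ {A : Set} (f : A → ℤ) xs ys → listSum f (xs ++ ys) ≡ listSum f xs + listSum f ys
listSum-++ f []       ys = sym (ℤ.+-identityˡ _)
listSum-++ f (x ∷ xs) ys = trans (cong (_+_ (f x)) (listSum-++ f xs ys)) (sym (ℤ.+-assoc (f x) _ _))

listSum-map : ∀ {A B : Set} (f : B → ℤ) (g : A → B) xs → listSum f (map g xs) ≡ listSum (f ∘ g) xs
listSum-map f g []       = refl
listSum-map f g (x ∷ xs) = cong (_+_ (f (g x))) (listSum-map f g xs)

listSum-filter : ∀ {A : Set} {Q : A → Set} (Q? : ∀ x → Dec (Q x)) f xs →
                 listSum f (filter Q? xs) ≡ listSum (λ x → iverson (Q? x) * f x) xs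
listSum-filter Q? f [] = refl
listSum-filter Q? f (x ∷ xs) with Q? x
... | yes _ = cong₂ _+_ (sym (ℤ.*-identityˡ (f x))) (listSum-filter Q? f xs)
... | no  _ = trans (listSum-filter Q? f xs) (sym (ℤ.+-identityˡ _))

length-listSum : ∀ {A : Set} (xs : List A) → + length xs ≡ listSum (λ _ → 1ℤ) xs
length-listSum []       = refl
length-listSum (x ∷ xs) = cong (_+_ 1ℤ) (length-listSum xs)

length-filter-¬ : ∀ {A : Set} {Q : A → Set} (Q? : ∀ x → Dec (Q x)) x xs →
                  length (filter (¬? ∘ Q?) (x ∷ xs)) ≡ (if does (Q? x) then 0 else 1) ℕ.+ length
                      (filter (¬? ∘ Q?) xs)
length-filter-¬ Q? x xs with Q? x
... | yes _ = refl
... | no  _ = refl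

module _ {p : ℕ} (F : OddField p) where

  open FieldTheory F using (∑; ∑-cong)
  open DegreeSums F using (∑₄)

  -- Stated for `tabulate g`, because the tail of `allFin (suc m)` is a tabulation of `suc` and the
  -- induction has to pass through it.
  listSum-product : ∀ {n m} (f : Vec (Fin p) (suc n) → ℤ) (g : Fin m → Fin p) xss →
    listSum f (cartesianProductWith _∷_ (tabulate g) xss) ≡ sum (λ i → listSum (λ xs → f (g i ∷ xs)) xss)
  listSum-product {m = zero}  f g xss = refl
  listSum-product {m = suc m} f g xss =
    trans (listSum-++ f (map (g zero ∷_) xss) _)
      (cong₂ _+_ (listSum-map f (g zero ∷_) xss) (listSum-product f (g ∘ suc) xss))

  listSum-points : ∀ (f : Vec (Fin p) 4 → ℤ) → listSum f (points p 4) ≡ ∑₄ (λ a b c d → f (a ∷ b ∷ c ∷ d ∷ []))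
  listSum-points f = trans (step f) (∑-cong λ a → trans (step (f ∘ (a ∷_))) (∑-cong λ b →
    trans (step (λ xs → f (a ∷ b ∷ xs))) (∑-cong λ c → trans (step (λ xs → f (a ∷ b ∷ c ∷ xs)))
      (∑-cong λ d → ℤ.+-identityʳ (f (a ∷ b ∷ c ∷ d ∷ []))))))
    where
    step : ∀ {n} (f : Vec (Fin p) (suc n) → ℤ) → listSum f (points p (suc n)) ≡ ∑
        (λ i → listSum (λ xs → f (i ∷ xs)) (points p n))
    step {n} f = listSum-product f (λ i → i) (points p n)

-- Vieta flips as involutions of the solution set

module Flips {p : ℕ} (F : OddField p) where

  open OddField F
  open FieldTheory F
  open VertexCount F
  open DegreeCount F
  open S using (_:+_; _:*_; _:-_; :-_; _:=_; con)

  Point : Set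
  Point = Vec (Fin p) 4

  module _ (k : Fin p) where

    Q : Point → Fin p
    Q (a ∷ b ∷ c ∷ d ∷ []) = q k a b c d

    D : Fin 4 → Point → Fin p
    D 0F (a ∷ b ∷ c ∷ d ∷ []) = partial (s a b c d) (k ⊠ (b ⊠ (c ⊠ d)))
    D 1F (a ∷ b ∷ c ∷ d ∷ []) = partial (s a b c d) (k ⊠ (a ⊠ (c ⊠ d)))
    D 2F (a ∷ b ∷ c ∷ d ∷ []) = partial (s a b c d) (k ⊠ (a ⊠ (b ⊠ d)))
    D 3F (a ∷ b ∷ c ∷ d ∷ []) = partial (s a b c d) (k ⊠ (a ⊠ (b ⊠ c)))

    flip : Fin 4 → Point → Point
    flip i x = x [ i ]≔ (lookup x i ⊟ D i x)

    -- The shape to which eval reduces on ∂ i (quartic c).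
    derivative : (a b c d a′ b′ c′ d′ : Fin p) → Fin p
    derivative a b c d a′ b′ c′ d′ = r′ ⊠ r ⊞ r ⊠ r′ ⊟
      ((((ι 0ℤ ⊠ a ⊞ k ⊠ a′) ⊠ b ⊞ k ⊠ a ⊠ b′) ⊠ c ⊞ k ⊠ a ⊠ b ⊠ c′) ⊠ d ⊞ k ⊠ a ⊠ b ⊠ c ⊠ d′)
      where
      r = s a b c d
      r′ = a′ ⊞ b′ ⊞ c′ ⊞ d′ ⊞ ι 0ℤ

    formal : ∀ {n} → (k a b c d a′ b′ c′ d′ : S.Polynomial n) → S.Polynomial n
    formal k a b c d a′ b′ c′ d′ = r′ :* r :+ r :* r′ :-
      ((((con 0ℤ :* a :+ k :* a′) :* b :+ k :* a :* b′) :* c :+ k :* a :* b :* c′) :* d :+ k :* a :* b :* c :*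
          d′)
      where
      r = a :+ b :+ c :+ d :+ con 1ℤ
      r′ = a′ :+ b′ :+ c′ :+ d′ :+ con 0ℤ

    derivative≡D : ∀ i a b c d → let η = λ j → ι (if does (i ≟ j) then 1ℤ else 0ℤ) in
                   derivative a b c d (η 0F) (η 1F) (η 2F) (η 3F) ≡ D i (a ∷ b ∷ c ∷ d ∷ [])
    derivative≡D 0F = S.solve 5 (λ k a b c d → formal k a b c d (con 1ℤ) (con 0ℤ) (con 0ℤ) (con 0ℤ) :=
      con (+ 2) :* (a :+ b :+ c :+ d :+ con 1ℤ) :- k :* (b :* (c :* d))) refl k
    derivative≡D 1F = S.solve 5 (λ k a b c d → formal k a b c d (con 0ℤ) (con 1ℤ) (con 0ℤ) (con 0ℤ) :=
      con (+ 2) :* (a :+ b :+ c :+ d :+ con 1ℤ) :- k :* (a :* (c :* d))) refl k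
    derivative≡D 2F = S.solve 5 (λ k a b c d → formal k a b c d (con 0ℤ) (con 0ℤ) (con 1ℤ) (con 0ℤ) :=
      con (+ 2) :* (a :+ b :+ c :+ d :+ con 1ℤ) :- k :* (a :* (b :* d))) refl k
    derivative≡D 3F = S.solve 5 (λ k a b c d → formal k a b c d (con 0ℤ) (con 0ℤ) (con 0ℤ) (con 1ℤ) :=
      con (+ 2) :* (a :+ b :+ c :+ d :+ con 1ℤ) :- k :* (a :* (b :* c))) refl k

    private
      -- The roots of (x + y)² - x π sum to π - 2y, so the flip is the reflection x ↦ π - 2y - x.
      restore : ∀ x π y → let r = x ⊞ y ; x′ = x ⊟ partial r π in x′ ⊟ partial (x′ ⊞ y) π ≡ x
      restore x π y = S.solve 3 (λ x π y → let x′ = x :- (con (+ 2) :* (x :+ y) :- π) in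
        x′ :- (con (+ 2) :* (x′ :+ y) :- π) := x) refl x π y

      -- A monic quadratic is invariant under the reflection that exchanges its roots, at every x;
      -- hence this is an identity and needs no equation for x.
      preserve : ∀ x π y → let x′ = x ⊟ partial (x ⊞ y) π in (x′ ⊞ y) ⊠ (x′ ⊞ y) ⊟ x′ ⊠ π ≡ (x ⊞ y) ⊠ (x ⊞ y) ⊟
          x ⊠ π
      preserve x π y = S.solve 3 (λ x π y → let x′ = x :- (con (+ 2) :* (x :+ y) :- π) in
        (x′ :+ y) :* (x′ :+ y) :- x′ :* π := (x :+ y) :* (x :+ y) :- x :* π) refl x π y

      -- Reduces the four coordinates to one computation: here `σ` is s as a function of the flipped
      -- coordinate alone.
      flip-coordinate : ∀ {x y π} (σ : Fin p → Fin p) → (∀ x → σ x ≡ x ⊞ y) →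
        let x′ = x ⊟ partial (σ x) π in x′ ⊟ partial (σ x′) π ≡ x
      flip-coordinate {x} {y} {π} σ σ≡ = begin
        x ⊟ partial (σ x) π ⊟ partial (σ (x ⊟ partial (σ x) π)) π
          ≡⟨ cong (λ t → x ⊟ partial t π ⊟ partial (σ (x ⊟ partial t π)) π) (σ≡ x) ⟩
        x ⊟ partial (x ⊞ y) π ⊟ partial (σ (x ⊟ partial (x ⊞ y) π)) π
          ≡⟨ cong (λ t → x ⊟ partial (x ⊞ y) π ⊟ partial t π) (σ≡ _) ⟩
        x ⊟ partial (x ⊞ y) π ⊟ partial (x ⊟ partial (x ⊞ y) π ⊞ y) π ≡⟨ restore x π y ⟩
        x ∎

      q-coordinate : ∀ {x y π} (σ τ : Fin p → Fin p) → (∀ x → σ x ≡ x ⊞ y) → (∀ x → τ x ≡ x ⊠ π) →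
        let x′ = x ⊟ partial (σ x) π in σ x′ ⊠ σ x′ ⊟ τ x′ ≡ σ x ⊠ σ x ⊟ τ x
      q-coordinate {x} {y} {π} σ τ σ≡ τ≡ = begin
        σ x′ ⊠ σ x′ ⊟ τ x′                 ≡⟨ cong₂ (λ u v → u ⊠ u ⊟ v) (σ≡ x′) (τ≡ x′) ⟩
        (x′ ⊞ y) ⊠ (x′ ⊞ y) ⊟ x′ ⊠ π
          ≡⟨ cong (λ t → let x″ = x ⊟ partial t π in (x″ ⊞ y) ⊠ (x″ ⊞ y) ⊟ x″ ⊠ π) (σ≡ x) ⟩
        (x‴ ⊞ y) ⊠ (x‴ ⊞ y) ⊟ x‴ ⊠ π      ≡⟨ preserve x π y ⟩
        (x ⊞ y) ⊠ (x ⊞ y) ⊟ x ⊠ π          ≡⟨ cong₂ (λ u v → u ⊠ u ⊟ v) (σ≡ x) (τ≡ x) ⟨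
        σ x ⊠ σ x ⊟ τ x ∎
        where
        x′ = x ⊟ partial (σ x) π
        x‴ = x ⊟ partial (x ⊞ y) π

      s₁ : ∀ b c d a → s a b c d ≡ a ⊞ (b ⊞ c ⊞ d ⊞ # 1)
      s₁ = S.solve 4 (λ b c d a → a :+ b :+ c :+ d :+ con 1ℤ := a :+ (b :+ c :+ d :+ con 1ℤ)) refl
      s₂ : ∀ a c d b → s a b c d ≡ b ⊞ (a ⊞ c ⊞ d ⊞ # 1)
      s₂ = S.solve 4 (λ a c d b → a :+ b :+ c :+ d :+ con 1ℤ := b :+ (a :+ c :+ d :+ con 1ℤ)) refl
      s₃ : ∀ a b d c → s a b c d ≡ c ⊞ (a ⊞ b ⊞ d ⊞ # 1)
      s₃ = S.solve 4 (λ a b d c → a :+ b :+ c :+ d :+ con 1ℤ := c :+ (a :+ b :+ d :+ con 1ℤ)) refl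
      s₄ : ∀ a b c d → s a b c d ≡ d ⊞ (a ⊞ b ⊞ c ⊞ # 1)
      s₄ = S.solve 4 (λ a b c d → a :+ b :+ c :+ d :+ con 1ℤ := d :+ (a :+ b :+ c :+ con 1ℤ)) refl
      π₁ : ∀ b c d a → k ⊠ a ⊠ b ⊠ c ⊠ d ≡ a ⊠ (k ⊠ (b ⊠ (c ⊠ d)))
      π₁ = S.solve 5 (λ k b c d a → k :* a :* b :* c :* d := a :* (k :* (b :* (c :* d)))) refl k
      π₂ : ∀ a c d b → k ⊠ a ⊠ b ⊠ c ⊠ d ≡ b ⊠ (k ⊠ (a ⊠ (c ⊠ d)))
      π₂ = S.solve 5 (λ k a c d b → k :* a :* b :* c :* d := b :* (k :* (a :* (c :* d)))) refl k
      π₃ : ∀ a b d c → k ⊠ a ⊠ b ⊠ c ⊠ d ≡ c ⊠ (k ⊠ (a ⊠ (b ⊠ d)))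
      π₃ = S.solve 5 (λ k a b d c → k :* a :* b :* c :* d := c :* (k :* (a :* (b :* d)))) refl k
      π₄ : ∀ a b c d → k ⊠ a ⊠ b ⊠ c ⊠ d ≡ d ⊠ (k ⊠ (a ⊠ (b ⊠ c)))
      π₄ = S.solve 5 (λ k a b c d → k :* a :* b :* c :* d := d :* (k :* (a :* (b :* c)))) refl k

    flip-involutive : ∀ i x → flip i (flip i x) ≡ x
    flip-involutive 0F (a ∷ b ∷ c ∷ d ∷ []) = cong (λ t → t ∷ b ∷ c ∷ d ∷ [])
        (flip-coordinate (λ a → s a b c d) (s₁ b c d))
    flip-involutive 1F (a ∷ b ∷ c ∷ d ∷ []) = cong (λ t → a ∷ t ∷ c ∷ d ∷ [])
        (flip-coordinate (λ b → s a b c d) (s₂ a c d))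
    flip-involutive 2F (a ∷ b ∷ c ∷ d ∷ []) = cong (λ t → a ∷ b ∷ t ∷ d ∷ [])
        (flip-coordinate (λ c → s a b c d) (s₃ a b d))
    flip-involutive 3F (a ∷ b ∷ c ∷ d ∷ []) = cong (λ t → a ∷ b ∷ c ∷ t ∷ [])
        (flip-coordinate (s a b c) (s₄ a b c))

    Q-flip : ∀ i x → Q (flip i x) ≡ Q x
    Q-flip 0F (a ∷ b ∷ c ∷ d ∷ []) = q-coordinate (λ a → s a b c d) (λ a → k ⊠ a ⊠ b ⊠ c ⊠ d) (s₁ b c d)
        (π₁ b c d)
    Q-flip 1F (a ∷ b ∷ c ∷ d ∷ []) = q-coordinate (λ b → s a b c d) (λ b → k ⊠ a ⊠ b ⊠ c ⊠ d) (s₂ a c d)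
        (π₂ a c d)
    Q-flip 2F (a ∷ b ∷ c ∷ d ∷ []) = q-coordinate (λ c → s a b c d) (λ c → k ⊠ a ⊠ b ⊠ c ⊠ d) (s₃ a b d)
        (π₃ a b d)
    Q-flip 3F (a ∷ b ∷ c ∷ d ∷ []) = q-coordinate (s a b c) (λ d → k ⊠ a ⊠ b ⊠ c ⊠ d) (s₄ a b c) (π₄ a b c)

    private
      fixed : ∀ {x y} → x ⊟ y ≡ x → y ≡ 0#
      fixed {x} {y} eq = trans (S.solve 2 (λ x y → y := x :- (x :- y)) refl x y) (x≡y⇒x⊟y≡0 (sym eq))

    flip-≢ : ∀ {i x} → D i x ≢ 0# → x ≢ flip i x
    flip-≢ {i} {x} D≢0 eq = D≢0 (fixed (trans (sym (lookup∘update i x _)) (cong (λ y → lookup y i) (sym eq))))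

    D-≢0 : ∀ {i x} → x ≢ flip i x → D i x ≢ 0#
    D-≢0 {i} {x} x≢ D≡0 = x≢ (sym (trans
        (cong (x [ i ]≔_) (trans (cong (λ t → lookup x i ⊟ t) (trans D≡0 (sym ι-0)))
      (S.solve 1 (λ x → x :- con 0ℤ := x) refl (lookup x i)))) ([]≔-lookup x i)))

    -- The i-th flip changes the i-th coordinate, while a flip of another coordinate leaves it
    -- alone.
    flip-injective : ∀ {i j x} → D i x ≢ 0# → D j x ≢ 0# → flip i x ≡ flip j x → i ≡ j
    flip-injective {i} {j} {x} Di≢0 _ eq with i ≟ j
    ... | yes i≡j = i≡j
    ... | no  i≢j = contradiction (fixed (begin
      lookup x i ⊟ D i x    ≡⟨ lookup∘update i x _ ⟨
      lookup (flip i x) i   ≡⟨ cong (λ y → lookup y i) eq ⟩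
      lookup (flip j x) i   ≡⟨ lookup∘update′ i≢j x _ ⟩
      lookup x i ∎)) Di≢0

-- The Vieta graph: neighbours, degrees and cardinalities

module Graph (p : ℕ) .{{_ : NonZero p}} (p-prime : Prime p) (2<p : 2 ℕ.< p) (c : ℤ) where

  private
    F : OddField p
    F = 𝔽-oddField p p-prime 2<p

  open FieldTheory F using (δ; ∑)
  open VertexCount F using (q; s; #solutions)
  open DegreeCount F using (moves; null)
  open DegreeSums F using (∑₄; ∑₄-cong)
  open DegreeFormulas F using (#moving)
  open Flips F
  open VietaGraph p c using (vertices; vietaFlip; Adjacent; adjacent?; degree)

  k : 𝔽 p
  k = reduce p c

  isVertex? : ∀ (x : Point) → Dec (eval (quartic c) x ≡ 0ₚ)
  isVertex? x = eval (quartic c) x ≟ 0ₚ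

  -- Replaces the outermost subtraction only. That suffices, as `quartic c` and its derivatives
  -- subtract once, at the top.
  eval⁻ : ∀ {n} → Poly n → Vec (𝔽 p) n → 𝔽 p
  eval⁻ (f ⊖ g) x = eval f x +ₚ negₚ p (eval g x)
  eval⁻ f       x = eval f x

  eval≡eval⁻ : ∀ {n} (f : Poly n) x → eval f x ≡ eval⁻ f x
  eval≡eval⁻ (con _) x = refl
  eval≡eval⁻ (var _) x = refl
  eval≡eval⁻ (_ ⊕ _) x = refl
  eval≡eval⁻ (_ ⊗ _) x = refl
  eval≡eval⁻ (f ⊖ g) x = -ₚ≡+neg p (eval f x) (eval g x)

  eval-quartic : ∀ x → eval (quartic c) x ≡ Q k x
  eval-quartic (x ∷ y ∷ z ∷ t ∷ []) = eval≡eval⁻ (quartic c) (x ∷ y ∷ z ∷ t ∷ [])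

  eval-∂ : ∀ i x → eval (∂ i (quartic c)) x ≡ D k i x
  eval-∂ i (x ∷ y ∷ z ∷ t ∷ []) = trans (eval≡eval⁻ (∂ i (quartic c)) (x ∷ y ∷ z ∷ t ∷ []))
      (derivative≡D k i x y z t)

  vietaFlip≡flip : ∀ i x → vietaFlip i x ≡ flip k i x
  vietaFlip≡flip i x = cong (x [ i ]≔_)
      (trans (cong (λ y → lookup x i -ₚ y) (eval-∂ i x)) (-ₚ≡+neg p (lookup x i) (D k i x)))

  -- Flips are involutions, so both orientations of an edge present y as a flip of x, and x ≠ y
  -- makes the derivative nonzero.
  adjacent⇒flip : ∀ {x y} → Adjacent x y → ∃[ i ] D k i x ≢ 0ₚ × y ≡ flip k i x
  adjacent⇒flip {x} {y} (x≢y , inj₁ (i , y≡)) = i , D-≢0 k (λ eq → x≢y (trans eq (sym y≡flip))) , y≡flip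
    where
    y≡flip : y ≡ flip k i x
    y≡flip = trans y≡ (vietaFlip≡flip i x)
  adjacent⇒flip {x} {y} (x≢y , inj₂ (i , x≡)) = i , D-≢0 k (λ eq → x≢y (trans eq (sym y≡flip))) , y≡flip
    where
    y≡flip : y ≡ flip k i x
    y≡flip = trans (sym (flip-involutive k i y)) (cong (flip k i) (sym (trans x≡ (vietaFlip≡flip i y))))

  flip⇒adjacent : ∀ i {x} → D k i x ≢ 0ₚ → Adjacent x (flip k i x)
  flip⇒adjacent i {x} D≢0 = flip-≢ k D≢0 , inj₁ (i , sym (vietaFlip≡flip i x))

  moving : Point → List (Fin 4)
  moving x = filter (λ i → ¬? (D k i x ≟ 0ₚ)) (allFin 4)

  -- Coordinates that move x give distinct neighbours by `flip-injective`, and every neighbour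
  -- arises so. That x is a vertex ensures, through `Q-flip`, that its flips are vertices too.
  degree≡length : ∀ {x} → eval (quartic c) x ≡ 0ₚ → degree x ≡ length (moving x)
  degree≡length {x} x∈V = trans (length-≡
      (Unique.filter⁺ (adjacent? x) (Unique.filter⁺ isVertex? (points-unique p 4)))
      (unique-map (flip-injective k) (All.all-filter (λ i → ¬? (D k i x ≟ 0ₚ)) (allFin 4))
        (Unique.filter⁺ (λ i → ¬? (D k i x ≟ 0ₚ)) (Unique.allFin⁺ 4)))
      (mk⇔ to from))
    (length-map (λ i → flip k i x) (moving x))
    where
    from-flip : ∀ {y} → ∃[ i ] D k i x ≢ 0ₚ × y ≡ flip k i x → y ∈ map (λ i → flip k i x) (moving x)
    from-flip (i , D≢0 , refl) = ∈-map⁺ (λ i → flip k i x)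
        (∈-filter⁺ (λ i → ¬? (D k i x ≟ 0ₚ)) (∈-allFin i) D≢0)
    to : ∀ {y} → y ∈ filter (adjacent? x) vertices → y ∈ map (λ i → flip k i x) (moving x)
    to y∈ = from-flip (adjacent⇒flip (proj₂ (∈-filter⁻ (adjacent? x) {xs = vertices} y∈)))
    flip∈ : ∀ i → D k i x ≢ 0ₚ → flip k i x ∈ filter (adjacent? x) vertices
    flip∈ i D≢0 = ∈-filter⁺ (adjacent? x) (∈-filter⁺ isVertex? (points-complete (flip k i x))
        (trans (eval-quartic (flip k i x)) (trans (Q-flip k i x) (trans (sym (eval-quartic x)) x∈V))))
      (flip⇒adjacent i D≢0)
    from-moving : ∀ {y} → ∃[ i ] i ∈ moving x × y ≡ flip k i x → y ∈ filter (adjacent? x) vertices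
    from-moving (i , i∈ , refl) = flip∈ i (proj₂ (∈-filter⁻ (λ i → ¬? (D k i x ≟ 0ₚ)) {xs = allFin 4} i∈))
    from : ∀ {y} → y ∈ map (λ i → flip k i x) (moving x) → y ∈ filter (adjacent? x) vertices
    from y∈ = from-moving (∈-map⁻ (λ i → flip k i x) y∈)

  length-moving : ∀ x → length (moving x) ≡
                  count-false (null (D k 0F x)) (null (D k 1F x)) (null (D k 2F x)) (null (D k 3F x))
  length-moving x =
    trans (step 0F (1F ∷ 2F ∷ 3F ∷ [])) (cong (ℕ._+_ _)
    (trans (step 1F (2F ∷ 3F ∷ [])) (cong (ℕ._+_ _)
    (trans (step 2F (3F ∷ [])) (cong (ℕ._+_ _) (trans (step 3F []) (ℕ.+-identityʳ _)))))))
    where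
    step = length-filter-¬ (λ i → D k i x ≟ 0ₚ)

  #vertices≡ : + #vertices p c ≡ #solutions k
  #vertices≡ = begin
    + length vertices                                  ≡⟨ length-listSum vertices ⟩
    listSum (λ _ → 1ℤ) vertices                        ≡⟨ listSum-filter isVertex? (λ _ → 1ℤ) (points p 4) ⟩
    listSum (λ x → iverson (isVertex? x) * 1ℤ) (points p 4)
      ≡⟨ listSum-cong (λ x → trans (ℤ.*-identityʳ _) (cong δ (eval-quartic x))) (points p 4) ⟩
    listSum (λ x → δ (Q k x)) (points p 4)             ≡⟨ listSum-points F (λ x → δ (Q k x)) ⟩
    #solutions k ∎

  #degree≡ : ∀ n → + #degree p c n ≡ #moving k n
  #degree≡ n = begin
    + length (filter degree≟ vertices)                 ≡⟨ length-listSum (filter degree≟ vertices) ⟩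
    listSum (λ _ → 1ℤ) (filter degree≟ vertices)       ≡⟨ listSum-filter degree≟ (λ _ → 1ℤ) vertices ⟩
    listSum (λ x → iverson (degree≟ x) * 1ℤ) vertices
      ≡⟨ listSum-filter isVertex? (λ x → iverson (degree≟ x) * 1ℤ) (points p 4) ⟩
    listSum (λ x → iverson (isVertex? x) * (iverson (degree≟ x) * 1ℤ)) (points p 4)
      ≡⟨ listSum-points F (λ x → iverson (isVertex? x) * (iverson (degree≟ x) * 1ℤ)) ⟩
    ∑₄ (λ x y z t → let v = x ∷ y ∷ z ∷ t ∷ [] in iverson (isVertex? v) * (iverson (degree≟ v) * 1ℤ))
      ≡⟨ ∑₄-cong pointwise ⟩
    #moving k n ∎
    where
    degree≟ : ∀ x → Dec (degree x ≡ n)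
    degree≟ x = degree x ℕ.≟ n
    -- `degree≡length` speaks of vertices only; at other points the first indicator annihilates both
    -- sides.
    guard : ∀ {A : Set} (d : Dec A) {g h : ℤ} → (A → g ≡ h) → iverson d * g ≡ iverson d * h
    guard (yes a) eq = cong (1ℤ *_) (eq a)
    guard (no _)  _  = refl
    pointwise : ∀ x y z t → let v = x ∷ y ∷ z ∷ t ∷ [] in
      iverson (isVertex? v) * (iverson (degree≟ v) * 1ℤ) ≡ δ (q k x y z t) * iverson (moves k x y z t ℕ.≟ n)
    pointwise x y z t = trans
      (guard (isVertex? v) λ v∈V → trans (ℤ.*-identityʳ _)
        (cong (λ m → iverson (m ℕ.≟ n)) (trans (degree≡length v∈V) (length-moving v))))
      (cong (λ u → δ u * iverson (moves k x y z t ℕ.≟ n)) (eval-quartic v))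
      where
      v : Point
      v = x ∷ y ∷ z ∷ t ∷ []

-- Specialisation to the four values of c

module Parameters {p : ℕ} (F : OddField p) where

  open OddField F
  open FieldTheory F
  open QuadraticCharacter F
  open VertexCount F
  open DegreeFormulas F
  open S using (_:+_; _:*_; _:-_; :-_; _:=_; con)

  record Counts (k : Fin p) (N d₃ d₂ d₁ d₀ : ℤ) : Set where
    field
      solutions : #solutions k ≡ N
      moving₃   : #moving k 3 ≡ d₃
      moving₂   : #moving k 2 ≡ d₂
      moving₁   : #moving k 1 ≡ d₁
      moving₀   : #moving k 0 ≡ d₀

  -- The degree 3 count comes out as 4 (P - 3 - σ)² + 4 (1 - σ²), so σ² = 1 leaves a perfect square.
  -- As k ≠ 16, no solution has all four coordinates equal to s/2.
  counts-regular : ∀ {k e σ L} → k ≢ 0# → k ⊠ e ≡ k ⊟ # 16 → k ⊟ # 16 ≢ 0# → χ e ≡ σ → σ * σ ≡ 1ℤ → legendre e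
      ≡ L →
    Counts k (P ^ 3 - + 1 + L * P) (+ 4 * (P - + 3 - σ) ^ 2) (+ 6 * (+ 1 + σ) * (P - + 3))
             (+ 4 * (P ^ 2 - + 3 * P + + 4 + σ)) (+ 6 * P - + 8)
  counts-regular {k} {e} {σ} k≢0 ke k≢16 refl σ²≡1 refl = record
    { solutions = #solutions≡ k≢0 ke
    ; moving₃   = begin
        #moving k 3 ≡⟨ #moving₃ k≢0 ke ⟩
        f₃ (δ (k ⊟ # 16)) ≡⟨ cong f₃ (δ-≢0 k≢16) ⟩
        f₃ 0ℤ ≡⟨ Z.solve 2 (λ P s → let M = Z.con 1ℤ Z.:+ s ; P-2 = P Z.:- Z.con (+ 2) in
                   Z.con (+ 4) Z.:* (P-2 Z.:* P-2 Z.:+ P Z.:* M) Z.:- Z.con (+ 2) Z.:*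
                       (Z.con (+ 6) Z.:* ((P Z.:- Z.con 1ℤ) Z.:* M))
                     Z.:+ Z.con (+ 3) Z.:* (Z.con (+ 4) Z.:* M) Z.:- Z.con (+ 4) Z.:* Z.con 0ℤ
                   Z.:= Z.con (+ 4) Z.:* (P Z.:- Z.con (+ 3) Z.:- s) Z.:^ 2 Z.:+ Z.con (+ 4) Z.:*
                       (Z.con 1ℤ Z.:- s Z.:* s)) refl P σ ⟩
        + 4 * (P - + 3 - σ) ^ 2 + + 4 * (1ℤ - σ * σ)
          ≡⟨ cong (λ t → + 4 * (P - + 3 - σ) ^ 2 + + 4 * (1ℤ - t)) σ²≡1 ⟩
        + 4 * (P - + 3 - σ) ^ 2 + 0ℤ ≡⟨ ℤ.+-identityʳ _ ⟩
        + 4 * (P - + 3 - σ) ^ 2 ∎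
    ; moving₂   = trans (#moving₂ k≢0 ke)
        (trans (cong f₂ (δ-≢0 k≢16)) (Z.solve 2 (λ P s → let M = Z.con 1ℤ Z.:+ s in
        Z.con (+ 6) Z.:* ((P Z.:- Z.con 1ℤ) Z.:* M) Z.:- Z.con (+ 3) Z.:* (Z.con (+ 4) Z.:* M) Z.:+ Z.con (+ 6)
            Z.:* Z.con 0ℤ
        Z.:= Z.con (+ 6) Z.:* M Z.:* (P Z.:- Z.con (+ 3))) refl P σ))
    ; moving₁   = trans (#moving₁ k≢0 ke)
        (trans (cong f₁ (δ-≢0 k≢16)) (Z.solve 2 (λ P s → let M = Z.con 1ℤ Z.:+ s in
        Z.con (+ 4) Z.:* ((P Z.:- Z.con 1ℤ) Z.:* (P Z.:- Z.con (+ 2)) Z.:+ Z.con 1ℤ) Z.:+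
            (Z.con (+ 4) Z.:* M Z.:- Z.con (+ 4) Z.:* Z.con 0ℤ)
        Z.:= Z.con (+ 4) Z.:* (P Z.:^ 2 Z.:- Z.con (+ 3) Z.:* P Z.:+ Z.con (+ 4) Z.:+ s)) refl P σ))
    ; moving₀   = trans (#moving₀ k≢0 ke) (trans (cong (_+_ (+ 6 * P - + 8)) (δ-≢0 k≢16)) (ℤ.+-identityʳ _))
    }
    where
    M : ℤ
    M = 1ℤ + σ
    f₁ f₂ f₃ : ℤ → ℤ
    f₁ t = + 4 * ((P - 1ℤ) * (P - + 2) + 1ℤ) + (+ 4 * M - + 4 * t)
    f₂ t = + 6 * ((P - 1ℤ) * M) - + 3 * (+ 4 * M) + + 6 * t
    f₃ t = + 4 * ((P - + 2) * (P - + 2) + P * M) - + 2 * (+ 6 * ((P - 1ℤ) * M)) + + 3 * (+ 4 * M) - + 4 * t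

  counts-8 : Counts (# 8) (P ^ 3 - + 1 + χ (# 2) * φ * P) (+ 4 * (P - + 3 - χ (ι -1ℤ)) ^ 2)
    (+ 6 * (+ 1 + χ (ι -1ℤ)) * (P - + 3)) (+ 4 * (P ^ 2 - + 3 * P + + 4 + χ (ι -1ℤ))) (+ 6 * P - + 8)
  counts-8 = counts-regular 8≢0 (S.solve 0 (con (+ 8) :* con -1ℤ := con (+ 8) :- con (+ 16)) refl)
    (subst (_≢ 0#) (S.solve 0 (:- con (+ 8) := con (+ 8) :- con (+ 16)) refl) (⊟-≢0 8≢0))
    refl (χ²≡1 -1≢0) legendre[-1]

  counts-[-16] : Counts (ι (- + 16)) (P ^ 3 - + 1 + χ (# 2) * φ * P) (+ 4 * (P - + 3 - χ (# 2)) ^ 2)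
    (+ 6 * (+ 1 + χ (# 2)) * (P - + 3)) (+ 4 * (P ^ 2 - + 3 * P + + 4 + χ (# 2))) (+ 6 * P - + 8)
  counts-[-16] = counts-regular (subst (_≢ 0#) (sym (ι-neg (+ 16))) (⊟-≢0 16≢0))
    (S.solve 0 (con (- + 16) :* con (+ 2) := con (- + 16) :- con (+ 16)) refl)
    (subst (_≢ 0#) (S.solve 0 (:- con (+ 32) := con (- + 16) :- con (+ 16)) refl) (⊟-≢0 32≢0))
    refl (χ²≡1 2≢0) legendre[2]

  counts-32 : Counts (# 32) (P ^ 3 - + 1 + φ * P) (+ 4 * (P - + 3 - χ (# 2)) ^ 2)
    (+ 6 * (+ 1 + χ (# 2)) * (P - + 3)) (+ 4 * (P ^ 2 - + 3 * P + + 4 + χ (# 2))) (+ 6 * P - + 8)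
  counts-32 = counts-regular 32≢0 (begin
      # 32 ⊠ # 2 ⁻¹
        ≡⟨ S.solve 1 (λ h → con (+ 32) :* h := con (+ 16) :* (con (+ 2) :* h)) refl (# 2 ⁻¹) ⟩
      # 16 ⊠ (# 2 ⊠ # 2 ⁻¹)    ≡⟨ cong (# 16 ⊠_) (trans (*-inverseʳ 2≢0) (sym ι-1)) ⟩
      # 16 ⊠ ι 1ℤ              ≡⟨ S.solve 0 (con (+ 16) :* con 1ℤ := con (+ 32) :- con (+ 16)) refl ⟩
      # 32 ⊟ # 16 ∎)
    (subst (_≢ 0#) (S.solve 0 (con (+ 16) := con (+ 32) :- con (+ 16)) refl) 16≢0)
    -- 1/2 = 2 · (1/2)², so 1/2 and 2 have the same character.
    (χ-≡ (# 2 ⁻¹) (⁻¹-≢0 2≢0) (begin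
      # 2 ⁻¹                    ≡⟨ S.solve 1 (λ h → h := con 1ℤ :* h) refl (# 2 ⁻¹) ⟩
      ι 1ℤ ⊠ # 2 ⁻¹            ≡⟨ cong (_⊠ # 2 ⁻¹) (trans ι-1 (sym (*-inverseʳ 2≢0))) ⟩
      # 2 ⊠ # 2 ⁻¹ ⊠ # 2 ⁻¹    ≡⟨ S.solve 1 (λ h → con (+ 2) :* h :* h := con (+ 2) :* (h :* h)) refl (# 2 ⁻¹) ⟩
      # 2 ⊠ (# 2 ⁻¹ ⊠ # 2 ⁻¹) ∎))
    (χ²≡1 2≢0) legendre[½]

  -- Outside `counts-regular`: e = 0 makes M = 1, and `δ (k ⊟ # 16)` is 1. The point with all
  -- coordinates -1/2 is fixed by every flip, which accounts for 6P - 7 in place of 6P - 8.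
  counts-16 : Counts (# 16) (P ^ 3 - + 1 - χ (ι -1ℤ) * P) (+ 4 * (P - + 3) ^ 2) (+ 6 * (P - + 2))
    (+ 4 * (P ^ 2 - + 3 * P + + 3)) (+ 6 * P - + 7)
  counts-16 = record
    { solutions = trans (#solutions≡ 16≢0 ke)
        (cong (_+_ (P ^ 3 - + 1)) (trans (cong (_* P) legendre[0]) (sym (ℤ.neg-distribˡ-* (χ (ι -1ℤ)) P))))
    ; moving₃   = trans (#moving₃ 16≢0 ke)
        (trans (cong₂ f₃ χ0 k≡16) (Z.solve 1 (λ P → let M = Z.con 1ℤ ; P-2 = P Z.:- Z.con (+ 2) in
        Z.con (+ 4) Z.:* (P-2 Z.:* P-2 Z.:+ P Z.:* M) Z.:- Z.con (+ 2) Z.:*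
            (Z.con (+ 6) Z.:* ((P Z.:- Z.con 1ℤ) Z.:* M))
          Z.:+ Z.con (+ 3) Z.:* (Z.con (+ 4) Z.:* M) Z.:- Z.con (+ 4) Z.:* Z.con 1ℤ
        Z.:= Z.con (+ 4) Z.:* (P Z.:- Z.con (+ 3)) Z.:^ 2) refl P))
    ; moving₂   = trans (#moving₂ 16≢0 ke) (trans (cong₂ f₂ χ0 k≡16) (Z.solve 1 (λ P → let M = Z.con 1ℤ in
        Z.con (+ 6) Z.:* ((P Z.:- Z.con 1ℤ) Z.:* M) Z.:- Z.con (+ 3) Z.:* (Z.con (+ 4) Z.:* M) Z.:+ Z.con (+ 6)
            Z.:* Z.con 1ℤ
        Z.:= Z.con (+ 6) Z.:* (P Z.:- Z.con (+ 2))) refl P))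
    ; moving₁   = trans (#moving₁ 16≢0 ke) (trans (cong₂ f₁ χ0 k≡16) (Z.solve 1 (λ P → let M = Z.con 1ℤ in
        Z.con (+ 4) Z.:* ((P Z.:- Z.con 1ℤ) Z.:* (P Z.:- Z.con (+ 2)) Z.:+ Z.con 1ℤ) Z.:+
            (Z.con (+ 4) Z.:* M Z.:- Z.con (+ 4) Z.:* Z.con 1ℤ)
        Z.:= Z.con (+ 4) Z.:* (P Z.:^ 2 Z.:- Z.con (+ 3) Z.:* P Z.:+ Z.con (+ 3))) refl P))
    ; moving₀   = trans (#moving₀ 16≢0 ke) (trans (cong (_+_ (+ 6 * P - + 8)) k≡16)
        (Z.solve 1 (λ P → Z.con (+ 6) Z.:* P Z.:- Z.con (+ 8) Z.:+ Z.con 1ℤ Z.:= Z.con (+ 6) Z.:* P Z.:- Z.con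
            (+ 7)) refl P))
    }
    where
    ke : # 16 ⊠ ι 0ℤ ≡ # 16 ⊟ # 16
    ke = S.solve 0 (con (+ 16) :* con 0ℤ := con (+ 16) :- con (+ 16)) refl
    χ0 : χ (ι 0ℤ) ≡ 0ℤ
    χ0 = χ-0 ι-0
    k≡16 : δ (# 16 ⊟ # 16) ≡ 1ℤ
    k≡16 = δ-≡0 (x≡y⇒x⊟y≡0 refl)
    f₁ f₂ f₃ : ℤ → ℤ → ℤ
    f₁ x t = + 4 * ((P - 1ℤ) * (P - + 2) + 1ℤ) + (+ 4 * (1ℤ + x) - + 4 * t)
    f₂ x t = + 6 * ((P - 1ℤ) * (1ℤ + x)) - + 3 * (+ 4 * (1ℤ + x)) + + 6 * t
    f₃ x t = + 4 * ((P - + 2) * (P - + 2) + P * (1ℤ + x)) - + 2 * (+ 6 * ((P - 1ℤ) * (1ℤ + x))) + + 3 *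
        (+ 4 * (1ℤ + x)) - + 4 * t

theorem15p3 : (p : ℕ) .{{_ : NonZero p}} → Prime p → 5 ≤ p →
    let σ[-1] = σ (reduce p (- + 1))
        σ[2]  = σ (reduce p (+ 2))
        φ     = φ₂⟨1⟩ p
        P     = + p
    in
    ( + #vertices p (+ 8)    ≡ P ^ 3 - + 1 + σ[2] * φ * P
    × + #degree p (+ 8) 3    ≡ + 4 * (P - + 3 - σ[-1]) ^ 2
    × + #degree p (+ 8) 2    ≡ + 6 * (+ 1 + σ[-1]) * (P - + 3)
    × + #degree p (+ 8) 1    ≡ + 4 * (P ^ 2 - + 3 * P + + 4 + σ[-1])
    × + #degree p (+ 8) 0    ≡ + 6 * P - + 8 )
    ×
    ( + #vertices p (+ 16)   ≡ P ^ 3 - + 1 - σ[-1] * P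
    × + #degree p (+ 16) 3   ≡ + 4 * (P - + 3) ^ 2
    × + #degree p (+ 16) 2   ≡ + 6 * (P - + 2)
    × + #degree p (+ 16) 1   ≡ + 4 * (P ^ 2 - + 3 * P + + 3)
    × + #degree p (+ 16) 0   ≡ + 6 * P - + 7 )
    ×
    ( + #vertices p (- + 16) ≡ P ^ 3 - + 1 + σ[2] * φ * P
    × + #degree p (- + 16) 3 ≡ + 4 * (P - + 3 - σ[2]) ^ 2
    × + #degree p (- + 16) 2 ≡ + 6 * (+ 1 + σ[2]) * (P - + 3)
    × + #degree p (- + 16) 1 ≡ + 4 * (P ^ 2 - + 3 * P + + 4 + σ[2])
    × + #degree p (- + 16) 0 ≡ + 6 * P - + 8 )
    ×
    ( + #vertices p (+ 32)   ≡ P ^ 3 - + 1 + φ * P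
    × + #degree p (+ 32) 3   ≡ + 4 * (P - + 3 - σ[2]) ^ 2
    × + #degree p (+ 32) 2   ≡ + 6 * (+ 1 + σ[2]) * (P - + 3)
    × + #degree p (+ 32) 1   ≡ + 4 * (P ^ 2 - + 3 * P + + 4 + σ[2])
    × + #degree p (+ 32) 0   ≡ + 6 * P - + 8 )
theorem15p3 p p-prime 5≤p = graph (+ 8) counts-8 , graph (+ 16) counts-16 , graph (- + 16) counts-[-16] , graph
    (+ 32) counts-32
  where
  2<p : 2 ℕ.< p
  2<p = ℕ.≤-trans (ℕ.s≤s (ℕ.s≤s (ℕ.s≤s ℕ.z≤n))) 5≤p
  open Parameters (𝔽-oddField p p-prime 2<p)
  graph : ∀ c {N d₃ d₂ d₁ d₀} → Counts (reduce p c) N d₃ d₂ d₁ d₀ →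
    + #vertices p c ≡ N × + #degree p c 3 ≡ d₃ × + #degree p c 2 ≡ d₂ × + #degree p c 1 ≡ d₁ × + #degree p c 0
        ≡ d₀
  graph c counts = trans #vertices≡ solutions , trans (#degree≡ 3) moving₃ , trans (#degree≡ 2) moving₂ ,
                   trans (#degree≡ 1) moving₁ , trans (#degree≡ 0) moving₀
    where
    open Graph p p-prime 2<p c
    open Counts counts
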